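{- There exists a polynomial function $p$ such that the following holds. Let $S=\langle Q,\{x_1,\dots,x_n\},\Delta,\Lambda\rangle$ be a flat affine counter system with the finite monoid property. For any run $\rho$ of $S$ starting in $(q_0,\vec v_0)$ and any iterated path schema $\langle P,\vec m\rangle\in\mathrm{ips}(\rho)$, there exist a run $\rho'$ of $S$ starting in $(q_0,\vec v_0)$ and an iterated path schema $\langle P,\vec m'\rangle\in\mathrm{ips}(\rho')$ (with the same path schema $P$) such that $\|\vec m'\|_\infty\le 2^{p(|S|+|\vec v_0|)}$.
   Context: An affine counter system of dimension $n$ is $S=\langle Q,\{x_1,\dots,x_n\},\Delta,\Lambda\rangle$ with finite state set $Q$, labeling $\Lambda:Q\to 2^{\mathsf{AP}}$, and finite set $\Delta$ of transition rules $\delta=\langle q,g,f,q'\rangle$ where $g$ is a guard (a finite, possibly empty, conjunction of integer linear inequalities $\vec C\vec x\le\vec d$) and $f=(\vec A,\vec b)\in\mathbb Z^{n\times n}\times\mathbb Z^n$ is an affine update $f(\vec v)=\vec A\vec v+\vec b$; $q$ is the source and $q'$ the target of $\delta$. Configurations are $(q,\vec v)\in Q\times\mathbb Z^n$; $(q,\vec v)\xrightarrow{\delta}(q',\vec v')$ iff $\vec v$ satisfies $g$ and $\vec v'=f(\vec v)$. A run is an infinite sequence $\gamma_0\xrightarrow{\delta_0}\gamma_1\xrightarrow{\delta_1}\cdots$, and $\mathrm{trans}(\rho)=\delta_0\delta_1\cdots$ is its sequence of rules; counter systems are assumed deadlock-free. A path is a nonempty sequence of rules where each rule's target equals the next rule's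 source; a simple cycle is a path of pairwise distinct rules whose last target equals its first source. $S$ is flat if every state is the source of at most one simple cycle; $S$ has the finite monoid property if the monoid generated under matrix product by $\mathbf I_n$ and the matrices occurring in updates of $S$ is finite. A path schema is a sequence $P=u_1\dots u_N$ where each $u_i$ is a transition rule or a simple cycle, the $u_i$ are pairwise distinct, $u_N$ is a simple cycle, and the target of $u_i$ is the source of $u_{i+1}$. An iterated path schema is a pair $\langle P,\vec m\rangle$ with $\vec m\in\mathbb N^{N-1}$, $\vec m[i]\ge1$ for all $i$, and $\vec m[i]>1$ only if $u_i$ is a cycle; it defines the infinite word $u_1^{\vec m[1]}\cdots u_{N-1}^{\vec m[N-1]}u_N^\omega$ over $\Delta$. For a run $\rho$, $\mathrm{ips}(\rho)$ is the set of iterated path schemas whose word equals $\mathrm{trans}(\rho)$. $|S|$ and $|\vec v_0|$ denote sizes with integers encoded in binary; $\|\vec m\|_\infty=\max_i|\vec m[i]|$. -}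

module Defs where

open import Data.Nat as ℕ using (ℕ; zero; suc; _⊔_; _≤_)
open import Data.Nat.DivMod using (_mod_)
open import Data.Nat.ListAction using (sum)
open import Data.Nat.Logarithm using (⌈log₂_⌉)
open import Data.Integer as ℤ using (ℤ; ∣_∣)
open import Data.Fin using (Fin; _≟_)
open import Data.Fin.Subset using (Subset)
open import Data.Vec as Vec using (Vec; []; _∷_)
open import Data.List as List using (List; []; _∷_; _++_; length; lookup)
open import Data.List.NonEmpty as List⁺ using (List⁺; _∷_)
open import Data.List.Relation.Unary.All using (All)
open import Data.List.Relation.Unary.Unique.Propositional using (Unique)
open import Data.List.Membership.Propositional using (_∈_)
open import Data.Product using (Σ; _×_; _,_; proj₁; proj₂; ∃)
open import Data.Unit using (⊤)
open import Relation.Binary.PropositionalEquality using (_≡_)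
open import Relation.Nullary using (yes; no)
open import Function.Definitions using (Injective)

Matrix : ℕ → Set
Matrix n = Vec (Vec ℤ n) n

dot : ∀ {n} → Vec ℤ n → Vec ℤ n → ℤ
dot u v = Vec.foldr _ ℤ._+_ (ℤ.+ 0) (Vec.zipWith ℤ._*_ u v)

_·ᵥ_ : ∀ {n} → Matrix n → Vec ℤ n → Vec ℤ n
A ·ᵥ v = Vec.map (λ row → dot row v) A

_⊗_ : ∀ {n} → Matrix n → Matrix n → Matrix n
A ⊗ B = Vec.map (λ row → Vec.map (dot row) (Vec.transpose B)) A

identity : ∀ n → Matrix n
identity n = Vec.tabulate λ i → Vec.tabulate λ j → δij i j
  where
  δij : Fin n → Fin n → ℤ
  δij i j with i ≟ j
  ... | yes _ = ℤ.+ 1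
  ... | no _  = ℤ.+ 0

Guard : ℕ → Set
Guard n = List (Vec ℤ n × ℤ)

Sat : ∀ {n} → Guard n → Vec ℤ n → Set
Sat g v = All (λ cd → dot (proj₁ cd) v ℤ.≤ proj₂ cd) g

record Rule (nQ n : ℕ) : Set where
  constructor rule
  field
    src   : Fin nQ
    guard : Guard n
    A     : Matrix n
    b     : Vec ℤ n
    tgt   : Fin nQ

open Rule public

update : ∀ {nQ n} → Rule nQ n → Vec ℤ n → Vec ℤ n
update r v = Vec.zipWith ℤ._+_ (A r ·ᵥ v) (b r)

record CounterSystem (nQ nAP n nR : ℕ) : Set where
  field
    Λ : Fin nQ → Subset nAP
    Δ : Fin nR → Rule nQ n

open CounterSystem public

module _ {nQ nAP n nR : ℕ} (S : CounterSystem nQ nAP n nR) where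

  Config : Set
  Config = Fin nQ × Vec ℤ n

  Step : Config → Fin nR → Config → Set
  Step (q , v) δ (q' , v') =
    src (Δ S δ) ≡ q × Sat (guard (Δ S δ)) v × tgt (Δ S δ) ≡ q'
      × v' ≡ update (Δ S δ) v

  -- Δ is a set: distinct indices denote distinct rules
  RulesDistinct : Set
  RulesDistinct = Injective _≡_ _≡_ (Δ S)

  DeadlockFree : Set
  DeadlockFree = ∀ (c : Config) → ∃ λ δ → ∃ λ c' → Step c δ c'

  record Run : Set where
    field
      conf  : ℕ → Config
      trans : ℕ → Fin nR
      step  : ∀ i → Step (conf i) (trans i) (conf (suc i))

  open Run public

  StartsIn : Run → Config → Set
  StartsIn ρ γ = conf ρ 0 ≡ γ

  Linked : List (Fin nR) → Set
  Linked [] = ⊤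
  Linked (x ∷ []) = ⊤
  Linked (x ∷ y ∷ r) = tgt (Δ S x) ≡ src (Δ S y) × Linked (y ∷ r)

  IsPath : List⁺ (Fin nR) → Set
  IsPath c = Linked (List⁺.toList c)

  SimpleCycle : List⁺ (Fin nR) → Set
  SimpleCycle c = IsPath c × Unique (List⁺.toList c)
                  × tgt (Δ S (List⁺.last c)) ≡ src (Δ S (List⁺.head c))

  Flat : Set
  Flat = ∀ (c c' : List⁺ (Fin nR)) → SimpleCycle c → SimpleCycle c'
         → src (Δ S (List⁺.head c)) ≡ src (Δ S (List⁺.head c')) → c ≡ c'

  matProd : List (Fin nR) → Matrix n
  matProd [] = identity n
  matProd (δ ∷ w) = A (Δ S δ) ⊗ matProd w

  FiniteMonoid : Set
  FiniteMonoid = ∃ λ (L : List (Matrix n)) → ∀ (w : List (Fin nR)) → matProd w ∈ L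

data Elem (nR : ℕ) : Set where
  rl : Fin nR → Elem nR
  cy : List⁺ (Fin nR) → Elem nR

elemWord : ∀ {nR} → Elem nR → List (Fin nR)
elemWord (rl δ) = δ ∷ []
elemWord (cy c) = List⁺.toList c

-- P = u₁ … u_{N-1} u_N  with  pre = u₁ … u_{N-1}  and  loop = u_N
record PathSchema (nR : ℕ) : Set where
  constructor pathSchema
  field
    pre  : List (Elem nR)
    loop : List⁺ (Fin nR)

open PathSchema public

allElems : ∀ {nR} → PathSchema nR → List (Elem nR)
allElems P = pre P ++ (cy (loop P) ∷ [])

module _ {nQ nAP n nR : ℕ} (S : CounterSystem nQ nAP n nR) where

  elemSrc : Elem nR → Fin nQ
  elemSrc (rl δ) = src (Δ S δ)
  elemSrc (cy c) = src (Δ S (List⁺.head c))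

  elemTgt : Elem nR → Fin nQ
  elemTgt (rl δ) = tgt (Δ S δ)
  elemTgt (cy c) = tgt (Δ S (List⁺.last c))

  ElemOK : Elem nR → Set
  ElemOK (rl δ) = ⊤
  ElemOK (cy c) = SimpleCycle S c

  LinkedElems : List (Elem nR) → Set
  LinkedElems [] = ⊤
  LinkedElems (u ∷ []) = ⊤
  LinkedElems (u ∷ u' ∷ r) = elemTgt u ≡ elemSrc u' × LinkedElems (u' ∷ r)

  IsPathSchema : PathSchema nR → Set
  IsPathSchema P = All ElemOK (allElems P) × Unique (allElems P)
                   × LinkedElems (allElems P)

ValidIter : ∀ {nR} (us : List (Elem nR)) → Vec ℕ (length us) → Set
ValidIter [] [] = ⊤
ValidIter (rl δ ∷ us) (k ∷ ks) = k ≡ 1 × ValidIter us ks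
ValidIter (cy c ∷ us) (k ∷ ks) = 1 ≤ k × ValidIter us ks

prefixWord : ∀ {nR} (us : List (Elem nR)) → Vec ℕ (length us) → List (Fin nR)
prefixWord [] [] = []
prefixWord (u ∷ us) (k ∷ ks) =
  List.concat (List.replicate k (elemWord u)) ++ prefixWord us ks

cycleAt : ∀ {nR} → List⁺ (Fin nR) → ℕ → Fin nR
cycleAt (δ ∷ r) k = lookup (δ ∷ r) (k mod suc (length r))

infWord : ∀ {nR} → List (Fin nR) → List⁺ (Fin nR) → ℕ → Fin nR
infWord [] c k = cycleAt c k
infWord (x ∷ w) c zero = x
infWord (x ∷ w) c (suc k) = infWord w c k

ipsWord : ∀ {nR} (P : PathSchema nR) → Vec ℕ (length (pre P)) → ℕ → Fin nR
ipsWord P m = infWord (prefixWord (pre P) m) (loop P)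

InIPS : ∀ {nQ nAP n nR} (S : CounterSystem nQ nAP n nR) → Run S
        → (P : PathSchema nR) → Vec ℕ (length (pre P)) → Set
InIPS S ρ P m = IsPathSchema S P × ValidIter (pre P) m
                × (∀ k → Run.trans ρ k ≡ ipsWord P m k)

‖_‖∞ : ∀ {k} → Vec ℕ k → ℕ
‖ m ‖∞ = Vec.foldr _ _⊔_ 0 m

bits : ℤ → ℕ
bits z = suc ⌈log₂ (suc ∣ z ∣) ⌉

sizeVec : ∀ {n} → Vec ℤ n → ℕ
sizeVec v = Vec.foldr _ ℕ._+_ 0 (Vec.map bits v)

sizeGuard : ∀ {n} → Guard n → ℕ
sizeGuard g = sum (List.map (λ cd → sizeVec (proj₁ cd) ℕ.+ bits (proj₂ cd)) g)

sizeMatrix : ∀ {n} → Matrix n → ℕ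
sizeMatrix M = Vec.foldr _ ℕ._+_ 0 (Vec.map sizeVec M)

sizeRule : ∀ {nQ n} → Rule nQ n → ℕ
sizeRule r = 3 ℕ.+ sizeGuard (guard r) ℕ.+ sizeMatrix (A r) ℕ.+ sizeVec (b r)

sizeCS : ∀ {nQ nAP n nR} → CounterSystem nQ nAP n nR → ℕ
sizeCS {nQ} {nAP} {n} {nR} S =
  nQ ℕ.+ nAP ℕ.+ n ℕ.+ nQ ℕ.* nAP ℕ.+
  sum (List.map (λ i → sizeRule (Δ S i)) (List.allFin nR))

Poly : Set
Poly = List ℕ

evalPoly : Poly → ℕ → ℕ
evalPoly [] x = 0
evalPoly (a ∷ as) x = a ℕ.+ x ℕ.* evalPoly as x

{-# OPTIONS --safe #-}
-- A run through a fixed path schema is replaced by one with small iteration counts by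
-- solving a system of integer inequalities with few unknowns and small coefficients.
--
-- Acceleration.  Let F v = M v + c be the effect of a cycle.  By the finite monoid property
-- the powers of M are eventually periodic, hence F^(j+π) v = F^j v + D for all j ≥ α, with a
-- constant drift D.  Writing each count as ρ + π y makes every visited configuration affine
-- in the unknowns y, and since guards are convex only the first and the last round of each
-- residue class modulo π must be tested.
--
-- Bounding the powers.  Each entry f(k) of M^k satisfies a linear recurrence of order at
-- most n.  If λ f(k+i) = Σ rⱼ f(j+i) for all i with some |rⱼ₀| much larger than |λ|, Dirichlet
-- approximation of the rⱼ / |rⱼ₀| gives an integer combination z ≠ 0 of the shifts that equals
-- a rational combination of shifts of total weight < 1.  On integer sequences such a z is
-- nilpotent, on periodic sequences it is normal, hence z f = 0 is a shorter recurrence.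
-- So rⱼ / λ, and with it f(k), is singly exponential, and a pigeonhole argument then
-- bounds α and π.
--
-- Small solutions.  Call a row tight at a solution y if its slack is small.  As long as the
-- independent tight rows found so far do not span, Siegel's lemma yields a small g ≠ 0 in
-- their kernel, and y can be moved along g until a new independent row becomes tight.  Full
-- rank then bounds y by Siegel's lemma applied to the transpose.
module Submission where

open import Data.Nat using (ℕ; zero; suc; _≤_; _<_; _+_; _*_; _^_; z≤n; s≤s)
import Data.Nat as ℕ
import Data.Nat.Properties as ℕ
open import Data.Integer as ℤ using (ℤ; +_; -[1+_]; ∣_∣; 0ℤ; 1ℤ)
import Data.Integer.Properties as ℤ
import Data.Integer.Tactic.RingSolver as ℤ-Ring
import Data.Nat.Tactic.RingSolver as ℕ-Ring
open import Data.Fin as Fin using (Fin; zero; suc; toℕ; fromℕ<; finToFun; funToFin; combine)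
import Data.Fin.Properties as Fin
open import Data.Product using (Σ; _×_; _,_; proj₁; proj₂; ∃; ∃₂)
open import Data.Sum using (_⊎_; inj₁; inj₂; [_,_]′)
open import Data.Unit using (⊤; tt)
open import Data.Empty using (⊥-elim)
open import Data.List as List using (List; []; _∷_; _++_; length; foldl; foldr; concat; replicate; reverse)
import Data.List.Properties as List
open import Data.List.NonEmpty as List⁺ using (List⁺; _∷_)
open import Data.Vec as Vec using (Vec; []; _∷_; lookup; tabulate; zipWith; transpose; _⊛_)
import Data.Vec.Properties as Vec
open import Data.List.Relation.Unary.All as All using (All; []; _∷_)
import Data.List.Relation.Unary.All.Properties as All
open import Data.List.Relation.Unary.Any as Any using (any?)
import Data.List.Relation.Unary.Any.Properties as Any
open import Data.List.Membership.Propositional using (_∈_; find; lose)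
open import Function using (_∘_; id)
open import Relation.Nullary using (¬_; Dec; yes; no; contradiction)
open import Relation.Nullary.Decidable using (_×-dec_; ¬?)
open import Relation.Binary.PropositionalEquality
open import Algebra.Properties.Semiring.Sum ℤ.+-*-semiring
  using (sum; sum-cong-≗; ∑-distrib-+; ∑-comm; *-distribˡ-sum; *-distribʳ-sum; sum-replicate-zero; sum-init-last)
open import Relation.Binary.Definitions using (tri<; tri≈; tri>)
open import Algebra.Properties.AbelianGroup ℤ.+-0-abelianGroup
  using () renaming (∙-cancelʳ to +-cancelʳ; ∙-cancelˡ to +-cancelˡ)
import Data.Nat.DivMod as ℕ
import Data.Integer.DivMod as ℤ
open import Data.Nat.Induction using (<-rec)
import Data.Nat.ListAction as ℕ
open import Data.Nat.Logarithm using (⌈log₂_⌉; ⌈log₂⌉-mono-≤; ⌈log₂⌈n/2⌉⌉≡⌈log₂n⌉∸1)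
open import Data.Sum.Properties using (inj₁-injective; inj₂-injective)
open import Data.List.Relation.Unary.Unique.Propositional using (Unique)
open import Data.List.Relation.Unary.AllPairs using ([]; _∷_)
open import Data.List.Membership.Propositional.Properties using (∈-lookup; ∈-allFin; ∈-++⁺ʳ)
open import Defs hiding (trans)

-- That the monoid is finite yields an eventual period for the powers of a cycle's matrix, but no
-- estimate of it. The obvious bound (n X)^k on the entries of the k-th power is doubly exponential
-- once k is exponential. The entries are therefore bounded through their recurrences, by a quantity
-- in which neither k nor the period occurs; only then does counting the possible matrices give a
-- short period.
--
-- The linear system has one unknown for each element before the last cycle, and flatness keeps
-- their number polynomial. It may have exponentially many rows, since guards are tested in every
-- residue class. The bound on small solutions must thus depend on the number of unknowns and the
-- size of the coefficients alone, which the descent along tight rows achieves.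
--
-- The last cycle has no count and infinitely many iterations. Its drift does not depend on the
-- starting vector, so the original run, which satisfies the guards forever, shows that no guard
-- gets closer to failing along the drift. This leaves finitely many iterations to test.

-- Linear algebra over the integers

∣sum∣≤ : ∀ {n B} (f : Fin n → ℤ) → (∀ i → ∣ f i ∣ ≤ B) → ∣ sum f ∣ ≤ n * B
∣sum∣≤ {zero}  f f≤B = z≤n
∣sum∣≤ {suc n} f f≤B = ℕ.≤-trans (ℤ.∣i+j∣≤∣i∣+∣j∣ (f zero) (sum (f ∘ suc)))
  (ℕ.+-mono-≤ (f≤B zero) (∣sum∣≤ (f ∘ suc) (f≤B ∘ suc)))

∣*∣≤ : ∀ {B C} i j → ∣ i ∣ ≤ B → ∣ j ∣ ≤ C → ∣ i ℤ.* j ∣ ≤ B * C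
∣*∣≤ i j p q = ℕ.≤-trans (ℕ.≤-reflexive (ℤ.∣i*j∣≡∣i∣*∣j∣ i j)) (ℕ.*-mono-≤ p q)

∣+∣≤ : ∀ {B C} i j → ∣ i ∣ ≤ B → ∣ j ∣ ≤ C → ∣ i ℤ.+ j ∣ ≤ B + C
∣+∣≤ i j p q = ℕ.≤-trans (ℤ.∣i+j∣≤∣i∣+∣j∣ i j) (ℕ.+-mono-≤ p q)

∣-∣≤ : ∀ {B C} i j → ∣ i ∣ ≤ B → ∣ j ∣ ≤ C → ∣ i ℤ.- j ∣ ≤ B + C
∣-∣≤ i j p q = ℕ.≤-trans (ℤ.∣i-j∣≤∣i∣+∣j∣ i j) (ℕ.+-mono-≤ p q)

i*j≢0 : ∀ {i j} → i ≢ 0ℤ → j ≢ 0ℤ → i ℤ.* j ≢ 0ℤ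
i*j≢0 {i} i≢0 j≢0 eq = [ i≢0 , j≢0 ]′ (ℤ.i*j≡0⇒i≡0∨j≡0 i eq)

infix 8 _∙_

_∙_ : ∀ {n} → (Fin n → ℤ) → (Fin n → ℤ) → ℤ
a ∙ x = sum λ j → a j ℤ.* x j

∣∙∣≤ : ∀ {n B C} (a x : Fin n → ℤ) → (∀ i → ∣ a i ∣ ≤ B) → (∀ i → ∣ x i ∣ ≤ C) → ∣ a ∙ x ∣ ≤ n * (B * C)
∣∙∣≤ a x p q = ∣sum∣≤ _ λ i → ∣*∣≤ (a i) (x i) (p i) (q i)

∙-congʳ : ∀ {n} (a : Fin n → ℤ) {x y} → x ≗ y → a ∙ x ≡ a ∙ y
∙-congʳ a eq = sum-cong-≗ λ i → cong (a i ℤ.*_) (eq i)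

∙-congˡ : ∀ {n} {a b : Fin n → ℤ} x → a ≗ b → a ∙ x ≡ b ∙ x
∙-congˡ x eq = sum-cong-≗ λ i → cong (ℤ._* x i) (eq i)

∙-distrib-+ : ∀ {n} (a x y : Fin n → ℤ) → a ∙ (λ i → x i ℤ.+ y i) ≡ a ∙ x ℤ.+ a ∙ y
∙-distrib-+ {n} a x y = trans (sum-cong-≗ {n} λ i → ℤ.*-distribˡ-+ (a i) (x i) (y i))
  (∑-distrib-+ {n} (λ i → a i ℤ.* x i) (λ i → a i ℤ.* y i))

∙-scaleʳ : ∀ {n} c (a x : Fin n → ℤ) → a ∙ (λ i → c ℤ.* x i) ≡ c ℤ.* a ∙ x
∙-scaleʳ {n} c a x = trans (sum-cong-≗ {n} λ i → swap (a i) c (x i)) (sym (*-distribˡ-sum {n} c λ i → a i ℤ.* x i))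
  where
  swap : ∀ p q r → p ℤ.* (q ℤ.* r) ≡ q ℤ.* (p ℤ.* r)
  swap = ℤ-Ring.solve-∀

∙-scaleˡ : ∀ {n} c (a x : Fin n → ℤ) → (λ i → c ℤ.* a i) ∙ x ≡ c ℤ.* a ∙ x
∙-scaleˡ {n} c a x = trans (sum-cong-≗ {n} λ i → ℤ.*-assoc c (a i) (x i)) (sym (*-distribˡ-sum {n} c λ i → a i ℤ.* x i))

∙-distrib-- : ∀ {n} (a x y : Fin n → ℤ) → a ∙ (λ i → x i ℤ.- y i) ≡ a ∙ x ℤ.- a ∙ y
∙-distrib-- a x y = begin
  a ∙ (λ i → x i ℤ.- y i)               ≡⟨ ∙-distrib-+ a x (λ i → ℤ.- y i) ⟩
  a ∙ x ℤ.+ a ∙ (λ i → ℤ.- y i)         ≡⟨ cong (λ t → a ∙ x ℤ.+ t) (∙-congʳ a λ i → sym (ℤ.-1*i≡-i (y i))) ⟩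
  a ∙ x ℤ.+ a ∙ (λ i → ℤ.-1ℤ ℤ.* y i)   ≡⟨ cong (λ t → a ∙ x ℤ.+ t) (∙-scaleʳ ℤ.-1ℤ a y) ⟩
  a ∙ x ℤ.+ ℤ.-1ℤ ℤ.* a ∙ y             ≡⟨ cong (λ t → a ∙ x ℤ.+ t) (ℤ.-1*i≡-i (a ∙ y)) ⟩
  a ∙ x ℤ.- a ∙ y                       ∎
  where open ≡-Reasoning

∙-comm : ∀ {n} (a b : Fin n → ℤ) → a ∙ b ≡ b ∙ a
∙-comm a b = sum-cong-≗ λ i → ℤ.*-comm (a i) (b i)

∙-zeroʳ : ∀ {n} (a : Fin n → ℤ) {x} → (∀ i → x i ≡ 0ℤ) → a ∙ x ≡ 0ℤ
∙-zeroʳ {n} a x≡0 = trans (sum-cong-≗ λ i → trans (cong (a i ℤ.*_) (x≡0 i)) (ℤ.*-zeroʳ (a i))) (sum-replicate-zero n)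

∙-assoc : ∀ {m n} (l : Fin m → ℤ) (M : Fin m → Fin n → ℤ) (x : Fin n → ℤ) →
  (λ j → l ∙ (λ i → M i j)) ∙ x ≡ l ∙ (λ i → M i ∙ x)
∙-assoc {m} {n} l M x = begin
  sum (λ j → sum (λ i → l i ℤ.* M i j) ℤ.* x j)    ≡⟨ sum-cong-≗ {n} (λ j → *-distribʳ-sum {m} (x j) λ i → l i ℤ.* M i j) ⟩
  sum (λ j → sum (λ i → l i ℤ.* M i j ℤ.* x j))    ≡⟨ ∑-comm {n} {m} (λ j i → l i ℤ.* M i j ℤ.* x j) ⟩
  sum (λ i → sum (λ j → l i ℤ.* M i j ℤ.* x j))    ≡⟨ sum-cong-≗ {m} (λ i → sum-cong-≗ {n} λ j → ℤ.*-assoc (l i) (M i j) (x j)) ⟩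
  sum (λ i → sum (λ j → l i ℤ.* (M i j ℤ.* x j)))  ≡⟨ sum-cong-≗ {m} (λ i → sym (*-distribˡ-sum {n} (l i) λ j → M i j ℤ.* x j)) ⟩
  sum (λ i → l i ℤ.* (M i ∙ x))                    ∎
  where open ≡-Reasoning

δ : ∀ {n} → Fin n → Fin n → ℤ
δ zero    zero    = 1ℤ
δ zero    (suc j) = 0ℤ
δ (suc i) zero    = 0ℤ
δ (suc i) (suc j) = δ i j

δ-∙ : ∀ {n} (i : Fin n) x → δ i ∙ x ≡ x i
δ-∙ {suc n} zero    x = begin
  1ℤ ℤ.* x zero ℤ.+ sum (λ j → 0ℤ ℤ.* x (suc j)) ≡⟨ cong₂ ℤ._+_ (ℤ.*-identityˡ (x zero)) (trans (sum-cong-≗ {n} λ j → refl) (sum-replicate-zero n)) ⟩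
  x zero ℤ.+ 0ℤ                                 ≡⟨ ℤ.+-identityʳ (x zero) ⟩
  x zero                                        ∎
  where open ≡-Reasoning
δ-∙ (suc i) x = trans (ℤ.+-identityˡ _) (δ-∙ i (x ∘ suc))

∣δ∣≤1 : ∀ {n} (i j : Fin n) → ∣ δ i j ∣ ≤ 1
∣δ∣≤1 zero    zero    = ℕ.≤-refl
∣δ∣≤1 zero    (suc j) = z≤n
∣δ∣≤1 (suc i) zero    = z≤n
∣δ∣≤1 (suc i) (suc j) = ∣δ∣≤1 i j

-- Pigeonhole principle on boxes and Siegel's lemma

0≤i+C : ∀ {C} i → ∣ i ∣ ≤ C → 0ℤ ℤ.≤ i ℤ.+ + C
0≤i+C (+ n)    _ = ℤ.+≤+ z≤n
0≤i+C {C} -[1+ n ] p = subst (0ℤ ℤ.≤_) (sym (ℤ.⊖-≥ p)) (ℤ.+≤+ z≤n)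

encode : ∀ C i → ∣ i ∣ ≤ C → Fin (suc (C + C))
encode C i p = fromℕ< {∣ i ℤ.+ + C ∣} (s≤s (∣+∣≤ i (+ C) p ℕ.≤-refl))

opaque
  encode-injective : ∀ {C i j} p q → encode C i p ≡ encode C j q → i ≡ j
  encode-injective {C} {i} {j} p q eq = +-cancelʳ (+ C) i j (begin
    i ℤ.+ + C         ≡⟨ sym (ℤ.0≤i⇒+∣i∣≡i (0≤i+C i p)) ⟩
    + ∣ i ℤ.+ + C ∣   ≡⟨ cong +_ (trans (sym (Fin.toℕ-fromℕ< _)) (trans (cong toℕ eq) (Fin.toℕ-fromℕ< _))) ⟩
    + ∣ j ℤ.+ + C ∣   ≡⟨ ℤ.0≤i⇒+∣i∣≡i (0≤i+C j q) ⟩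
    j ℤ.+ + C         ∎)
    where open ≡-Reasoning

funToFin-cong : ∀ {m n} {f g : Fin m → Fin n} → f ≗ g → funToFin f ≡ funToFin g
funToFin-cong {zero}  eq = refl
funToFin-cong {suc m} eq = cong₂ combine (eq zero) (funToFin-cong (eq ∘ suc))

opaque
  -- The box of integer vectors with r entries between -C and C has (2C + 1)^r points. This one
  -- count serves Siegel's lemma, Dirichlet approximation and the period of matrix powers.
  pigeonhole-box : ∀ {r N} C (g : Fin N → Fin r → ℤ) → (∀ p i → ∣ g p i ∣ ≤ C) →
    suc (C + C) ^ r < N → ∃₂ λ p q → p Fin.< q × g p ≗ g q
  pigeonhole-box C g bd N> with Fin.pigeonhole N> (λ p → funToFin λ i → encode C (g p i) (bd p i))
  ... | p , q , p<q , eq = p , q , p<q , λ i → encode-injective (bd p i) (bd q i)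
    (trans (sym (Fin.finToFun-funToFin (λ i → encode C (g p i) (bd p i)) i))
      (trans (cong (λ k → finToFun k i) eq) (Fin.finToFun-funToFin (λ i → encode C (g q i) (bd q i)) i)))

opaque
  ^-distribʳ-* : ∀ m n k → (m * n) ^ k ≡ m ^ k * n ^ k
  ^-distribʳ-* m n zero    = refl
  ^-distribʳ-* m n (suc k) = trans (cong (m * n *_) (^-distribʳ-* m n k)) (ℕ.[m*n]*[o*p]≡[m*o]*[n*p] m n (m ^ k) (n ^ k))

siegelBound : ℕ → ℕ → ℕ → ℕ
siegelBound r s H = suc (2 * (s * H)) ^ r

opaque
  -- Two points of the cube with coordinates from 0 to B have the same image under `M`, and their
  -- difference is the kernel vector. The images lie in a box of radius C = s H B, and B = (2sH +
  -- 1)^r makes (2C + 1)^r at most B (B + 1)^r, which is less than (B + 1)^(r + 1). The exponent r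
  -- in place of the classical r / (s - r) keeps B an integer.
  siegel : ∀ {r s} H (M : Fin r → Fin s → ℤ) → (∀ i j → ∣ M i j ∣ ≤ H) → r < s →
    Σ (Fin s → ℤ) λ x → (∃ λ j → x j ≢ 0ℤ) × (∀ j → ∣ x j ∣ ≤ siegelBound r s H) × (∀ i → M i ∙ x ≡ 0ℤ)
  siegel {r} {s} H M M≤H r<s = x , x≢0 , x≤B , Mx≡0
    where
    B C : ℕ
    B = siegelBound r s H
    C = s * (H * B)

    point : Fin (suc B ^ s) → Fin s → ℤ
    point p j = + toℕ (finToFun p j)

    point≤B : ∀ p j → ∣ point p j ∣ ≤ B
    point≤B p j = ℕ.≤-pred (Fin.toℕ<n (finToFun p j))

    count : suc (C + C) ^ r < suc B ^ s
    count = begin-strict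
      suc (C + C) ^ r                      ≤⟨ ℕ.^-monoˡ-≤ r (s≤s (ℕ.≤-trans (ℕ.m≤m+n (C + C) (B + 2 * (s * H))) (ℕ.≤-reflexive (lhs s H B)))) ⟩
      (suc (2 * (s * H)) * suc B) ^ r      ≡⟨ ^-distribʳ-* (suc (2 * (s * H))) (suc B) r ⟩
      B * suc B ^ r                        <⟨ ℕ.*-monoˡ-< (suc B ^ r) {{ℕ.m^n≢0 (suc B) r}} (ℕ.n<1+n B) ⟩
      suc B ^ suc r                        ≤⟨ ℕ.^-monoʳ-≤ (suc B) r<s ⟩
      suc B ^ s                            ∎
      where
      open ℕ.≤-Reasoning
      lhs : ∀ s H B → s * (H * B) + s * (H * B) + (B + 2 * (s * H)) ≡ B + 2 * (s * H) * suc B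
      lhs = ℕ-Ring.solve-∀

    collision : ∃₂ λ p q → p Fin.< q × (λ i → M i ∙ point p) ≗ (λ i → M i ∙ point q)
    collision = pigeonhole-box C (λ p i → M i ∙ point p) (λ p i → ∣∙∣≤ (M i) (point p) (M≤H i) (point≤B p)) count

    p q : Fin (suc B ^ s)
    p = proj₁ collision
    q = proj₁ (proj₂ collision)

    x : Fin s → ℤ
    x j = point p j ℤ.- point q j

    Mx≡0 : ∀ i → M i ∙ x ≡ 0ℤ
    Mx≡0 i = trans (∙-distrib-- (M i) (point p) (point q)) (ℤ.i≡j⇒i-j≡0 (proj₂ (proj₂ (proj₂ collision)) i))

    x≤B : ∀ j → ∣ x j ∣ ≤ B
    x≤B j = ℕ.≤-trans (ℕ.≤-reflexive (cong ∣_∣ (ℤ.m-n≡m⊖n (toℕ (finToFun p j)) (toℕ (finToFun q j)))))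
      (ℕ.≤-trans (ℤ.∣m⊝n∣≤m⊔n (toℕ (finToFun p j)) (toℕ (finToFun q j))) (ℕ.⊔-lub (point≤B p j) (point≤B q j)))

    x≢0 : ∃ λ j → x j ≢ 0ℤ
    x≢0 = Fin.¬∀⟶∃¬ s _ (λ j → x j ℤ.≟ 0ℤ) λ x≡0 → Fin.<⇒≢ (proj₁ (proj₂ (proj₂ collision)))
      (trans (sym (Fin.funToFin-finToFin {s} p)) (trans (funToFin-cong λ j →
        Fin.toℕ-injective (ℤ.+-injective (ℤ.i-j≡0⇒i≡j _ _ (x≡0 j)))) (Fin.funToFin-finToFin {s} q)))

-- Small solutions of systems of integer inequalities

Row : ℕ → Set
Row K = (Fin K → ℤ) × ℤ

Holds : ∀ {K} → (Fin K → ℤ) → Row K → Set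
Holds y (a , b) = a ∙ y ℤ.≤ b

RowBounded : ∀ {K} → ℕ → Row K → Set
RowBounded H (a , b) = (∀ j → ∣ a j ∣ ≤ H) × ∣ b ∣ ≤ H

Independent : ∀ {r K} → (Fin r → Fin K → ℤ) → Set
Independent {r} rows = ∀ l → (∀ j → l ∙ (λ i → rows i j) ≡ 0ℤ) → ∀ i → l i ≡ 0ℤ

infixr 5 _◂_

_◂_ : ∀ {r} {A : Set} → A → (Fin r → A) → Fin (suc r) → A
(a ◂ rows) zero    = a
(a ◂ rows) (suc i) = rows i

-- A vector g annihilating the old rows but not the new one certifies that independence persists.
opaque
  Independent-◂ : ∀ {r K} {rows : Fin r → Fin K → ℤ} a g → Independent rows →
    (∀ i → rows i ∙ g ≡ 0ℤ) → a ∙ g ≢ 0ℤ → Independent (a ◂ rows)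
  Independent-◂ {r} {K} {rows} a g indep rows∙g a∙g l comb = go
    where
    open ≡-Reasoning
    l₀≡0 : l zero ≡ 0ℤ
    l₀≡0 with l zero ℤ.≟ 0ℤ
    ... | yes p = p
    ... | no ¬p = contradiction (begin
      l zero ℤ.* a ∙ g                                    ≡⟨ sym (ℤ.+-identityʳ _) ⟩
      l zero ℤ.* a ∙ g ℤ.+ 0ℤ                             ≡⟨ cong (λ t → l zero ℤ.* a ∙ g ℤ.+ t) (sym (∙-zeroʳ (l ∘ suc) rows∙g)) ⟩
      l ∙ (λ i → (a ◂ rows) i ∙ g)                        ≡⟨ sym (∙-assoc l (a ◂ rows) g) ⟩
      (λ j → l ∙ (λ i → (a ◂ rows) i j)) ∙ g              ≡⟨ ∙-comm (λ j → l ∙ (λ i → (a ◂ rows) i j)) g ⟩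
      g ∙ (λ j → l ∙ (λ i → (a ◂ rows) i j))              ≡⟨ ∙-zeroʳ g comb ⟩
      0ℤ                                                  ∎) (i*j≢0 ¬p a∙g)

    go : ∀ i → l i ≡ 0ℤ
    go zero    = l₀≡0
    go (suc i) = indep (l ∘ suc) (λ j → begin
      (l ∘ suc) ∙ (λ i → rows i j)                              ≡⟨ sym (ℤ.+-identityˡ _) ⟩
      0ℤ ℤ.+ (l ∘ suc) ∙ (λ i → rows i j)                       ≡⟨ cong (λ t → t ℤ.* a j ℤ.+ (l ∘ suc) ∙ (λ i → rows i j)) (sym l₀≡0) ⟩
      l ∙ (λ i → (a ◂ rows) i j)                                ≡⟨ comb j ⟩
      0ℤ                                                        ∎) i

opaque
  -- A sign change gives the direction a positive coordinate. Moving against it then decreases that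
  -- coordinate, which nonnegativity of the solutions stops.
  orient : ∀ {K} (x : Fin K → ℤ) → (∃ λ j → x j ≢ 0ℤ) → Σ (Fin K → ℤ) λ g → (∃ λ j → 0ℤ ℤ.< g j) ×
    (∀ j → ∣ g j ∣ ≡ ∣ x j ∣) × (∀ a → a ∙ x ≡ 0ℤ → a ∙ g ≡ 0ℤ)
  orient x (j , xj≢0) with ℤ.<-cmp 0ℤ (x j)
  ... | tri< 0<xj _ _ = x , (j , 0<xj) , (λ _ → refl) , λ _ → id
  ... | tri≈ _ 0≡xj _ = contradiction (sym 0≡xj) xj≢0
  ... | tri> _ _ xj<0 = (λ i → ℤ.-1ℤ ℤ.* x i) , (j , subst (0ℤ ℤ.<_) (sym (ℤ.-1*i≡-i (x j))) (ℤ.neg-mono-< xj<0)) ,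
    (λ i → trans (cong ∣_∣ (ℤ.-1*i≡-i (x i))) (ℤ.∣-i∣≡∣i∣ (x i))) ,
    λ a ax≡0 → trans (∙-scaleʳ ℤ.-1ℤ a x) (cong (ℤ.-1ℤ ℤ.*_) ax≡0)

-- `G` bounds the Siegel vectors of K equations in K + 1 unknowns. The inner summand K (H G) is the
-- slack allowed to a tight row, so H + K (H G) bounds the value of a tight row at the solution, and
-- the outer factors bound a combination of K such values.
smallBound : ℕ → ℕ → ℕ
smallBound K H = K * (G * (H + K * (H * G)))
  where
  G : ℕ
  G = suc (2 * (suc K * H)) ^ K

module SmallSolution {K H : ℕ} (R : List (Row K)) (1≤H : 1 ≤ H) (R≤H : All (RowBounded H) R)
  (nonneg : ∀ y → All (Holds y) R → ∀ j → 0ℤ ℤ.≤ y j) where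

  G θ : ℕ
  G = suc (2 * (suc K * H)) ^ K
  θ = K * (H * G)

  slack : (Fin K → ℤ) → Row K → ℤ
  slack y (a , b) = b ℤ.- a ∙ y

  Tight : (Fin K → ℤ) → (Fin K → ℤ) → Set
  Tight y a = ∃ λ b → (a , b) ∈ R × slack y (a , b) ℤ.< + θ

  Blocking : (Fin K → ℤ) → (Fin K → ℤ) → Row K → Set
  Blocking g y row = slack y row ℤ.< + θ × proj₁ row ∙ g ≢ 0ℤ

  blocking? : ∀ g y row → Dec (Blocking g y row)
  blocking? g y row = (slack y row ℤ.<? + θ) ×-dec ¬? (proj₁ row ∙ g ℤ.≟ 0ℤ)

  opaque
    -- A row orthogonal to `g` keeps its value. Any other row that does not block has slack at least
    -- `θ`, and `θ` is the most that one step along a vector with entries up to `G` can change it.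
    step-sat : ∀ g y → (∀ j → ∣ g j ∣ ≤ G) → All (Holds y) R → (∀ {row} → row ∈ R → ¬ Blocking g y row) →
      All (Holds (λ j → y j ℤ.- g j)) R
    step-sat g y g≤G sat free = All.tabulate go
      where
      open ℤ.≤-Reasoning
      rearr : ∀ p q b → (p ℤ.- b) ℤ.+ (b ℤ.- q) ≡ p ℤ.- q
      rearr = ℤ-Ring.solve-∀
      go : ∀ {row} → row ∈ R → Holds (λ j → y j ℤ.- g j) row
      go {a , b} row∈R with a ∙ g ℤ.≟ 0ℤ | slack y (a , b) ℤ.<? + θ
      ... | no ag≢0 | yes near = contradiction (near , ag≢0) (free row∈R)
      ... | yes ag≡0 | _ = begin
        a ∙ (λ j → y j ℤ.- g j)  ≡⟨ ∙-distrib-- a y g ⟩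
        a ∙ y ℤ.- a ∙ g          ≡⟨ cong (λ t → a ∙ y ℤ.- t) ag≡0 ⟩
        a ∙ y ℤ.+ 0ℤ             ≡⟨ ℤ.+-identityʳ (a ∙ y) ⟩
        a ∙ y                    ≤⟨ All.lookup sat row∈R ⟩
        b                        ∎
      ... | no _ | no far = begin
        a ∙ (λ j → y j ℤ.- g j)                    ≡⟨ ∙-distrib-- a y g ⟩
        a ∙ y ℤ.- a ∙ g                            ≤⟨ ℤ.+-monoʳ-≤ (a ∙ y) (begin
          ℤ.- (a ∙ g)             ≤⟨ i≤+∣i∣ (ℤ.- (a ∙ g)) ⟩
          + ∣ ℤ.- (a ∙ g) ∣       ≡⟨ cong +_ (ℤ.∣-i∣≡∣i∣ (a ∙ g)) ⟩
          + ∣ a ∙ g ∣             ≤⟨ ℤ.+≤+ (∣∙∣≤ a g (proj₁ (All.lookup R≤H row∈R)) g≤G) ⟩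
          + θ                     ≤⟨ ℤ.≮⇒≥ far ⟩
          b ℤ.- a ∙ y             ∎) ⟩
        a ∙ y ℤ.+ (b ℤ.- a ∙ y)                    ≡⟨ cancel (a ∙ y) b ⟩
        b                                          ∎
        where
        cancel : ∀ p q → p ℤ.+ (q ℤ.- p) ≡ q
        cancel = ℤ-Ring.solve-∀
        i≤+∣i∣ : ∀ i → i ℤ.≤ + ∣ i ∣
        i≤+∣i∣ (+ n)    = ℤ.≤-refl
        i≤+∣i∣ -[1+ n ] = ℤ.-≤+

  Descent : (g y : Fin K → ℤ) → Set
  Descent g y = Σ (Fin K → ℤ) λ y′ → All (Holds y′) R × (∀ a → a ∙ g ≡ 0ℤ → a ∙ y′ ≡ a ∙ y) ×
    ∃ λ a → Tight y′ a × a ∙ g ≢ 0ℤ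

  opaque
    -- Every step lowers `y j` by at least one while the solution stays nonnegative, so `fuel`
    -- cannot run out before some row blocks; this is the new tight row. Rows orthogonal to `g` keep
    -- their values, and with them the earlier tight rows stay tight.
    descend : ∀ g j → 0ℤ ℤ.< g j → (∀ i → ∣ g i ∣ ≤ G) → ∀ fuel y → All (Holds y) R → y j ℤ.≤ + fuel → Descent g y
    descend g j 0<gj g≤G fuel y sat y≤fuel with any? (blocking? g y) R
    ... | yes found with find found
    ...   | (a , b) , row∈R , near , ag≢0 = y , sat , (λ _ _ → refl) , a , (b , row∈R , near) , ag≢0
    descend g j 0<gj g≤G fuel y sat y≤fuel | no none = go fuel y≤fuel
      where
      y′ : Fin K → ℤ
      y′ i = y i ℤ.- g i

      sat′ : All (Holds y′) R
      sat′ = step-sat g y g≤G sat λ row∈R b → none (lose row∈R b)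

      y′<y : y′ j ℤ.< y j
      y′<y = subst (y′ j ℤ.<_) (ℤ.+-identityʳ (y j)) (ℤ.+-monoʳ-< (y j) (ℤ.neg-mono-< 0<gj))

      go : ∀ fuel → y j ℤ.≤ + fuel → Descent g y
      go zero y≤0 = contradiction (ℤ.<-≤-trans y′<y y≤0) (ℤ.≤⇒≯ (nonneg y′ sat′ j))
      go (suc fuel) y≤ with descend g j 0<gj g≤G fuel y′ sat′ (ℤ.i<j⇒i≤pred[j] (ℤ.<-≤-trans y′<y y≤))
      ... | z , satz , inv , rest = z , satz , (λ a ag≡0 → trans (inv a ag≡0) (begin
          a ∙ y′            ≡⟨ ∙-distrib-- a y g ⟩
          a ∙ y ℤ.- a ∙ g   ≡⟨ cong (λ t → a ∙ y ℤ.- t) ag≡0 ⟩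
          a ∙ y ℤ.+ 0ℤ      ≡⟨ ℤ.+-identityʳ (a ∙ y) ⟩
          a ∙ y             ∎)) , rest
        where open ≡-Reasoning

  opaque
    tight-bounded : ∀ y a → All (Holds y) R → Tight y a → (∀ j → ∣ a j ∣ ≤ H) × ∣ a ∙ y ∣ ≤ H + θ
    tight-bounded y a sat (b , row∈R , near) = proj₁ bd , ℕ.≤-trans (ℕ.≤-reflexive (cong ∣_∣ (sym (cancel b (a ∙ y)))))
      (∣-∣≤ b (slack y (a , b)) (proj₂ bd) (ℤ.drop‿+≤+ (begin
        + ∣ slack y (a , b) ∣   ≡⟨ ℤ.0≤i⇒+∣i∣≡i (ℤ.i≤j⇒0≤j-i (All.lookup sat row∈R)) ⟩
        slack y (a , b)         ≤⟨ ℤ.<⇒≤ near ⟩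
        + θ                     ∎)))
      where
      open ℤ.≤-Reasoning
      bd : RowBounded H (a , b)
      bd = All.lookup R≤H row∈R
      cancel : ∀ p q → p ℤ.- (p ℤ.- q) ≡ q
      cancel = ℤ-Ring.solve-∀

  -- Siegel's lemma applied to the transpose: some nonzero multiple of the
  -- j-th unit vector is a small combination of the rows.
  opaque
    full-rank : ∀ y (rows : Fin K → Fin K → ℤ) → Independent rows → All (Holds y) R → (∀ i → Tight y (rows i)) →
      ∀ j → ∣ y j ∣ ≤ smallBound K H
    full-rank y rows indep sat tight j = conclude (siegel {K} {suc K} H M M≤H (ℕ.n<1+n K))
      where
      M : Fin K → Fin (suc K) → ℤ
      M l = δ j l ◂ λ i → rows i l
      M≤H : ∀ l i → ∣ M l i ∣ ≤ H
      M≤H l zero    = ℕ.≤-trans (∣δ∣≤1 j l) 1≤H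
      M≤H l (suc i) = proj₁ (tight-bounded y (rows i) sat (tight i)) l
      conclude : (Σ (Fin (suc K) → ℤ) λ x → (∃ λ j → x j ≢ 0ℤ) × (∀ j → ∣ x j ∣ ≤ siegelBound K (suc K) H) × (∀ l → M l ∙ x ≡ 0ℤ)) →
        ∣ y j ∣ ≤ smallBound K H
      conclude (x , (i₀ , xi≢0) , x≤G , Mx≡0) = ℕ.≤-trans (ℕ.m≤n*m ∣ y j ∣ ∣ x zero ∣ {{ℕ.≢-nonZero (x₀≢0 ∘ ℤ.∣i∣≡0⇒i≡0)}}) bound
        where
        tl : Fin K → ℤ
        tl = x ∘ suc
        neg-unique : ∀ a b → a ℤ.+ b ≡ 0ℤ → a ≡ ℤ.- b
        neg-unique a b eq = trans (sym (cancel a b)) (trans (cong (ℤ._- b) eq) (ℤ.+-identityˡ (ℤ.- b)))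
          where
          cancel : ∀ a b → (a ℤ.+ b) ℤ.- b ≡ a
          cancel = ℤ-Ring.solve-∀
        comb : ∀ l → x zero ℤ.* δ j l ≡ ℤ.- (tl ∙ (λ i → rows i l))
        comb l = neg-unique _ _ (trans (cong₂ ℤ._+_ (ℤ.*-comm (x zero) (δ j l)) (∙-comm tl (λ i → rows i l))) (Mx≡0 l))
        -- Otherwise the kernel vector would be a nontrivial relation between the independent rows.
        x₀≢0 : x zero ≢ 0ℤ
        x₀≢0 x₀≡0 = all0 i₀ xi≢0
          where
          tl∙≡0 : ∀ l → tl ∙ (λ i → rows i l) ≡ 0ℤ
          tl∙≡0 l = trans (sym (ℤ.neg-involutive _)) (cong ℤ.-_ (trans (sym (comb l)) (cong (ℤ._* δ j l) x₀≡0)))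
          all0 : ∀ i → ¬ (x i ≢ 0ℤ)
          all0 zero    x≢0 = x≢0 x₀≡0
          all0 (suc i) x≢0 = x≢0 (indep tl tl∙≡0 i)
        key : x zero ℤ.* y j ≡ ℤ.- (tl ∙ (λ i → rows i ∙ y))
        key = begin
          x zero ℤ.* y j                                          ≡⟨ cong (x zero ℤ.*_) (sym (δ-∙ j y)) ⟩
          x zero ℤ.* δ j ∙ y                                      ≡⟨ sym (∙-scaleˡ (x zero) (δ j) y) ⟩
          (λ l → x zero ℤ.* δ j l) ∙ y                            ≡⟨ ∙-congˡ y (λ l → trans (comb l) (sym (ℤ.-1*i≡-i _))) ⟩
          (λ l → ℤ.-1ℤ ℤ.* (tl ∙ (λ i → rows i l))) ∙ y           ≡⟨ ∙-scaleˡ ℤ.-1ℤ (λ l → tl ∙ (λ i → rows i l)) y ⟩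
          ℤ.-1ℤ ℤ.* (λ l → tl ∙ (λ i → rows i l)) ∙ y             ≡⟨ ℤ.-1*i≡-i _ ⟩
          ℤ.- ((λ l → tl ∙ (λ i → rows i l)) ∙ y)                 ≡⟨ cong ℤ.-_ (∙-assoc tl rows y) ⟩
          ℤ.- (tl ∙ (λ i → rows i ∙ y))                           ∎
          where open ≡-Reasoning
        bound : ∣ x zero ∣ * ∣ y j ∣ ≤ smallBound K H
        bound = begin
          ∣ x zero ∣ * ∣ y j ∣                       ≡⟨ sym (ℤ.∣i*j∣≡∣i∣*∣j∣ (x zero) (y j)) ⟩
          ∣ x zero ℤ.* y j ∣                         ≡⟨ cong ∣_∣ key ⟩
          ∣ ℤ.- (tl ∙ (λ i → rows i ∙ y)) ∣          ≡⟨ ℤ.∣-i∣≡∣i∣ (tl ∙ (λ i → rows i ∙ y)) ⟩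
          ∣ tl ∙ (λ i → rows i ∙ y) ∣                ≤⟨ ∣∙∣≤ tl (λ i → rows i ∙ y) (x≤G ∘ suc) (λ i → proj₂ (tight-bounded y (rows i) sat (tight i))) ⟩
          smallBound K H                             ∎
          where open ℕ.≤-Reasoning

  Small : Set
  Small = Σ (Fin K → ℤ) λ y → All (Holds y) R × ∀ j → ∣ y j ∣ ≤ smallBound K H

  siegelBound≤G : ∀ {r} → r < K → siegelBound r K H ≤ G
  siegelBound≤G r<K = ℕ.≤-trans (ℕ.^-monoʳ-≤ _ (ℕ.<⇒≤ r<K))
    (ℕ.^-monoˡ-≤ K (s≤s (ℕ.*-monoʳ-≤ 2 (ℕ.*-monoˡ-≤ H (ℕ.n≤1+n K)))))

  opaque
    -- Induction on the number `k` of rows still missing: while r < K, the r rows have a common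
    -- kernel vector, and descending along it adds a row outside their span.
    grow : ∀ k r → k + r ≡ K → ∀ y (rows : Fin r → Fin K → ℤ) → Independent rows → All (Holds y) R →
      (∀ i → Tight y (rows i)) → Small
    grow zero    r refl y rows indep sat tight = y , sat , full-rank y rows indep sat tight
    grow (suc k) r k+r≡K y rows indep sat tight
      with siegel {r} {K} H rows (λ i → proj₁ (tight-bounded y (rows i) sat (tight i))) r<K
      where
      r<K : r < K
      r<K = subst (r <_) k+r≡K (s≤s (ℕ.m≤n+m r k))
    ... | x , x≢0 , x≤ , Mx≡0 with orient x x≢0
    ... | g , (j , 0<gj) , ∣g∣ , ker
      with descend g j 0<gj (λ i → ℕ.≤-trans (ℕ.≤-reflexive (∣g∣ i)) (ℕ.≤-trans (x≤ i)
             (siegelBound≤G (subst (r <_) k+r≡K (s≤s (ℕ.m≤n+m r k))))))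
             ∣ y j ∣ y sat (ℤ.≤-reflexive (sym (ℤ.0≤i⇒+∣i∣≡i (nonneg y sat j))))
    ... | y′ , sat′ , inv , a , tight-a , ag≢0 =
      grow k (suc r) (trans (ℕ.+-suc k r) k+r≡K) y′ (a ◂ rows)
        (Independent-◂ a g indep (λ i → ker (rows i) (Mx≡0 i)) ag≢0) sat′ tight′
      where
      tight′ : ∀ i → Tight y′ ((a ◂ rows) i)
      tight′ zero    = tight-a
      tight′ (suc i) with tight i
      ... | b , row∈R , near = b , row∈R , subst (ℤ._< + θ) (cong (λ t → b ℤ.- t) (sym (inv (rows i) (ker (rows i) (Mx≡0 i))))) near

  opaque
    small-solution : ∀ y → All (Holds y) R → Small
    small-solution y sat = grow K 0 (ℕ.+-identityʳ K) y (λ ()) (λ _ _ ()) sat λ ()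

-- Periodic integer sequences and shift operators

Seq : Set
Seq = ℕ → ℤ

-- With T the shift of sequences, this is the operator Σ cⱼ T^(jp). Stride 1 expresses recurrences;
-- other strides serve to write the adjoint of a stride-1 operator on periodic sequences.
act : ∀ {d} → ℕ → (Fin d → ℤ) → Seq → Seq
act p c f k = c ∙ λ j → f (toℕ j * p + k)

act-cong : ∀ {d} p (c : Fin d → ℤ) {f g} → f ≗ g → act p c f ≗ act p c g
act-cong p c eq k = ∙-congʳ c λ j → eq (toℕ j * p + k)

act-zero : ∀ {d} p (c : Fin d → ℤ) {f} → (∀ k → f k ≡ 0ℤ) → ∀ k → act p c f k ≡ 0ℤ
act-zero p c f≡0 k = ∙-zeroʳ c λ j → f≡0 (toℕ j * p + k)

act-shift : ∀ {d} p (c : Fin d → ℤ) f m k → act p c (λ i → f (m + i)) k ≡ act p c f (m + k)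
act-shift p c f m k = ∙-congʳ c λ j → cong f (swap m (toℕ j * p) k)
  where
  swap : ∀ a b c → a + (b + c) ≡ b + (a + c)
  swap = ℕ-Ring.solve-∀

opaque
  -- Both operators are polynomials in the same shift.
  act-comm : ∀ {d e} p q (c : Fin d → ℤ) (c′ : Fin e → ℤ) f →
    act p c (act q c′ f) ≗ act q c′ (act p c f)
  act-comm {d} {e} p q c c′ f k = begin
    sum (λ i → c i ℤ.* c′ ∙ (λ j → f (toℕ j * q + (toℕ i * p + k))))
      ≡⟨ sum-cong-≗ {d} (λ i → *-distribˡ-sum {e} (c i) λ j → c′ j ℤ.* f (toℕ j * q + (toℕ i * p + k))) ⟩
    sum (λ i → sum λ j → c i ℤ.* (c′ j ℤ.* f (toℕ j * q + (toℕ i * p + k))))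
      ≡⟨ ∑-comm {d} {e} (λ i j → c i ℤ.* (c′ j ℤ.* f (toℕ j * q + (toℕ i * p + k)))) ⟩
    sum (λ j → sum λ i → c i ℤ.* (c′ j ℤ.* f (toℕ j * q + (toℕ i * p + k))))
      ≡⟨ sum-cong-≗ {e} (λ j → sum-cong-≗ {d} λ i → trans (swap (c i) (c′ j) _)
           (cong (λ t → c′ j ℤ.* (c i ℤ.* f t)) (swapℕ (toℕ j * q) (toℕ i * p) k))) ⟩
    sum (λ j → sum λ i → c′ j ℤ.* (c i ℤ.* f (toℕ i * p + (toℕ j * q + k))))
      ≡⟨ sum-cong-≗ {e} (λ j → sym (*-distribˡ-sum {d} (c′ j) λ i → c i ℤ.* f (toℕ i * p + (toℕ j * q + k)))) ⟩
    sum (λ j → c′ j ℤ.* c ∙ (λ i → f (toℕ i * p + (toℕ j * q + k)))) ∎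
    where
    open ≡-Reasoning
    swap : ∀ a b c → a ℤ.* (b ℤ.* c) ≡ b ℤ.* (a ℤ.* c)
    swap = ℤ-Ring.solve-∀
    swapℕ : ∀ a b c → a + (b + c) ≡ b + (a + c)
    swapℕ = ℕ-Ring.solve-∀

Periodic : ℕ → Seq → Set
Periodic β f = ∀ k → f (β + k) ≡ f k

periodic-* : ∀ {β f} → Periodic β f → ∀ m k → f (m * β + k) ≡ f k
periodic-* per zero    k = refl
periodic-* {β} {f} per (suc m) k = trans (cong f (ℕ.+-assoc β (m * β) k)) (trans (per (m * β + k)) (periodic-* per m k))

act-periodic : ∀ {d β f} p (c : Fin d → ℤ) → Periodic β f → Periodic β (act p c f)
act-periodic {β = β} {f} p c per k = trans (sym (act-shift p c f β k)) (act-cong p c per k)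

∑ᵖ : ℕ → Seq → ℤ
∑ᵖ β h = sum {β} (h ∘ toℕ)

opaque
  ∑ᵖ-suc : ∀ β h → h β ≡ h 0 → ∑ᵖ β (h ∘ suc) ≡ ∑ᵖ β h
  ∑ᵖ-suc β h hβ≡h0 = +-cancelˡ (h 0) _ _ (begin
    h 0 ℤ.+ ∑ᵖ β (h ∘ suc)                                  ≡⟨ sum-init-last {β} (h ∘ toℕ) ⟩
    sum {β} (h ∘ toℕ ∘ Fin.inject₁) ℤ.+ h (toℕ (Fin.fromℕ β))  ≡⟨ cong₂ ℤ._+_ (sum-cong-≗ {β} λ i → cong h (Fin.toℕ-inject₁ i))
                                                                    (trans (cong h (Fin.toℕ-fromℕ β)) hβ≡h0) ⟩
    ∑ᵖ β h ℤ.+ h 0                                          ≡⟨ ℤ.+-comm (∑ᵖ β h) (h 0) ⟩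
    h 0 ℤ.+ ∑ᵖ β h                                          ∎)
    where open ≡-Reasoning

opaque
  ∑ᵖ-shift : ∀ β h → Periodic β h → ∀ m → ∑ᵖ β (λ k → h (m + k)) ≡ ∑ᵖ β h
  ∑ᵖ-shift β h per zero    = refl
  ∑ᵖ-shift β h per (suc m) = trans (∑ᵖ-shift β (h ∘ suc) per′ m) (∑ᵖ-suc β h (trans (cong h (sym (ℕ.+-identityʳ β))) (per 0)))
    where
    per′ : Periodic β (h ∘ suc)
    per′ k = trans (cong h (sym (ℕ.+-suc β k))) (per (suc k))

⟨_,_⟩[_] : Seq → Seq → ℕ → ℤ
⟨ f , g ⟩[ β ] = ∑ᵖ β λ k → f k ℤ.* g k

⟨⟩-zeroʳ : ∀ β f {g} → (∀ k → g k ≡ 0ℤ) → ⟨ f , g ⟩[ β ] ≡ 0ℤ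
⟨⟩-zeroʳ β f g≡0 = ∙-zeroʳ {β} (f ∘ toℕ) (g≡0 ∘ toℕ)

⟨⟩-comm : ∀ β f g → ⟨ f , g ⟩[ β ] ≡ ⟨ g , f ⟩[ β ]
⟨⟩-comm β f g = ∙-comm {β} (f ∘ toℕ) (g ∘ toℕ)

-- On sequences of period p + 1 the shift by p is the inverse, hence the adjoint, of the shift by 1.
opaque
  adjoint : ∀ {d p} (z : Fin d → ℤ) f g → Periodic (suc p) f → Periodic (suc p) g →
    ⟨ act 1 z f , g ⟩[ suc p ] ≡ ⟨ f , act p z g ⟩[ suc p ]
  adjoint {d} {p} z f g perf perg = begin
    sum {suc p} (λ k → z ∙ (λ j → f (toℕ j * 1 + toℕ k)) ℤ.* g (toℕ k))
      ≡⟨ ∙-assoc {d} {suc p} z (λ j k → f (toℕ j * 1 + toℕ k)) (g ∘ toℕ) ⟩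
    z ∙ (λ j → ∑ᵖ (suc p) (λ k → f (toℕ j * 1 + k) ℤ.* g k))
      ≡⟨ ∙-congʳ z (λ j → trans (sum-cong-≗ {suc p} λ k → cong (f (toℕ j * 1 + toℕ k) ℤ.*_)
           (trans (sym (periodic-* perg (toℕ j) (toℕ k))) (cong g (arith (toℕ j) p (toℕ k)))))
           (∑ᵖ-shift (suc p) (h j) (perh j) (toℕ j * 1))) ⟩
    z ∙ (λ j → ∑ᵖ (suc p) (h j))
      ≡⟨ ∙-congʳ z (λ j → ∙-comm {suc p} (f ∘ toℕ) (λ k → g (toℕ j * p + toℕ k))) ⟩
    z ∙ (λ j → sum {suc p} (λ k → g (toℕ j * p + toℕ k) ℤ.* f (toℕ k)))
      ≡⟨ sym (∙-assoc {d} {suc p} z (λ j k → g (toℕ j * p + toℕ k)) (f ∘ toℕ)) ⟩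
    sum {suc p} (λ k → act p z g (toℕ k) ℤ.* f (toℕ k))
      ≡⟨ ⟨⟩-comm (suc p) (act p z g) f ⟩
    ⟨ f , act p z g ⟩[ suc p ] ∎
    where
    open ≡-Reasoning
    h : Fin d → Seq
    h j k = f k ℤ.* g (toℕ j * p + k)
    perh : ∀ j → Periodic (suc p) (h j)
    perh j k = cong₂ ℤ._*_ (perf k) (trans (cong g (swap (toℕ j * p) (suc p) k)) (perg (toℕ j * p + k)))
      where
      swap : ∀ a b c → a + (b + c) ≡ b + (a + c)
      swap = ℕ-Ring.solve-∀
    arith : ∀ j p k → j * suc p + k ≡ j * p + (j * 1 + k)
    arith = ℕ-Ring.solve-∀

i*i≡+ : ∀ i → i ℤ.* i ≡ + (∣ i ∣ * ∣ i ∣)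
i*i≡+ (+ n)    = sym (ℤ.pos-* n n)
i*i≡+ -[1+ n ] = refl

sum-squares : ∀ n (f : Fin n → ℤ) → ∃ λ m → f ∙ f ≡ + m
sum-squares zero    f = 0 , refl
sum-squares (suc n) f with sum-squares n (f ∘ suc)
... | m , eq = ∣ f zero ∣ * ∣ f zero ∣ + m , trans (cong₂ ℤ._+_ (i*i≡+ (f zero)) eq) (sym (ℤ.pos-+ _ m))

opaque
  -- A vanishing sum of squares has vanishing terms. Starting the period at `k` makes the square of
  -- `h k` its first term.
  definite : ∀ {p} h → Periodic (suc p) h → ⟨ h , h ⟩[ suc p ] ≡ 0ℤ → ∀ k → h k ≡ 0ℤ
  definite {p} h per eq k with sum-squares p (λ i → h (k + toℕ (suc i)))
  ... | m , sq = ℤ.∣i∣≡0⇒i≡0 ([ id , id ]′ (ℕ.m*n≡0⇒m≡0∨n≡0 ∣ h k ∣ (ℕ.m+n≡0⇒m≡0 _ (ℤ.+-injective (begin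
    + (∣ h k ∣ * ∣ h k ∣ + m)                ≡⟨ ℤ.pos-+ (∣ h k ∣ * ∣ h k ∣) m ⟩
    + (∣ h k ∣ * ∣ h k ∣) ℤ.+ + m            ≡⟨ cong₂ ℤ._+_ (sym (i*i≡+ (h k))) (sym sq) ⟩
    h k ℤ.* h k ℤ.+ _                        ≡⟨ cong (λ t → h t ℤ.* h t ℤ.+ (λ i → h (k + toℕ (suc i))) ∙ (λ i → h (k + toℕ {suc p} (suc i)))) (sym (ℕ.+-identityʳ k)) ⟩
    ∑ᵖ (suc p) (λ i → h (k + i) ℤ.* h (k + i))   ≡⟨ ∑ᵖ-shift (suc p) (λ i → h i ℤ.* h i) (λ i → cong₂ ℤ._*_ (per i) (per i)) k ⟩
    ⟨ h , h ⟩[ suc p ]                       ≡⟨ eq ⟩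
    0ℤ                                       ∎)))))
    where open ≡-Reasoning

-- act 1 z is a normal operator on periodic sequences, so its square has the same kernel.
opaque
  semisimple : ∀ {d p} (z : Fin d → ℤ) f → Periodic (suc p) f →
    (∀ k → act 1 z (act 1 z f) k ≡ 0ℤ) → ∀ k → act 1 z f k ≡ 0ℤ
  semisimple {d} {p} z f per zzf≡0 = definite h perh
    -- Write z for `act 1 z` and z* for its adjoint, so that h = z f and g = z* h. Since z g = z* z
    -- h = 0, the product ⟨g, g⟩ = ⟨z g, h⟩ vanishes and g = 0. Then ⟨h, h⟩ = ⟨f, g⟩ = 0.
    (trans (adjoint z f h per perh) (⟨⟩-zeroʳ (suc p) f (definite g perg (begin
      ⟨ g , act p z h ⟩[ suc p ]        ≡⟨ sym (adjoint z g h perg perh) ⟩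
      ⟨ act 1 z g , h ⟩[ suc p ]        ≡⟨ ⟨⟩-comm (suc p) (act 1 z g) h ⟩
      ⟨ h , act 1 z g ⟩[ suc p ]        ≡⟨ ⟨⟩-zeroʳ (suc p) h (λ k → trans (act-comm 1 p z z h k) (act-zero p z zzf≡0 k)) ⟩
      0ℤ                                ∎))))
    where
    open ≡-Reasoning
    h g : Seq
    h = act 1 z f
    g = act p z h
    perh : Periodic (suc p) h
    perh = act-periodic 1 z per
    perg : Periodic (suc p) g
    perg = act-periodic p z perh

-- An integral operator that is c⁻¹ times a combination of shifts of total weight
-- less than c strictly decreases the sup norm, so some power of it vanishes on f.
opaque
  contraction-vanishes : ∀ {d e p} c τ K B (s : Fin e → ℤ) (z : Fin d → ℤ) → (∀ j → ∣ s j ∣ ≤ B) → ∣ τ ∣ + e * B < c →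
    ∀ M f → Periodic (suc p) f → (∀ k → ∣ f k ∣ ≤ M) →
    (∀ i → + c ℤ.* act 1 z f i ≡ τ ℤ.* f (K + i) ℤ.+ act 1 s f i) → ∀ i → act 1 z f i ≡ 0ℤ
  contraction-vanishes c τ K B s z s≤B <c zero f per f≤M eq = act-zero 1 z {f} λ k → ℤ.∣i∣≡0⇒i≡0 (ℕ.n≤0⇒n≡0 (f≤M k))
  -- `h` satisfies the same operator equation with the smaller bound `M`, so the operator sends `h`
  -- to zero by induction, and `semisimple` gives h = 0.
  contraction-vanishes {e = e} c τ K B s z s≤B <c (suc M) f per f≤M eq = semisimple z f per
    (contraction-vanishes c τ K B s z s≤B <c M h (act-periodic 1 z per) h≤M eq′)
    where
    h : Seq
    h = act 1 z f
    h≤M : ∀ k → ∣ h k ∣ ≤ M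
    h≤M k = ℕ.≤-pred (ℕ.*-cancelˡ-< c ∣ h k ∣ (suc M) (begin-strict
      c * ∣ h k ∣                              ≡⟨ sym (ℤ.∣i*j∣≡∣i∣*∣j∣ (+ c) (h k)) ⟩
      ∣ + c ℤ.* h k ∣                          ≡⟨ cong ∣_∣ (eq k) ⟩
      ∣ τ ℤ.* f (K + k) ℤ.+ act 1 s f k ∣      ≤⟨ ∣+∣≤ (τ ℤ.* f (K + k)) (act 1 s f k) (∣*∣≤ τ (f (K + k)) ℕ.≤-refl (f≤M (K + k)))
                                                    (∣∙∣≤ s _ s≤B (λ j → f≤M (toℕ j * 1 + k))) ⟩
      ∣ τ ∣ * suc M + e * (B * suc M)          ≡⟨ cong (λ t → ∣ τ ∣ * suc M + t) (sym (ℕ.*-assoc e B (suc M))) ⟩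
      ∣ τ ∣ * suc M + e * B * suc M            ≡⟨ sym (ℕ.*-distribʳ-+ (suc M) ∣ τ ∣ (e * B)) ⟩
      (∣ τ ∣ + e * B) * suc M                  <⟨ ℕ.*-monoˡ-< (suc M) <c ⟩
      c * suc M                                ∎))
      where open ℕ.≤-Reasoning
    eq′ : ∀ i → + c ℤ.* act 1 z h i ≡ τ ℤ.* h (K + i) ℤ.+ act 1 s h i
    eq′ i = begin
      + c ℤ.* act 1 z h i                                               ≡⟨ sym (∙-scaleʳ (+ c) z _) ⟩
      act 1 z (λ k → + c ℤ.* h k) i                                     ≡⟨ act-cong 1 z eq i ⟩
      act 1 z (λ k → τ ℤ.* f (K + k) ℤ.+ act 1 s f k) i                 ≡⟨ ∙-distrib-+ z _ _ ⟩
      act 1 z (λ k → τ ℤ.* f (K + k)) i ℤ.+ act 1 z (act 1 s f) i       ≡⟨ cong₂ ℤ._+_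
           (trans (∙-scaleʳ τ z _) (cong (τ ℤ.*_) (act-shift 1 z f K i))) (act-comm 1 1 z s f i) ⟩
      τ ℤ.* h (K + i) ℤ.+ act 1 s h i                                   ∎
      where open ≡-Reasoning

-- Diophantine approximation and recurrences

opaque
  /≡⇒∣-∣< : ∀ x y c .{{_ : ℕ.NonZero c}} → x ℕ./ c ≡ y ℕ./ c → ∣ + x ℤ.- + y ∣ < c
  /≡⇒∣-∣< x y c eq = begin-strict
    ∣ + x ℤ.- + y ∣                    ≡⟨ cong ∣_∣ (cong₂ (λ u v → + u ℤ.- + v) (ℕ.m≡m%n+[m/n]*n x c)
                                            (trans (ℕ.m≡m%n+[m/n]*n y c) (cong (λ t → y ℕ.% c + t * c) (sym eq)))) ⟩
    ∣ + (x ℕ.% c + Q) ℤ.- + (y ℕ.% c + Q) ∣  ≡⟨ cong ∣_∣ (trans (cong₂ (λ u v → u ℤ.- v) (ℤ.pos-+ (x ℕ.% c) Q) (ℤ.pos-+ (y ℕ.% c) Q))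
                                            (cancel (+ (x ℕ.% c)) (+ (y ℕ.% c)) (+ Q))) ⟩
    ∣ + (x ℕ.% c) ℤ.- + (y ℕ.% c) ∣    ≡⟨ cong ∣_∣ (ℤ.m-n≡m⊖n (x ℕ.% c) (y ℕ.% c)) ⟩
    ∣ (x ℕ.% c) ℤ.⊖ (y ℕ.% c) ∣        ≤⟨ ℤ.∣m⊝n∣≤m⊔n (x ℕ.% c) (y ℕ.% c) ⟩
    (x ℕ.% c) ℕ.⊔ (y ℕ.% c)            <⟨ ℕ.⊔-pres-<m (ℕ.m%n<n x c) (ℕ.m%n<n y c) ⟩
    c                                  ∎
    where
    open ℕ.≤-Reasoning
    Q : ℕ
    Q = x ℕ./ c * c
    cancel : ∀ u v w → (u ℤ.+ w) ℤ.- (v ℤ.+ w) ≡ u ℤ.- v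
    cancel = ℤ-Ring.solve-∀

-- Simultaneous approximation of the fractions rⱼ / c with common denominator t.
opaque
  dirichlet : ∀ {d} (r : Fin d → ℤ) c b .{{_ : ℕ.NonZero c}} → ∃ λ t → 1 ≤ t × t ≤ suc (b + b) ^ d ×
    Σ (Fin d → ℤ) λ z → ∀ j → ∣ + t ℤ.* r j ℤ.- + c ℤ.* z j ∣ * b < c
  dirichlet {d} r c b with pigeonhole-box b box box≤b (ℕ.n<1+n (suc (b + b) ^ d))
    where
    -- The fractional part of t rⱼ / c, scaled by b and rounded down. The box for the pigeonhole is
    -- symmetric about 0, whence the factor 2b + 1 for each coordinate.
    box : Fin (suc (suc (b + b) ^ d)) → Fin d → ℤ
    box t j = + (((+ toℕ t ℤ.* r j) ℤ.%ℕ c * b) ℕ./ c)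
    box≤b : ∀ t j → ∣ box t j ∣ ≤ b
    box≤b t j = ℕ.≤-trans (ℕ./-monoˡ-≤ c (ℕ.*-monoˡ-≤ b (ℕ.<⇒≤ (ℤ.n%ℕd<d (+ toℕ t ℤ.* r j) c))))
      (ℕ.≤-reflexive (trans (cong (ℕ._/ c) (ℕ.*-comm c b)) (ℕ.m*n/n≡m b c)))
  ... | p , q , p<q , same = toℕ q ℕ.∸ toℕ p , ℕ.m<n⇒0<n∸m p<q , ℕ.≤-trans (ℕ.m∸n≤m (toℕ q) (toℕ p)) (ℕ.≤-pred (Fin.toℕ<n q)) ,
    (λ j → quo q j ℤ.- quo p j) , approx
    where
    rem : Fin (suc (suc (b + b) ^ d)) → Fin d → ℕ
    rem t j = (+ toℕ t ℤ.* r j) ℤ.%ℕ c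
    quo : Fin (suc (suc (b + b) ^ d)) → Fin d → ℤ
    quo t j = (+ toℕ t ℤ.* r j) ℤ./ℕ c
    distrib : ∀ u v w → (u ℤ.- v) ℤ.* w ≡ u ℤ.* w ℤ.- v ℤ.* w
    distrib = ℤ-Ring.solve-∀
    collect : ∀ m n k x y → (m ℤ.+ x ℤ.* k) ℤ.- (n ℤ.+ y ℤ.* k) ℤ.- k ℤ.* (x ℤ.- y) ≡ m ℤ.- n
    collect = ℤ-Ring.solve-∀
    residue : ∀ j → + (toℕ q ℕ.∸ toℕ p) ℤ.* r j ℤ.- + c ℤ.* (quo q j ℤ.- quo p j) ≡ + rem q j ℤ.- + rem p j
    residue j = begin
      + (toℕ q ℕ.∸ toℕ p) ℤ.* r j ℤ.- + c ℤ.* (quo q j ℤ.- quo p j)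
        ≡⟨ cong (λ t → t ℤ.* r j ℤ.- + c ℤ.* (quo q j ℤ.- quo p j)) (sym (trans (ℤ.m-n≡m⊖n (toℕ q) (toℕ p)) (ℤ.⊖-≥ (ℕ.<⇒≤ p<q)))) ⟩
      (+ toℕ q ℤ.- + toℕ p) ℤ.* r j ℤ.- + c ℤ.* (quo q j ℤ.- quo p j)
        ≡⟨ cong (ℤ._- + c ℤ.* (quo q j ℤ.- quo p j)) (distrib (+ toℕ q) (+ toℕ p) (r j)) ⟩
      (+ toℕ q ℤ.* r j ℤ.- + toℕ p ℤ.* r j) ℤ.- + c ℤ.* (quo q j ℤ.- quo p j)
        ≡⟨ cong₂ (λ u v → (u ℤ.- v) ℤ.- + c ℤ.* (quo q j ℤ.- quo p j)) (ℤ.a≡a%ℕn+[a/ℕn]*n (+ toℕ q ℤ.* r j) c) (ℤ.a≡a%ℕn+[a/ℕn]*n (+ toℕ p ℤ.* r j) c) ⟩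
      _ ≡⟨ collect (+ rem q j) (+ rem p j) (+ c) (quo q j) (quo p j) ⟩
      + rem q j ℤ.- + rem p j ∎
      where open ≡-Reasoning
    approx : ∀ j → ∣ + (toℕ q ℕ.∸ toℕ p) ℤ.* r j ℤ.- + c ℤ.* (quo q j ℤ.- quo p j) ∣ * b < c
    approx j = begin-strict
      ∣ + (toℕ q ℕ.∸ toℕ p) ℤ.* r j ℤ.- + c ℤ.* (quo q j ℤ.- quo p j) ∣ * b   ≡⟨ cong (λ t → ∣ t ∣ * b) (residue j) ⟩
      ∣ + rem q j ℤ.- + rem p j ∣ * b                                         ≡⟨ sym (ℤ.∣i*j∣≡∣i∣*∣j∣ (+ rem q j ℤ.- + rem p j) (+ b)) ⟩
      ∣ (+ rem q j ℤ.- + rem p j) ℤ.* + b ∣                                   ≡⟨ cong ∣_∣ (trans (distrib (+ rem q j) (+ rem p j) (+ b))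
                                                                                   (cong₂ ℤ._-_ (sym (ℤ.pos-* (rem q j) b)) (sym (ℤ.pos-* (rem p j) b)))) ⟩
      ∣ + (rem q j * b) ℤ.- + (rem p j * b) ∣                                 <⟨ /≡⇒∣-∣< (rem q j * b) (rem p j * b) c (sym (ℤ.+-injective (same j))) ⟩
      c                                                                       ∎
      where open ℕ.≤-Reasoning

init-last-zero : ∀ {d} (c : Fin (suc d) → ℤ) → (∀ i → c (Fin.inject₁ i) ≡ 0ℤ) → c (Fin.fromℕ d) ≡ 0ℤ → ∀ j → c j ≡ 0ℤ
init-last-zero {zero}  c ini≡0 last≡0 zero    = last≡0
init-last-zero {suc d} c ini≡0 last≡0 zero    = ini≡0 zero
init-last-zero {suc d} c ini≡0 last≡0 (suc j) = init-last-zero (c ∘ suc) (ini≡0 ∘ suc) last≡0 j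

opaque
  act-init-last : ∀ {d} (c : Fin (suc d) → ℤ) f k → act 1 c f k ≡ act 1 (c ∘ Fin.inject₁) f k ℤ.+ c (Fin.fromℕ d) ℤ.* f (d + k)
  act-init-last {d} c f k = trans (sum-init-last {d} λ j → c j ℤ.* f (toℕ j * 1 + k)) (cong₂ ℤ._+_
    (∙-congʳ (c ∘ Fin.inject₁) λ j → cong (λ t → f (t * 1 + k)) (Fin.toℕ-inject₁ j))
    (cong (λ t → c (Fin.fromℕ d) ℤ.* f (t + k)) (trans (ℕ.*-identityʳ _) (Fin.toℕ-fromℕ d))))

a+b≡0⇒b≡-a : ∀ a b → a ℤ.+ b ≡ 0ℤ → b ≡ ℤ.- a
a+b≡0⇒b≡-a a b eq = trans (sym (cancel a b)) (trans (cong (ℤ._- a) eq) (ℤ.+-identityˡ (ℤ.- a)))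
  where
  cancel : ∀ a b → (a ℤ.+ b) ℤ.- a ≡ b
  cancel = ℤ-Ring.solve-∀

opaque
  -- Over the rationals the recurrence reduces every later shift to the first e ones. To stay within
  -- the integers the denominator `l`, a power of the leading coefficient, is kept on the left.
  reduce-shift : ∀ {e} (c : Fin (suc e) → ℤ) f → c (Fin.fromℕ e) ≢ 0ℤ → (∀ k → act 1 c f k ≡ 0ℤ) →
    ∀ m → ∃ λ l → l ≢ 0ℤ × Σ (Fin e → ℤ) λ r → ∀ i → l ℤ.* f (m + e + i) ≡ act 1 r f i
  reduce-shift {e} c f ℓ≢0 cf≡0 m = go m
    where
    open ≡-Reasoning
    ℓ : ℤ
    ℓ = c (Fin.fromℕ e)
    ini : Fin e → ℤ
    ini = c ∘ Fin.inject₁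
    top : ∀ k → ℓ ℤ.* f (e + k) ≡ ℤ.- act 1 ini f k
    top k = a+b≡0⇒b≡-a (act 1 ini f k) _ (trans (sym (act-init-last c f k)) (cf≡0 k))
    go : ∀ m → ∃ λ l → l ≢ 0ℤ × Σ (Fin e → ℤ) λ r → ∀ i → l ℤ.* f (m + e + i) ≡ act 1 r f i
    go zero = ℓ , ℓ≢0 , (λ j → ℤ.-1ℤ ℤ.* ini j) , λ i → begin
      ℓ ℤ.* f (e + i)                      ≡⟨ top i ⟩
      ℤ.- act 1 ini f i                    ≡⟨ sym (ℤ.-1*i≡-i (act 1 ini f i)) ⟩
      ℤ.-1ℤ ℤ.* act 1 ini f i              ≡⟨ sym (∙-scaleˡ ℤ.-1ℤ ini _) ⟩
      act 1 (λ j → ℤ.-1ℤ ℤ.* ini j) f i    ∎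
    go (suc m) with go m
    ... | l , l≢0 , r , eq = ℓ ℤ.* l , i*j≢0 ℓ≢0 l≢0 , r′ , λ i → begin
      ℓ ℤ.* l ℤ.* f (suc (m + e + i))                                ≡⟨ ℤ.*-assoc ℓ l _ ⟩
      ℓ ℤ.* (l ℤ.* f (suc (m + e + i)))                              ≡⟨ cong (λ t → ℓ ℤ.* (l ℤ.* f t)) (sym (ℕ.+-suc (m + e) i)) ⟩
      ℓ ℤ.* (l ℤ.* f (m + e + suc i))                                ≡⟨ cong (ℓ ℤ.*_) (eq (suc i)) ⟩
      ℓ ℤ.* act 1 r f (suc i)                                        ≡⟨ cong (ℓ ℤ.*_) (∙-congʳ r λ j → cong f (ℕ.+-suc (toℕ j * 1) i)) ⟩
      ℓ ℤ.* r ∙ (λ j → f (suc (toℕ j * 1 + i)))                      ≡⟨ cong (ℓ ℤ.*_) (sym (ℤ.+-identityˡ _)) ⟩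
      ℓ ℤ.* act 1 r⁺ f i                                             ≡⟨ cong (ℓ ℤ.*_) (act-init-last r⁺ f i) ⟩
      ℓ ℤ.* (act 1 (r⁺ ∘ Fin.inject₁) f i ℤ.+ x ℤ.* f (e + i))       ≡⟨ dist ℓ (act 1 (r⁺ ∘ Fin.inject₁) f i) x (f (e + i)) ⟩
      ℓ ℤ.* act 1 (r⁺ ∘ Fin.inject₁) f i ℤ.+ x ℤ.* (ℓ ℤ.* f (e + i)) ≡⟨ cong (λ t → ℓ ℤ.* act 1 (r⁺ ∘ Fin.inject₁) f i ℤ.+ x ℤ.* t) (top i) ⟩
      ℓ ℤ.* act 1 (r⁺ ∘ Fin.inject₁) f i ℤ.+ x ℤ.* (ℤ.- act 1 ini f i)
        ≡⟨ cong₂ ℤ._+_ (sym (∙-scaleˡ ℓ (r⁺ ∘ Fin.inject₁) (λ j → f (toℕ j * 1 + i))))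
             (trans (negate x (act 1 ini f i)) (sym (∙-scaleˡ (ℤ.- x) ini (λ j → f (toℕ j * 1 + i))))) ⟩
      act 1 (λ j → ℓ ℤ.* r⁺ (Fin.inject₁ j)) f i ℤ.+ act 1 (λ j → ℤ.- x ℤ.* ini j) f i
        ≡⟨ cong₂ ℤ._+_ (∙-comm (λ j → ℓ ℤ.* r⁺ (Fin.inject₁ j)) (F i)) (∙-comm (λ j → ℤ.- x ℤ.* ini j) (F i)) ⟩
      F i ∙ (λ j → ℓ ℤ.* r⁺ (Fin.inject₁ j)) ℤ.+ F i ∙ (λ j → ℤ.- x ℤ.* ini j)
        ≡⟨ sym (∙-distrib-+ (F i) (λ j → ℓ ℤ.* r⁺ (Fin.inject₁ j)) (λ j → ℤ.- x ℤ.* ini j)) ⟩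
      F i ∙ r′                                                       ≡⟨ ∙-comm (F i) r′ ⟩
      act 1 r′ f i                                                   ∎
      where
      -- `r⁺` is `r` moved up by one place. Its top entry `x` multiplies f (e + i), which one more
      -- use of the recurrence eliminates.
      r⁺ : Fin (suc e) → ℤ
      r⁺ = 0ℤ ◂ r
      x : ℤ
      x = r⁺ (Fin.fromℕ e)
      F : ℕ → Fin e → ℤ
      F i j = f (toℕ j * 1 + i)
      r′ : Fin e → ℤ
      r′ j = ℓ ℤ.* r⁺ (Fin.inject₁ j) ℤ.+ ℤ.- x ℤ.* ini j
      dist : ∀ a b c d → a ℤ.* (b ℤ.+ c ℤ.* d) ≡ a ℤ.* b ℤ.+ c ℤ.* (a ℤ.* d)
      dist = ℤ-Ring.solve-∀
      negate : ∀ a b → a ℤ.* (ℤ.- b) ≡ ℤ.- a ℤ.* b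
      negate = ℤ-Ring.solve-∀

opaque
  finite-bound : ∀ {n} (f : Fin n → ℕ) → ∃ λ M → ∀ i → f i ≤ M
  finite-bound {zero}  f = 0 , λ ()
  finite-bound {suc n} f with finite-bound (f ∘ suc)
  ... | M , f≤M = f zero + M , λ { zero → ℕ.m≤m+n (f zero) M ; (suc i) → ℕ.≤-trans (f≤M i) (ℕ.m≤n+m M (f zero)) }

opaque
  periodic-bounded : ∀ {p f} → Periodic (suc p) f → ∃ λ M → ∀ k → ∣ f k ∣ ≤ M
  periodic-bounded {p} {f} per with finite-bound {suc p} (λ i → ∣ f (toℕ i) ∣)
  ... | M , f≤M = M , λ k → subst (λ t → ∣ t ∣ ≤ M) (begin
      f (toℕ (fromℕ< (ℕ.m%n<n k (suc p))))      ≡⟨ cong f (Fin.toℕ-fromℕ< _) ⟩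
      f (k ℕ.% suc p)                           ≡⟨ sym (periodic-* per (k ℕ./ suc p) (k ℕ.% suc p)) ⟩
      f (k ℕ./ suc p * suc p + k ℕ.% suc p)     ≡⟨ cong f (trans (ℕ.+-comm (k ℕ./ suc p * suc p) _) (sym (ℕ.m≡m%n+[m/n]*n k (suc p)))) ⟩
      f k                                       ∎) (f≤M _)
    where open ≡-Reasoning

-- `dirichletBound L` bounds the common denominator when at most L fractions are approximated within
-- 1 / (2L). `seqBound L` is the total weight of L coefficients, each at most twice that
-- denominator.
dirichletBound seqBound : ℕ → ℕ
dirichletBound L = suc (2 * L + 2 * L) ^ L
seqBound L = L * (2 * dirichletBound L)

dirichletBound≥1 : ∀ L → 1 ≤ dirichletBound L
dirichletBound≥1 L = ℕ.m^n>0 (suc (2 * L + 2 * L)) L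

module _ {L p : ℕ} {f : Seq} (per : Periodic (suc p) f) where

  opaque
    -- With c = |r j₀|, the rounding error `s` satisfies c z = t r + s, and t r acts on `f` as t l
    -- times the shift by `K`. The at most L entries of `s` are bounded by c / (2L) and contribute
    -- at most c / 2; the term t l contributes less than c / 2 because `r j₀` is large. So c z has
    -- weight less than c, and `contraction-vanishes` applies.
    shorter-relation : ∀ {e} K l (r : Fin e → ℤ) j₀ → suc e ≤ L → (∀ i → l ℤ.* f (K + i) ≡ act 1 r f i) →
      2 * dirichletBound L * ∣ l ∣ < ∣ r j₀ ∣ →
      Σ (Fin e → ℤ) λ z → (∃ λ j → z j ≢ 0ℤ) × (∀ k → act 1 z f k ≡ 0ℤ)
    shorter-relation {e} K l r j₀ e<L eq large = z , (j₀ , z₀≢0) ,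
      contraction-vanishes c (+ t ℤ.* l) K (c ℕ./ N) s z s≤ weight (proj₁ bounded) f per (proj₂ bounded) operator
      where
      c N : ℕ
      c = ∣ r j₀ ∣
      N = 2 * L
      instance
        c≢0 : ℕ.NonZero c
        c≢0 = ℕ.>-nonZero (ℕ.≤-<-trans z≤n large)
        N≢0 : ℕ.NonZero N
        N≢0 = ℕ.>-nonZero (ℕ.≤-trans (ℕ.≤-trans (s≤s z≤n) e<L) (ℕ.m≤n*m L 2))
      bounded : ∃ λ M → ∀ k → ∣ f k ∣ ≤ M
      bounded = periodic-bounded per
      approx : ∃ λ t → 1 ≤ t × t ≤ suc (N + N) ^ e × Σ (Fin e → ℤ) λ z → ∀ j → ∣ + t ℤ.* r j ℤ.- + c ℤ.* z j ∣ * N < c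
      approx = dirichlet r c N
      t : ℕ
      t = proj₁ approx
      z s : Fin e → ℤ
      z = proj₁ (proj₂ (proj₂ (proj₂ approx)))
      s j = + c ℤ.* z j ℤ.- + t ℤ.* r j
      close : ∀ j → ∣ + t ℤ.* r j ℤ.- + c ℤ.* z j ∣ * N < c
      close = proj₂ (proj₂ (proj₂ (proj₂ approx)))
      t≤ : t ≤ dirichletBound L
      t≤ = ℕ.≤-trans (proj₁ (proj₂ (proj₂ approx))) (ℕ.^-monoʳ-≤ (suc (N + N)) (ℕ.<⇒≤ e<L))
      s≤ : ∀ j → ∣ s j ∣ ≤ c ℕ./ N
      s≤ j = begin
        ∣ s j ∣                                   ≡⟨ ℤ.∣i-j∣≡∣j-i∣ (+ c ℤ.* z j) (+ t ℤ.* r j) ⟩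
        d                                         ≡⟨ sym (ℕ.m*n/n≡m d N) ⟩
        d * N ℕ./ N                               ≤⟨ ℕ./-monoˡ-≤ N (ℕ.<⇒≤ (close j)) ⟩
        c ℕ./ N                                   ∎
        where
        open ℕ.≤-Reasoning
        d : ℕ
        d = ∣ + t ℤ.* r j ℤ.- + c ℤ.* z j ∣
      weight : ∣ + t ℤ.* l ∣ + e * (c ℕ./ N) < c
      weight = ℕ.*-cancelˡ-< 2 _ c (begin-strict
        2 * (∣ + t ℤ.* l ∣ + e * (c ℕ./ N))       ≡⟨ cong (λ u → 2 * (u + e * (c ℕ./ N))) (ℤ.∣i*j∣≡∣i∣*∣j∣ (+ t) l) ⟩
        2 * (t * ∣ l ∣ + e * (c ℕ./ N))           ≡⟨ dist t ∣ l ∣ e (c ℕ./ N) ⟩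
        2 * t * ∣ l ∣ + (c ℕ./ N) * (2 * e)       ≤⟨ ℕ.+-mono-≤ (ℕ.*-monoˡ-≤ ∣ l ∣ (ℕ.*-monoʳ-≤ 2 t≤)) (ℕ.*-monoʳ-≤ (c ℕ./ N) (ℕ.*-monoʳ-≤ 2 (ℕ.<⇒≤ e<L))) ⟩
        2 * dirichletBound L * ∣ l ∣ + (c ℕ./ N) * N   <⟨ ℕ.+-mono-<-≤ large (ℕ.m/n*n≤m c N) ⟩
        c + c                                     ≡⟨ cong (λ u → c + u) (sym (ℕ.+-identityʳ c)) ⟩
        2 * c                                     ∎)
        where
        open ℕ.≤-Reasoning
        dist : ∀ t l e q → 2 * (t * l + e * q) ≡ 2 * t * l + q * (2 * e)
        dist = ℕ-Ring.solve-∀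
      z₀≢0 : z j₀ ≢ 0ℤ
      -- Rounding t r j₀ / c to zero would leave an error of t c, which is at least c.
      z₀≢0 z₀≡0 = ℕ.<⇒≱ (close j₀) (begin
        c                                         ≤⟨ ℕ.m≤n*m c t {{ℕ.>-nonZero (proj₁ (proj₂ approx))}} ⟩
        t * c                                     ≤⟨ ℕ.m≤m*n (t * c) N ⟩
        t * c * N                                 ≡⟨ cong (_* N) (sym (ℤ.∣i*j∣≡∣i∣*∣j∣ (+ t) (r j₀))) ⟩
        ∣ + t ℤ.* r j₀ ∣ * N                      ≡⟨ cong (λ u → ∣ u ∣ * N) (sym (ℤ.+-identityʳ (+ t ℤ.* r j₀))) ⟩
        ∣ + t ℤ.* r j₀ ℤ.- 0ℤ ∣ * N               ≡⟨ cong (λ u → ∣ + t ℤ.* r j₀ ℤ.- u ∣ * N) (sym (trans (cong (+ c ℤ.*_) z₀≡0) (ℤ.*-zeroʳ (+ c)))) ⟩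
        ∣ + t ℤ.* r j₀ ℤ.- + c ℤ.* z j₀ ∣ * N     ∎)
        where open ℕ.≤-Reasoning
      operator : ∀ i → + c ℤ.* act 1 z f i ≡ + t ℤ.* l ℤ.* f (K + i) ℤ.+ act 1 s f i
      operator i = sym (begin
        + t ℤ.* l ℤ.* f (K + i) ℤ.+ act 1 s f i
          ≡⟨ cong₂ ℤ._+_ (trans (ℤ.*-assoc (+ t) l _) (cong (+ t ℤ.*_) (eq i)))
               (trans (∙-comm s F) (∙-distrib-- F (λ j → + c ℤ.* z j) (λ j → + t ℤ.* r j))) ⟩
        + t ℤ.* act 1 r f i ℤ.+ (F ∙ (λ j → + c ℤ.* z j) ℤ.- F ∙ (λ j → + t ℤ.* r j))
          ≡⟨ cong₂ (λ u v → + t ℤ.* act 1 r f i ℤ.+ (u ℤ.- v))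
               (trans (∙-scaleʳ (+ c) F z) (cong (+ c ℤ.*_) (∙-comm F z))) (trans (∙-scaleʳ (+ t) F r) (cong (+ t ℤ.*_) (∙-comm F r))) ⟩
        + t ℤ.* act 1 r f i ℤ.+ (+ c ℤ.* act 1 z f i ℤ.- + t ℤ.* act 1 r f i)
          ≡⟨ cancel (+ t ℤ.* act 1 r f i) (+ c ℤ.* act 1 z f i) ⟩
        + c ℤ.* act 1 z f i ∎)
        where
        open ≡-Reasoning
        F : Fin e → ℤ
        F j = f (toℕ j * 1 + i)
        cancel : ∀ u v → u ℤ.+ (v ℤ.- u) ≡ v
        cancel = ℤ-Ring.solve-∀

  module _ {H : ℕ} (window : ∀ i → i < L → ∣ f i ∣ ≤ H) where

    opaque
      coefficients-bounded : ∀ {e} K l (r : Fin e → ℤ) → l ≢ 0ℤ → suc e ≤ L → (∀ i → l ℤ.* f (K + i) ≡ act 1 r f i) →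
        (∀ j → ∣ r j ∣ ≤ 2 * dirichletBound L * ∣ l ∣) → ∣ f K ∣ ≤ seqBound L * H
      coefficients-bounded {e} K l r l≢0 e<L eq r≤ = ℕ.*-cancelˡ-≤ ∣ l ∣ {{ℕ.≢-nonZero (l≢0 ∘ ℤ.∣i∣≡0⇒i≡0)}} (begin
        ∣ l ∣ * ∣ f K ∣                     ≡⟨ sym (ℤ.∣i*j∣≡∣i∣*∣j∣ l (f K)) ⟩
        ∣ l ℤ.* f K ∣                       ≡⟨ cong (λ k → ∣ l ℤ.* f k ∣) (sym (ℕ.+-identityʳ K)) ⟩
        ∣ l ℤ.* f (K + 0) ∣                 ≡⟨ cong ∣_∣ (eq 0) ⟩
        ∣ act 1 r f 0 ∣                     ≤⟨ ∣∙∣≤ r _ r≤ (λ j → window (toℕ j * 1 + 0) (subst (_< L) (sym (trans (ℕ.+-identityʳ _) (ℕ.*-identityʳ _)))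
                                                 (ℕ.<-trans (Fin.toℕ<n j) e<L))) ⟩
        e * (2 * D * ∣ l ∣ * H)             ≤⟨ ℕ.*-monoˡ-≤ (2 * D * ∣ l ∣ * H) (ℕ.<⇒≤ e<L) ⟩
        L * (2 * D * ∣ l ∣ * H)             ≡⟨ rearr L D ∣ l ∣ H ⟩
        ∣ l ∣ * (seqBound L * H)            ∎)
        where
        open ℕ.≤-Reasoning
        D : ℕ
        D = dirichletBound L
        rearr : ∀ L D l H → L * (2 * D * l * H) ≡ l * (L * (2 * D) * H)
        rearr = ℕ-Ring.solve-∀

    opaque
      -- Induction on the length of the relation. A zero leading coefficient is dropped. Otherwise f
      -- K is a combination of the first e terms with ratios r j / l: either all ratios are small
      -- and the initial window bounds f K, or one is large and `shorter-relation` replaces the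
      -- relation. `L` stays fixed throughout, so the bound does not deteriorate with the
      -- replacements.
      periodic-seq-bounded : ∀ d → d ≤ L → (c : Fin d → ℤ) → (∃ λ j → c j ≢ 0ℤ) → (∀ k → act 1 c f k ≡ 0ℤ) →
        ∀ k → ∣ f k ∣ ≤ seqBound L * H
      periodic-seq-bounded (suc e) e<L c (j , cj≢0) cf≡0 k with c (Fin.fromℕ e) ℤ.≟ 0ℤ
      ... | yes ℓ≡0 = periodic-seq-bounded e (ℕ.<⇒≤ e<L) (c ∘ Fin.inject₁)
        (Fin.¬∀⟶∃¬ e _ (λ i → c (Fin.inject₁ i) ℤ.≟ 0ℤ) λ ini≡0 → cj≢0 (init-last-zero c ini≡0 ℓ≡0 j))
        (λ i → begin
          act 1 (c ∘ Fin.inject₁) f i                                          ≡⟨ sym (ℤ.+-identityʳ _) ⟩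
          act 1 (c ∘ Fin.inject₁) f i ℤ.+ 0ℤ ℤ.* f (e + i)                     ≡⟨ cong (λ t → act 1 (c ∘ Fin.inject₁) f i ℤ.+ t ℤ.* f (e + i)) (sym ℓ≡0) ⟩
          act 1 (c ∘ Fin.inject₁) f i ℤ.+ c (Fin.fromℕ e) ℤ.* f (e + i)        ≡⟨ sym (act-init-last c f i) ⟩
          act 1 c f i                                                          ≡⟨ cf≡0 i ⟩
          0ℤ                                                                   ∎) k
        where open ≡-Reasoning
      ... | no ℓ≢0 with k ℕ.<? e
      ...   | yes k<e = ℕ.≤-trans (window k (ℕ.<-trans k<e e<L)) (ℕ.m≤n*m H (seqBound L) {{ℕ.>-nonZero
              (ℕ.*-mono-≤ (ℕ.≤-trans (s≤s z≤n) e<L) (ℕ.*-mono-≤ {1} {2} (s≤s z≤n) (dirichletBound≥1 L)))}})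
      ...   | no k≮e = subst (λ K → ∣ f K ∣ ≤ seqBound L * H) (ℕ.m∸n+n≡m (ℕ.≮⇒≥ k≮e)) (finish (reduce-shift c f ℓ≢0 cf≡0 (k ℕ.∸ e)))
        where
        K : ℕ
        K = k ℕ.∸ e + e
        finish : (∃ λ l → l ≢ 0ℤ × Σ (Fin e → ℤ) λ r → ∀ i → l ℤ.* f (K + i) ≡ act 1 r f i) → ∣ f K ∣ ≤ seqBound L * H
        finish (l , l≢0 , r , eq) = decide (Fin.all? λ j → ∣ r j ∣ ℕ.≤? 2 * dirichletBound L * ∣ l ∣)
          where
          decide : Dec (∀ j → ∣ r j ∣ ≤ 2 * dirichletBound L * ∣ l ∣) → ∣ f K ∣ ≤ seqBound L * H
          decide (yes r≤) = coefficients-bounded K l r l≢0 e<L eq r≤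
          decide (no ¬r≤) = shorten (Fin.¬∀⟶∃¬ e _ (λ j → ∣ r j ∣ ℕ.≤? 2 * dirichletBound L * ∣ l ∣) ¬r≤)
            where
            shorten : (∃ λ j → ¬ (∣ r j ∣ ≤ 2 * dirichletBound L * ∣ l ∣)) → ∣ f K ∣ ≤ seqBound L * H
            shorten (j₀ , big) = relation (shorter-relation K l r j₀ e<L eq (ℕ.≰⇒> big))
              where
              relation : (Σ (Fin e → ℤ) λ z → (∃ λ j → z j ≢ 0ℤ) × (∀ k → act 1 z f k ≡ 0ℤ)) → ∣ f K ∣ ≤ seqBound L * H
              relation (z , z≢0 , zf≡0) = periodic-seq-bounded e (ℕ.<⇒≤ e<L) z z≢0 zf≡0 K

opaque
  -- If the constant coefficient is nonzero, the recurrence runs backwards from the vanishing tail.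
  -- If it is zero, it is dropped together with the first term of `h`; this happens fewer than d
  -- times.
  vanishes-from-order : ∀ {d} (c : Fin d → ℤ) → (∃ λ j → c j ≢ 0ℤ) → ∀ h → (∀ k → act 1 c h k ≡ 0ℤ) →
    ∀ a → (∀ k → h (a + k) ≡ 0ℤ) → ∀ k → h (d + k) ≡ 0ℤ
  vanishes-from-order {suc e} c (j , cj≢0) h ch≡0 a tail≡0 k with c zero ℤ.≟ 0ℤ
  ... | no c₀≢0 = back a tail≡0 (suc e + k)
    where
    back : ∀ a → (∀ k → h (a + k) ≡ 0ℤ) → ∀ k → h k ≡ 0ℤ
    back zero    tail≡0 = tail≡0
    back (suc a) tail≡0 = back a λ { zero → trans (cong h (ℕ.+-identityʳ a)) ha≡0
                                    ; (suc k) → trans (cong h (ℕ.+-suc a k)) (tail≡0 k) }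
      where
      open ≡-Reasoning
      ha≡0 : h a ≡ 0ℤ
      ha≡0 = [ ⊥-elim ∘ c₀≢0 , id ]′ (ℤ.i*j≡0⇒i≡0∨j≡0 (c zero) (begin
        c zero ℤ.* h a                       ≡⟨ sym (ℤ.+-identityʳ _) ⟩
        c zero ℤ.* h a ℤ.+ 0ℤ                ≡⟨ cong (λ t → c zero ℤ.* h a ℤ.+ t) (sym (∙-zeroʳ (c ∘ suc) λ i →
                                                  trans (cong h (cong suc (ℕ.+-comm (toℕ i * 1) a))) (tail≡0 (toℕ i * 1)))) ⟩
        act 1 c h a                          ≡⟨ ch≡0 a ⟩
        0ℤ                                   ∎))
  ... | yes c₀≡0 = vanishes-from-order (c ∘ suc) (nonzero j cj≢0) (h ∘ suc) (λ i → begin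
        act 1 (c ∘ suc) (h ∘ suc) i                           ≡⟨ sym (ℤ.+-identityˡ _) ⟩
        0ℤ ℤ.* h i ℤ.+ act 1 (c ∘ suc) (h ∘ suc) i            ≡⟨ cong (λ t → t ℤ.* h i ℤ.+ act 1 (c ∘ suc) (h ∘ suc) i) (sym c₀≡0) ⟩
        act 1 c h i                                           ≡⟨ ch≡0 i ⟩
        0ℤ                                                    ∎)
      a (λ i → trans (cong h (sym (ℕ.+-suc a i))) (tail≡0 (suc i))) k
    where
    open ≡-Reasoning
    nonzero : ∀ j → c j ≢ 0ℤ → ∃ λ i → c (suc i) ≢ 0ℤ
    nonzero zero    c₀≢0 = contradiction c₀≡0 c₀≢0
    nonzero (suc i) ci≢0 = i , ci≢0

opaque
  -- The difference of `f` and its shift by the period satisfies the same recurrence and vanishes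
  -- eventually, hence from index `L` on: the pre-period is at most `L`, whatever `a` is. The
  -- sequence is purely periodic after its first L terms, and a window of length 2L contains L terms
  -- of that part.
  seq-bounded : ∀ {L p a H} f (c : Fin L → ℤ) → (∃ λ j → c j ≢ 0ℤ) → (∀ k → act 1 c f k ≡ 0ℤ) →
    (∀ k → f (suc p + (a + k)) ≡ f (a + k)) → (∀ i → i < L + L → ∣ f i ∣ ≤ H) → ∀ k → ∣ f k ∣ ≤ seqBound L * H
  seq-bounded {L} {p} {a} {H} f c c≢0 cf≡0 evper window k with k ℕ.<? L
  ... | yes k<L = ℕ.≤-trans (window k (ℕ.<-≤-trans k<L (ℕ.m≤m+n L L))) (ℕ.m≤n*m H (seqBound L) {{ℕ.>-nonZero
          (ℕ.*-mono-≤ (ℕ.≤-trans (s≤s z≤n) k<L) (ℕ.*-mono-≤ {1} {2} (s≤s z≤n) (dirichletBound≥1 L)))}})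
  ... | no k≮L = subst (λ k → ∣ f k ∣ ≤ seqBound L * H) (ℕ.m+[n∸m]≡n (ℕ.≮⇒≥ k≮L))
        (periodic-seq-bounded {L} {p} {g} perg (λ i i<L → window (L + i) (ℕ.+-monoʳ-< L i<L)) L ℕ.≤-refl c c≢0
          (λ i → trans (act-shift 1 c f L i) (cf≡0 (L + i))) (k ℕ.∸ L))
    where
    g h : Seq
    g k = f (L + k)
    h k = f (suc p + k) ℤ.- f k
    ch≡0 : ∀ k → act 1 c h k ≡ 0ℤ
    ch≡0 k = trans (∙-distrib-- c _ _) (cong₂ ℤ._-_ (trans (act-shift 1 c f (suc p) k) (cf≡0 (suc p + k))) (cf≡0 k))
    perg : Periodic (suc p) g
    perg k = trans (cong f (swap L (suc p) k)) (ℤ.i-j≡0⇒i≡j _ _ (vanishes-from-order c c≢0 h ch≡0 a (λ k → ℤ.i≡j⇒i-j≡0 (evper k)) k))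
      where
      swap : ∀ a b c → a + (b + c) ≡ b + (a + c)
      swap = ℕ-Ring.solve-∀

-- Powers of integer matrices

Mat : ℕ → Set
Mat n = Fin n → Fin n → ℤ

-- Only the action on vectors is iterated; column `l` of the k-th power is `pow M k (δ l)`.
pow : ∀ {n} → Mat n → ℕ → (Fin n → ℤ) → Fin n → ℤ
pow M zero    x = x
pow M (suc k) x = λ i → M i ∙ pow M k x

pow-cong : ∀ {n} (M : Mat n) k {x y} → x ≗ y → pow M k x ≗ pow M k y
pow-cong M zero    x≗y = x≗y
pow-cong M (suc k) x≗y i = ∙-congʳ (M i) (pow-cong M k x≗y)

pow-+ : ∀ {n} (M : Mat n) j k x → pow M (j + k) x ≗ pow M j (pow M k x)
pow-+ M zero    k x i = refl
pow-+ M (suc j) k x i = ∙-congʳ (M i) (pow-+ M j k x)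

pow-linear : ∀ {n d} (M : Mat n) k (c : Fin d → ℤ) (X : Fin d → Fin n → ℤ) i →
  pow M k (λ i → c ∙ λ j → X j i) i ≡ c ∙ λ j → pow M k (X j) i
pow-linear M zero    c X i = refl
pow-linear M (suc k) c X i = begin
  M i ∙ pow M k (λ i → c ∙ λ j → X j i)          ≡⟨ ∙-congʳ (M i) (pow-linear M k c X) ⟩
  M i ∙ (λ l → c ∙ λ j → pow M k (X j) l)        ≡⟨ ∙-comm (M i) (λ l → c ∙ λ j → pow M k (X j) l) ⟩
  (λ l → c ∙ λ j → pow M k (X j) l) ∙ M i        ≡⟨ ∙-assoc c (λ j → pow M k (X j)) (M i) ⟩
  c ∙ (λ j → pow M k (X j) ∙ M i)                ≡⟨ ∙-congʳ c (λ j → ∙-comm (pow M k (X j)) (M i)) ⟩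
  c ∙ (λ j → M i ∙ pow M k (X j))                ∎
  where open ≡-Reasoning

δ-sym : ∀ {n} (i j : Fin n) → δ i j ≡ δ j i
δ-sym zero    zero    = refl
δ-sym zero    (suc j) = refl
δ-sym (suc i) zero    = refl
δ-sym (suc i) (suc j) = δ-sym i j

pow-basis : ∀ {n} (M : Mat n) k x i → pow M k x i ≡ x ∙ λ l → pow M k (δ l) i
pow-basis M k x i = trans (pow-cong M k (λ i → sym (trans (∙-congʳ x λ l → δ-sym l i) (trans (∙-comm x (δ i)) (δ-∙ i x)))) i)
  (pow-linear M k x δ i)

-- Exponential in `k`, hence of use for the initial window only.
pow-crude : ∀ {n X} (M : Mat n) → (∀ i j → ∣ M i j ∣ ≤ X) → ∀ k l i → ∣ pow M k (δ l) i ∣ ≤ (n * X) ^ k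
pow-crude M M≤X zero    l i = ∣δ∣≤1 l i
pow-crude {n} {X} M M≤X (suc k) l i = ℕ.≤-trans (∣∙∣≤ (M i) (pow M k (δ l)) (M≤X i) (pow-crude M M≤X k l))
  (ℕ.≤-reflexive (sym (ℕ.*-assoc n X ((n * X) ^ k))))

-- The bound of `seq-bounded` for relations of length L = n + 1, with `pow-crude` supplying the
-- window of the first 2L powers.
entryBound : ℕ → ℕ → ℕ
entryBound n X = seqBound (suc n) * (suc n * X) ^ (suc n + suc n)

Recurrence : ∀ {n} → Mat n → Fin n → Set
Recurrence {n} M l = Σ (Fin (suc n) → ℤ) λ c → (∃ λ j → c j ≢ 0ℤ) ×
  (∀ i k → act 1 c (λ k → pow M k (δ l) i) k ≡ 0ℤ)

opaque
  -- The n + 1 vectors M^j e_l lie in dimension n and are dependent, which takes the place of the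
  -- characteristic polynomial. Being a relation between vectors, it survives the application of any
  -- power of `M` and serves every entry of the column at once.
  linear-recurrence : ∀ {n} (M : Mat n) l → Recurrence M l
  linear-recurrence {n} M l = from-siegel (siegel H (λ i j → pow M (toℕ j) (δ l) i) entry≤H (ℕ.n<1+n n))
    where
    entry≤H′ : ∃ λ H → ∀ i → proj₁ (finite-bound λ (j : Fin (suc n)) → ∣ pow M (toℕ j) (δ l) i ∣) ≤ H
    entry≤H′ = finite-bound {n} λ i → proj₁ (finite-bound λ (j : Fin (suc n)) → ∣ pow M (toℕ j) (δ l) i ∣)
    H : ℕ
    H = proj₁ entry≤H′
    entry≤H : ∀ i (j : Fin (suc n)) → ∣ pow M (toℕ j) (δ l) i ∣ ≤ H
    entry≤H i j = ℕ.≤-trans (proj₂ (finite-bound λ (j : Fin (suc n)) → ∣ pow M (toℕ j) (δ l) i ∣) j) (proj₂ entry≤H′ i)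
    from-siegel : (Σ (Fin (suc n) → ℤ) λ c → (∃ λ j → c j ≢ 0ℤ) × (∀ j → ∣ c j ∣ ≤ siegelBound n (suc n) H) ×
        (∀ i → (λ j → pow M (toℕ j) (δ l) i) ∙ c ≡ 0ℤ)) → Recurrence M l
    from-siegel (c , c≢0 , _ , Mc≡0) = c , c≢0 , λ i k → begin
      c ∙ (λ j → pow M (toℕ j * 1 + k) (δ l) i)              ≡⟨ ∙-congʳ c (λ j → trans (cong (λ t → pow M t (δ l) i) (arith (toℕ j) k)) (pow-+ M k (toℕ j) (δ l) i)) ⟩
      c ∙ (λ j → pow M k (pow M (toℕ j) (δ l)) i)            ≡⟨ sym (pow-linear M k c (λ j → pow M (toℕ j) (δ l)) i) ⟩
      pow M k (λ i → c ∙ λ j → pow M (toℕ j) (δ l) i) i      ≡⟨ pow-basis M k (λ i → c ∙ λ j → pow M (toℕ j) (δ l) i) i ⟩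
      (λ i → c ∙ λ j → pow M (toℕ j) (δ l) i) ∙ _            ≡⟨ ∙-comm (λ i → c ∙ λ j → pow M (toℕ j) (δ l) i) (λ l → pow M k (δ l) i) ⟩
      (λ l → pow M k (δ l) i) ∙ _                            ≡⟨ ∙-zeroʳ (λ l → pow M k (δ l) i) (λ i → trans (∙-comm c (λ j → pow M (toℕ j) (δ l) i)) (Mc≡0 i)) ⟩
      0ℤ                                                     ∎
      where
      open ≡-Reasoning
      arith : ∀ j k → j * 1 + k ≡ k + j
      arith = ℕ-Ring.solve-∀

EventuallyPeriodic : ∀ {n} → Mat n → ℕ → ℕ → Set
EventuallyPeriodic M a p = ∀ x → pow M (suc p + a) x ≗ pow M a x

module _ {n X a p : ℕ} (M : Mat n) (1≤X : 1 ≤ X) (M≤X : ∀ i j → ∣ M i j ∣ ≤ X) (ev : EventuallyPeriodic M a p) where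

  opaque
    pow-entry-bounded : ∀ k l i → ∣ pow M k (δ l) i ∣ ≤ entryBound n X
    pow-entry-bounded k l i = from-recurrence (linear-recurrence M l)
      where
      f : Seq
      f k = pow M k (δ l) i
      shifted : ∀ k → f (suc p + (a + k)) ≡ f (a + k)
      shifted k = begin
        f (suc p + (a + k))                      ≡⟨ cong f (sym (ℕ.+-assoc (suc p) a k)) ⟩
        f (suc p + a + k)                        ≡⟨ pow-+ M (suc p + a) k (δ l) i ⟩
        pow M (suc p + a) (pow M k (δ l)) i      ≡⟨ ev (pow M k (δ l)) i ⟩
        pow M a (pow M k (δ l)) i                ≡⟨ sym (pow-+ M a k (δ l) i) ⟩
        f (a + k)                                ∎
        where open ≡-Reasoning
      nonzero : ℕ.NonZero (suc n * X)
      nonzero = ℕ.>-nonZero (ℕ.*-mono-≤ {1} {suc n} (s≤s z≤n) 1≤X)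
      window : ∀ i → i < suc n + suc n → ∣ f i ∣ ≤ (suc n * X) ^ (suc n + suc n)
      window k k< = ℕ.≤-trans (pow-crude M M≤X k l i) (ℕ.≤-trans (ℕ.^-monoˡ-≤ k (ℕ.*-monoˡ-≤ X (ℕ.n≤1+n n)))
        (ℕ.^-monoʳ-≤ (suc n * X) {{nonzero}} (ℕ.<⇒≤ k<)))
      from-recurrence : Recurrence M l → ∣ f k ∣ ≤ entryBound n X
      from-recurrence (c , c≢0 , cf≡0) = seq-bounded {p = p} {a} f c c≢0 (cf≡0 i) shifted window k

  PeriodWithin : ℕ → Set
  PeriodWithin B = ∃₂ λ α π → suc π + α ≤ B × EventuallyPeriodic M α π

  opaque
    -- Neither `a` nor `p` enters the bound on the entries, so two of the first powers agree by
    -- counting matrices with n² bounded entries. This trades a period merely known to exist for a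
    -- short one.
    pow-period : PeriodWithin (suc (entryBound n X + entryBound n X) ^ (n * n))
    pow-period = from-collision (pigeonhole-box E g (λ k q → pow-entry-bounded (toℕ k) (row q) (col q)) (ℕ.n<1+n _))
      where
      E : ℕ
      E = entryBound n X
      row col : Fin (n * n) → Fin n
      row q = proj₁ (Fin.remQuot n q)
      col q = proj₂ (Fin.remQuot {n} n q)
      g : Fin (suc (suc (E + E) ^ (n * n))) → Fin (n * n) → ℤ
      g k q = pow M (toℕ k) (δ (row q)) (col q)
      from-collision : (∃₂ λ r s → r Fin.< s × g r ≗ g s) → PeriodWithin (suc (E + E) ^ (n * n))
      from-collision (r , s , r<s , same) = toℕ r , toℕ s ℕ.∸ suc (toℕ r) ,
        subst (_≤ suc (E + E) ^ (n * n)) (sym sum≡) (ℕ.≤-pred (Fin.toℕ<n s)) ,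
        λ x i → trans (cong (λ t → pow M t x i) sum≡) (begin
          pow M (toℕ s) x i                          ≡⟨ pow-basis M (toℕ s) x i ⟩
          x ∙ (λ l → pow M (toℕ s) (δ l) i)          ≡⟨ ∙-congʳ x (λ l → sym (entry l i)) ⟩
          x ∙ (λ l → pow M (toℕ r) (δ l) i)          ≡⟨ sym (pow-basis M (toℕ r) x i) ⟩
          pow M (toℕ r) x i                          ∎)
        where
        open ≡-Reasoning
        sum≡ : suc (toℕ s ℕ.∸ suc (toℕ r)) + toℕ r ≡ toℕ s
        sum≡ = trans (sym (ℕ.+-suc (toℕ s ℕ.∸ suc (toℕ r)) (toℕ r))) (ℕ.m∸n+n≡m r<s)
        entry : ∀ l i → pow M (toℕ r) (δ l) i ≡ pow M (toℕ s) (δ l) i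
        entry l i = subst (λ q → pow M (toℕ r) (δ (proj₁ q)) (proj₂ q) ≡ pow M (toℕ s) (δ (proj₁ q)) (proj₂ q))
          (Fin.remQuot-combine l i) (same (combine l i))

-- Affine maps and their iterates

vec-ext : ∀ {n} {A : Set} {u v : Vec A n} → lookup u ≗ lookup v → u ≡ v
vec-ext {u = u} {v} eq = trans (sym (Vec.tabulate∘lookup u)) (trans (Vec.tabulate-cong eq) (Vec.tabulate∘lookup v))

infixl 6 _⊞_
infixr 7 _⊡_

_⊞_ : ∀ {n} → Vec ℤ n → Vec ℤ n → Vec ℤ n
_⊞_ = zipWith ℤ._+_

_⊡_ : ∀ {n} → ℤ → Vec ℤ n → Vec ℤ n
t ⊡ v = Vec.map (t ℤ.*_) v

0ᵥ : ∀ {n} → Vec ℤ n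
0ᵥ = Vec.replicate _ 0ℤ

lookup-⊞ : ∀ {n} (u v : Vec ℤ n) i → lookup (u ⊞ v) i ≡ lookup u i ℤ.+ lookup v i
lookup-⊞ u v i = Vec.lookup-zipWith ℤ._+_ i u v

lookup-⊡ : ∀ {n} t (v : Vec ℤ n) i → lookup (t ⊡ v) i ≡ t ℤ.* lookup v i
lookup-⊡ t v i = Vec.lookup-map i (t ℤ.*_) v

dot≡∙ : ∀ {n} (u v : Vec ℤ n) → dot u v ≡ lookup u ∙ lookup v
dot≡∙ []      []      = refl
dot≡∙ (x ∷ u) (y ∷ v) = cong (λ t → x ℤ.* y ℤ.+ t) (dot≡∙ u v)

entry : ∀ {n} → Matrix n → Mat n
entry M i j = lookup (lookup M i) j

lookup-·ᵥ : ∀ {n} (M : Matrix n) v i → lookup (M ·ᵥ v) i ≡ entry M i ∙ lookup v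
lookup-·ᵥ M v i = trans (Vec.lookup-map i (λ row → dot row v) M) (dot≡∙ (lookup M i) v)

lookup-transpose : ∀ {m n} {A : Set} (M : Vec (Vec A n) m) i j → lookup (lookup (transpose M) i) j ≡ lookup (lookup M j) i
lookup-transpose {n = n} (v ∷ M) i j = trans (cong (λ r → lookup r j) row) (case j)
  where
  row : lookup (transpose (v ∷ M)) i ≡ lookup v i ∷ lookup (transpose M) i
  row = trans (Vec.lookup-⊛ i (Vec.replicate n Vec._∷_ ⊛ v) (transpose M))
    (cong (λ f → f (lookup (transpose M) i)) (trans (Vec.lookup-⊛ i (Vec.replicate n Vec._∷_) v)
      (cong (λ f → f (lookup v i)) (Vec.lookup-replicate i Vec._∷_))))
  case : ∀ j → lookup (lookup v i ∷ lookup (transpose M) i) j ≡ lookup (lookup (v ∷ M) j) i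
  case zero    = refl
  case (suc j) = lookup-transpose M i j

⊗-·ᵥ : ∀ {n} (M N : Matrix n) v → (M ⊗ N) ·ᵥ v ≡ M ·ᵥ (N ·ᵥ v)
⊗-·ᵥ M N v = vec-ext λ i → begin
  lookup ((M ⊗ N) ·ᵥ v) i                                 ≡⟨ lookup-·ᵥ (M ⊗ N) v i ⟩
  entry (M ⊗ N) i ∙ lookup v                              ≡⟨ ∙-congˡ (lookup v) (entry-⊗ i) ⟩
  (λ j → entry M i ∙ (λ l → entry N l j)) ∙ lookup v      ≡⟨ ∙-assoc (entry M i) (entry N) (lookup v) ⟩
  entry M i ∙ (λ l → entry N l ∙ lookup v)                ≡⟨ ∙-congʳ (entry M i) (λ l → sym (lookup-·ᵥ N v l)) ⟩
  entry M i ∙ lookup (N ·ᵥ v)                             ≡⟨ sym (lookup-·ᵥ M (N ·ᵥ v) i) ⟩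
  lookup (M ·ᵥ (N ·ᵥ v)) i                                ∎
  where
  open ≡-Reasoning
  entry-⊗ : ∀ i j → entry (M ⊗ N) i j ≡ entry M i ∙ (λ l → entry N l j)
  entry-⊗ i j = trans (cong (λ r → lookup r j) (Vec.lookup-map i (λ row → Vec.map (dot row) (transpose N)) M))
    (trans (Vec.lookup-map j (dot (lookup M i)) (transpose N))
    (trans (dot≡∙ (lookup M i) (lookup (transpose N) j)) (∙-congʳ (entry M i) (lookup-transpose N j))))

δ-refl : ∀ {n} (i : Fin n) → δ i i ≡ 1ℤ
δ-refl zero    = refl
δ-refl (suc i) = δ-refl i

δ-≢ : ∀ {n} {i j : Fin n} → i ≢ j → δ i j ≡ 0ℤ
δ-≢ {i = zero}  {zero}  i≢j = contradiction refl i≢j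
δ-≢ {i = zero}  {suc j} i≢j = refl
δ-≢ {i = suc i} {zero}  i≢j = refl
δ-≢ {i = suc i} {suc j} i≢j = δ-≢ (i≢j ∘ cong suc)

-- The entries of identity n are a Kronecker delta local to its definition; unification names it.
identity-entries : ∀ n → Σ (Mat n) λ f → ∀ i j → entry (identity n) i j ≡ f i j
identity-entries n = _ , λ i j → trans (cong (λ r → lookup r j) (Vec.lookup∘tabulate _ i)) (Vec.lookup∘tabulate _ j)

entry-identity : ∀ {n} i j → entry (identity n) i j ≡ δ i j
entry-identity {n} i j with i Fin.≟ j | proj₂ (identity-entries n) i j
... | yes refl | eq = trans eq (sym (δ-refl i))
... | no i≢j   | eq = trans eq (sym (δ-≢ i≢j))

identity-·ᵥ : ∀ {n} (v : Vec ℤ n) → identity n ·ᵥ v ≡ v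
identity-·ᵥ {n} v = vec-ext λ i → trans (lookup-·ᵥ (identity n) v i) (trans (∙-congˡ (lookup v) (entry-identity i)) (δ-∙ i (lookup v)))

iter : {A : Set} → (A → A) → ℕ → A → A
iter f zero    x = x
iter f (suc k) x = f (iter f k x)

iter-suc : ∀ {A : Set} (f : A → A) k x → iter f k (f x) ≡ iter f (suc k) x
iter-suc f zero    x = refl
iter-suc f (suc k) x = cong f (iter-suc f k x)

iter-+ : ∀ {A : Set} (f : A → A) j k x → iter f (j + k) x ≡ iter f j (iter f k x)
iter-+ f zero    k x = refl
iter-+ f (suc j) k x = cong f (iter-+ f j k x)

-- `L` is the linear part of `F`, kept as a map of its own: finiteness of the monoid speaks of the
-- linear action `lin` of a word, guards and drifts of its action `exec`, and both must share one
-- matrix.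
record Affine {n} (X : ℕ) (F L : Vec ℤ n → Vec ℤ n) : Set where
  field
    M      : Mat n
    c      : Fin n → ℤ
    M≤     : ∀ i j → ∣ M i j ∣ ≤ X
    c≤     : ∀ i → ∣ c i ∣ ≤ X
    affine : ∀ v i → lookup (F v) i ≡ M i ∙ lookup v ℤ.+ c i
    linear : ∀ v i → lookup (L v) i ≡ M i ∙ lookup v

Affine-id : ∀ {n} → Affine {n} 1 id id
Affine-id = record
  { M = δ ; c = λ _ → 0ℤ ; M≤ = ∣δ∣≤1 ; c≤ = λ _ → z≤n
  ; affine = λ v i → sym (trans (ℤ.+-identityʳ _) (δ-∙ i (lookup v)))
  ; linear = λ v i → sym (δ-∙ i (lookup v)) }

Affine-∘ : ∀ {n X Y} {F L F′ L′ : Vec ℤ n → Vec ℤ n} → 1 ≤ Y → Affine X F L → Affine Y F′ L′ →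
  Affine (suc n * X * Y) (F ∘ F′) (L ∘ L′)
Affine-∘ {n} {X} {Y} {F} {L} {F′} {L′} 1≤Y 𝑭 𝑭′ = record
  { M = M″ ; c = λ i → 𝐅.M i ∙ 𝐅′.c ℤ.+ 𝐅.c i
  ; M≤ = λ i j → ℕ.≤-trans (∣∙∣≤ (𝐅.M i) (λ l → 𝐅′.M l j) (𝐅.M≤ i) (λ l → 𝐅′.M≤ l j))
      (ℕ.≤-trans (ℕ.≤-reflexive (sym (ℕ.*-assoc n X Y))) (ℕ.*-monoˡ-≤ Y (ℕ.*-monoˡ-≤ X (ℕ.n≤1+n n))))
  ; c≤ = λ i → ℕ.≤-trans (∣+∣≤ (𝐅.M i ∙ 𝐅′.c) (𝐅.c i) (∣∙∣≤ (𝐅.M i) 𝐅′.c (𝐅.M≤ i) 𝐅′.c≤) (𝐅.c≤ i))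
      (ℕ.≤-trans (ℕ.+-monoʳ-≤ (n * (X * Y)) (ℕ.m≤m*n X Y {{ℕ.>-nonZero 1≤Y}})) (ℕ.≤-reflexive (arith n X Y)))
  ; affine = λ v i → begin
      lookup (F (F′ v)) i                                          ≡⟨ 𝐅.affine (F′ v) i ⟩
      𝐅.M i ∙ lookup (F′ v) ℤ.+ 𝐅.c i                              ≡⟨ cong (λ t → t ℤ.+ 𝐅.c i) (trans (∙-congʳ (𝐅.M i) (𝐅′.affine v))
                                                                        (∙-distrib-+ (𝐅.M i) (λ l → 𝐅′.M l ∙ lookup v) 𝐅′.c)) ⟩
      𝐅.M i ∙ (λ l → 𝐅′.M l ∙ lookup v) ℤ.+ 𝐅.M i ∙ 𝐅′.c ℤ.+ 𝐅.c i ≡⟨ cong (λ t → t ℤ.+ 𝐅.M i ∙ 𝐅′.c ℤ.+ 𝐅.c i) (sym (∙-assoc (𝐅.M i) 𝐅′.M (lookup v))) ⟩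
      M″ i ∙ lookup v ℤ.+ 𝐅.M i ∙ 𝐅′.c ℤ.+ 𝐅.c i                   ≡⟨ ℤ.+-assoc (M″ i ∙ lookup v) (𝐅.M i ∙ 𝐅′.c) (𝐅.c i) ⟩
      M″ i ∙ lookup v ℤ.+ (𝐅.M i ∙ 𝐅′.c ℤ.+ 𝐅.c i)                 ∎
  ; linear = λ v i → trans (𝐅.linear (L′ v) i) (trans (∙-congʳ (𝐅.M i) (𝐅′.linear v)) (sym (∙-assoc (𝐅.M i) 𝐅′.M (lookup v)))) }
  where
  open ≡-Reasoning
  module 𝐅 = Affine 𝑭
  module 𝐅′ = Affine 𝑭′
  M″ : Mat n
  M″ i j = 𝐅.M i ∙ λ l → 𝐅′.M l j
  arith : ∀ n X Y → n * (X * Y) + X * Y ≡ suc n * X * Y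
  arith = ℕ-Ring.solve-∀

Affine-mono : ∀ {n X Y} {F L : Vec ℤ n → Vec ℤ n} → X ≤ Y → Affine X F L → Affine Y F L
Affine-mono X≤Y 𝑭 = record { Affine 𝑭 ; M≤ = λ i j → ℕ.≤-trans (Affine.M≤ 𝑭 i j) X≤Y ; c≤ = λ i → ℕ.≤-trans (Affine.c≤ 𝑭 i) X≤Y }

Affine-⊞ : ∀ {n X} {F L : Vec ℤ n → Vec ℤ n} → Affine X F L → ∀ u t v → F (u ⊞ t ⊡ v) ≡ F u ⊞ t ⊡ L v
Affine-⊞ {F = F} {L} 𝑭 u t v = vec-ext λ i → begin
  lookup (F (u ⊞ t ⊡ v)) i                                     ≡⟨ 𝐅.affine (u ⊞ t ⊡ v) i ⟩
  𝐅.M i ∙ lookup (u ⊞ t ⊡ v) ℤ.+ 𝐅.c i                         ≡⟨ cong (λ z → z ℤ.+ 𝐅.c i) (trans (∙-congʳ (𝐅.M i) (λ l →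
                                                                    trans (lookup-⊞ u (t ⊡ v) l) (cong (λ z → lookup u l ℤ.+ z) (lookup-⊡ t v l))))
                                                                    (trans (∙-distrib-+ (𝐅.M i) (lookup u) (λ l → t ℤ.* lookup v l))
                                                                      (cong (λ z → 𝐅.M i ∙ lookup u ℤ.+ z) (∙-scaleʳ t (𝐅.M i) (lookup v))))) ⟩
  𝐅.M i ∙ lookup u ℤ.+ t ℤ.* 𝐅.M i ∙ lookup v ℤ.+ 𝐅.c i        ≡⟨ rearr (𝐅.M i ∙ lookup u) (t ℤ.* 𝐅.M i ∙ lookup v) (𝐅.c i) ⟩
  (𝐅.M i ∙ lookup u ℤ.+ 𝐅.c i) ℤ.+ t ℤ.* 𝐅.M i ∙ lookup v      ≡⟨ cong₂ (λ y z → y ℤ.+ t ℤ.* z) (sym (𝐅.affine u i)) (sym (𝐅.linear v i)) ⟩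
  lookup (F u) i ℤ.+ t ℤ.* lookup (L v) i                      ≡⟨ cong (λ z → lookup (F u) i ℤ.+ z) (sym (lookup-⊡ t (L v) i)) ⟩
  lookup (F u) i ℤ.+ lookup (t ⊡ L v) i                        ≡⟨ sym (lookup-⊞ (F u) (t ⊡ L v) i) ⟩
  lookup (F u ⊞ t ⊡ L v) i                                     ∎
  where
  open ≡-Reasoning
  module 𝐅 = Affine 𝑭
  rearr : ∀ a b c → a ℤ.+ b ℤ.+ c ≡ (a ℤ.+ c) ℤ.+ b
  rearr = ℤ-Ring.solve-∀

-- The constant part of Fᵏ is the sum of the Mʲ c over j < k.
module Iteration {n X E : ℕ} {F L : Vec ℤ n → Vec ℤ n} (𝑭 : Affine X F L)
  (pow≤E : ∀ k l i → ∣ pow (Affine.M 𝑭) k (δ l) i ∣ ≤ E) where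

  open Affine 𝑭

  offset : ℕ → Fin n → ℤ
  offset zero    i = 0ℤ
  offset (suc k) i = offset k i ℤ.+ pow M k c i

  offset-suc : ∀ k i → M i ∙ offset k ℤ.+ c i ≡ offset (suc k) i
  offset-suc zero    i = trans (cong (λ t → t ℤ.+ c i) (∙-zeroʳ (M i) λ _ → refl)) refl
  offset-suc (suc k) i = begin
    M i ∙ (λ l → offset k l ℤ.+ pow M k c l) ℤ.+ c i            ≡⟨ cong (λ t → t ℤ.+ c i) (∙-distrib-+ (M i) (offset k) (pow M k c)) ⟩
    M i ∙ offset k ℤ.+ pow M (suc k) c i ℤ.+ c i                ≡⟨ rearr (M i ∙ offset k) (pow M (suc k) c i) (c i) ⟩
    M i ∙ offset k ℤ.+ c i ℤ.+ pow M (suc k) c i                ≡⟨ cong (λ t → t ℤ.+ pow M (suc k) c i) (offset-suc k i) ⟩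
    offset (suc k) i ℤ.+ pow M (suc k) c i                      ∎
    where
    open ≡-Reasoning
    rearr : ∀ a b c → a ℤ.+ b ℤ.+ c ≡ a ℤ.+ c ℤ.+ b
    rearr = ℤ-Ring.solve-∀

  offset≤ : ∀ k i → ∣ offset k i ∣ ≤ k * (n * (X * E))
  offset≤ zero    i = z≤n
  offset≤ (suc k) i = ℕ.≤-trans (∣+∣≤ (offset k i) (pow M k c i) (offset≤ k i)
      (subst (λ t → ∣ t ∣ ≤ n * (X * E)) (sym (pow-basis M k c i)) (∣∙∣≤ c (λ l → pow M k (δ l) i) c≤ (λ l → pow≤E k l i))))
    (ℕ.≤-reflexive (ℕ.+-comm (k * (n * (X * E))) (n * (X * E))))

  iter-affine : ∀ k v i → lookup (iter F k v) i ≡ pow M k (lookup v) i ℤ.+ offset k i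
  iter-affine zero    v i = sym (ℤ.+-identityʳ _)
  iter-affine (suc k) v i = begin
    lookup (F (iter F k v)) i                                                 ≡⟨ affine (iter F k v) i ⟩
    M i ∙ lookup (iter F k v) ℤ.+ c i                                         ≡⟨ cong (λ t → t ℤ.+ c i) (trans (∙-congʳ (M i) (iter-affine k v))
                                                                                   (∙-distrib-+ (M i) (pow M k (lookup v)) (offset k))) ⟩
    pow M (suc k) (lookup v) i ℤ.+ M i ∙ offset k ℤ.+ c i                     ≡⟨ ℤ.+-assoc (pow M (suc k) (lookup v) i) (M i ∙ offset k) (c i) ⟩
    pow M (suc k) (lookup v) i ℤ.+ (M i ∙ offset k ℤ.+ c i)                   ≡⟨ cong (λ t → pow M (suc k) (lookup v) i ℤ.+ t) (offset-suc k i) ⟩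
    pow M (suc k) (lookup v) i ℤ.+ offset (suc k) i                           ∎
    where open ≡-Reasoning

  iter-linear : ∀ k v i → lookup (iter L k v) i ≡ pow M k (lookup v) i
  iter-linear zero    v i = refl
  iter-linear (suc k) v i = trans (linear (iter L k v) i) (∙-congʳ (M i) (iter-linear k v))

  Affine-iter : ∀ {B} k → k ≤ B → Affine (E + B * (n * (X * E))) (iter F k) (iter L k)
  Affine-iter {B} k k≤B = record
    { M = λ i l → pow M k (δ l) i ; c = offset k
    ; M≤ = λ i l → ℕ.≤-trans (pow≤E k l i) (ℕ.m≤m+n E _)
    ; c≤ = λ i → ℕ.≤-trans (offset≤ k i) (ℕ.≤-trans (ℕ.*-monoˡ-≤ (n * (X * E)) k≤B) (ℕ.m≤n+m _ E))
    ; affine = λ v i → trans (iter-affine k v i) (cong (λ t → t ℤ.+ offset k i) (basis k v i))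
    ; linear = λ v i → trans (iter-linear k v i) (basis k v i) }
    where
    basis : ∀ k v i → pow M k (lookup v) i ≡ (λ l → pow M k (δ l) i) ∙ lookup v
    basis k v i = trans (pow-basis M k (lookup v) i) (∙-comm (lookup v) (λ l → pow M k (δ l) i))

  drift : ℕ → ℕ → Vec ℤ n
  drift α π = tabulate λ i → offset (π + α) i ℤ.- offset α i

  drift≤ : ∀ {B} α π → π + α ≤ B → ∀ i → ∣ lookup (drift α π) i ∣ ≤ 2 * (B * (n * (X * E)))
  drift≤ {B} α π π+α≤B i = begin
    ∣ lookup (drift α π) i ∣                      ≡⟨ cong ∣_∣ (Vec.lookup∘tabulate _ i) ⟩
    ∣ offset (π + α) i ℤ.- offset α i ∣           ≤⟨ ∣-∣≤ (offset (π + α) i) (offset α i)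
                                                     (ℕ.≤-trans (offset≤ (π + α) i) (ℕ.*-monoˡ-≤ (n * (X * E)) π+α≤B))
                                                     (ℕ.≤-trans (offset≤ α i) (ℕ.*-monoˡ-≤ (n * (X * E)) (ℕ.≤-trans (ℕ.m≤n+m α π) π+α≤B))) ⟩
    B * (n * (X * E)) + B * (n * (X * E))         ≡⟨ cong (λ t → B * (n * (X * E)) + t) (sym (ℕ.+-identityʳ _)) ⟩
    2 * (B * (n * (X * E)))                       ∎
    where open ℕ.≤-Reasoning

  -- After the first j - α iterations, the remaining α and π + α ones have the same matrix power and
  -- differ in their constants only. So the drift depends neither on `v` nor on `j`.
  iter-drift : ∀ α p → EventuallyPeriodic M α p → ∀ j v → α ≤ j → iter F (suc p + j) v ≡ iter F j v ⊞ drift α (suc p)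
  iter-drift α p ev j v α≤j = begin
    iter F (suc p + j) v                       ≡⟨ cong (λ k → iter F (suc p + k) v) (sym j≡) ⟩
    iter F (suc p + (α + k)) v                 ≡⟨ cong (λ k → iter F k v) (sym (ℕ.+-assoc (suc p) α k)) ⟩
    iter F (suc p + α + k) v                   ≡⟨ iter-+ F (suc p + α) k v ⟩
    iter F (suc p + α) (iter F k v)            ≡⟨ vec-ext at-α ⟩
    iter F α (iter F k v) ⊞ drift α (suc p)    ≡⟨ cong (λ u → u ⊞ drift α (suc p)) (sym (iter-+ F α k v)) ⟩
    iter F (α + k) v ⊞ drift α (suc p)         ≡⟨ cong (λ k → iter F k v ⊞ drift α (suc p)) j≡ ⟩
    iter F j v ⊞ drift α (suc p)               ∎
    where
    open ≡-Reasoning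
    k : ℕ
    k = j ℕ.∸ α
    j≡ : α + k ≡ j
    j≡ = ℕ.m+[n∸m]≡n α≤j
    u : Vec ℤ n
    u = iter F k v
    cancel : ∀ a b c → a ℤ.+ b ≡ (a ℤ.+ c) ℤ.+ (b ℤ.- c)
    cancel = ℤ-Ring.solve-∀
    at-α : ∀ i → lookup (iter F (suc p + α) u) i ≡ lookup (iter F α u ⊞ drift α (suc p)) i
    at-α i = begin
      lookup (iter F (suc p + α) u) i                                  ≡⟨ iter-affine (suc p + α) u i ⟩
      pow M (suc p + α) (lookup u) i ℤ.+ offset (suc p + α) i          ≡⟨ cong (λ t → t ℤ.+ offset (suc p + α) i) (ev (lookup u) i) ⟩
      pow M α (lookup u) i ℤ.+ offset (suc p + α) i                    ≡⟨ cancel (pow M α (lookup u) i) (offset (suc p + α) i) (offset α i) ⟩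
      (pow M α (lookup u) i ℤ.+ offset α i) ℤ.+ (offset (suc p + α) i ℤ.- offset α i)
        ≡⟨ cong₂ ℤ._+_ (sym (iter-affine α u i)) (sym (Vec.lookup∘tabulate _ i)) ⟩
      lookup (iter F α u) i ℤ.+ lookup (drift α (suc p)) i             ≡⟨ sym (lookup-⊞ (iter F α u) (drift α (suc p)) i) ⟩
      lookup (iter F α u ⊞ drift α (suc p)) i                          ∎

-- The action of words, and eventual periodicity from the finite monoid

module _ {nQ nAP n nR : ℕ} (S : CounterSystem nQ nAP n nR) where

  exec lin : List (Fin nR) → Vec ℤ n → Vec ℤ n
  exec w v = foldl (λ v δ → update (Δ S δ) v) v w
  lin w v = foldl (λ v δ → A (Δ S δ) ·ᵥ v) v w

  matProd-·ᵥ : ∀ w v → matProd S w ·ᵥ v ≡ foldr (λ δ v → A (Δ S δ) ·ᵥ v) v w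
  matProd-·ᵥ []      v = identity-·ᵥ v
  matProd-·ᵥ (δ ∷ w) v = trans (⊗-·ᵥ (A (Δ S δ)) (matProd S w) v) (cong (A (Δ S δ) ·ᵥ_) (matProd-·ᵥ w v))

  repeat : ℕ → List (Fin nR) → List (Fin nR)
  repeat k w = concat (replicate k w)

  lin-repeat : ∀ k w v → lin (repeat k w) v ≡ iter (lin w) k v
  lin-repeat zero    w v = refl
  lin-repeat (suc k) w v = trans (List.foldl-++ (λ v δ → A (Δ S δ) ·ᵥ v) v w (repeat k w))
    (trans (lin-repeat k w (lin w v)) (iter-suc (lin w) k v))

  opaque
    -- Two powers of the word occupy the same position in the finite list of products. A word
    -- applies its first rule first whereas a matrix product applies its last factor first, hence
    -- the reversal.
    finite-monoid⇒eventuallyPeriodic : FiniteMonoid S → ∀ w (M : Mat n) →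
      (∀ v i → lookup (lin w v) i ≡ M i ∙ lookup v) → ∃₂ λ a p → EventuallyPeriodic M a p
    finite-monoid⇒eventuallyPeriodic (Ls , complete) w M rep = from-collision (Fin.pigeonhole (ℕ.n<1+n _) position)
      where
      member : (k : Fin (suc (length Ls))) → matProd S (reverse (repeat (toℕ k) w)) ∈ Ls
      member k = complete (reverse (repeat (toℕ k) w))
      position : Fin (suc (length Ls)) → Fin (length Ls)
      position k = Any.index (member k)
      pow≡iter : ∀ k x i → pow M k x i ≡ lookup (iter (lin w) k (tabulate x)) i
      pow≡iter zero    x i = sym (Vec.lookup∘tabulate x i)
      pow≡iter (suc k) x i = trans (∙-congʳ (M i) (pow≡iter k x)) (sym (rep (iter (lin w) k (tabulate x)) i))
      iter≡matProd : ∀ k v → iter (lin w) k v ≡ matProd S (reverse (repeat k w)) ·ᵥ v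
      iter≡matProd k v = trans (sym (lin-repeat k w v)) (sym (trans (matProd-·ᵥ (reverse (repeat k w)) v)
        (List.reverse-foldr (λ δ v → A (Δ S δ) ·ᵥ v) v (repeat k w))))
      from-collision : (∃₂ λ i j → i Fin.< j × position i ≡ position j) → ∃₂ λ a p → EventuallyPeriodic M a p
      from-collision (i , j , i<j , same) = toℕ i , toℕ j ℕ.∸ suc (toℕ i) , λ x l → begin
          pow M (suc (toℕ j ℕ.∸ suc (toℕ i)) + toℕ i) x l           ≡⟨ cong (λ k → pow M k x l) (trans (sym (ℕ.+-suc (toℕ j ℕ.∸ suc (toℕ i)) (toℕ i))) (ℕ.m∸n+n≡m i<j)) ⟩
          pow M (toℕ j) x l                                          ≡⟨ pow≡iter (toℕ j) x l ⟩
          lookup (iter (lin w) (toℕ j) (tabulate x)) l               ≡⟨ cong (λ u → lookup u l) (iter≡matProd (toℕ j) (tabulate x)) ⟩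
          lookup (matProd S (reverse (repeat (toℕ j) w)) ·ᵥ tabulate x) l
            ≡⟨ cong (λ N → lookup (N ·ᵥ tabulate x) l) (trans (Any.lookup-index (member j)) (trans (cong (List.lookup Ls) (sym same)) (sym (Any.lookup-index (member i))))) ⟩
          lookup (matProd S (reverse (repeat (toℕ i) w)) ·ᵥ tabulate x) l   ≡⟨ cong (λ u → lookup u l) (sym (iter≡matProd (toℕ i) (tabulate x))) ⟩
          lookup (iter (lin w) (toℕ i) (tabulate x)) l               ≡⟨ sym (pow≡iter (toℕ i) x l) ⟩
          pow M (toℕ i) x l                                          ∎
        where open ≡-Reasoning

-- Words, paths and runs

-- A function affine in t attains its maximum on an interval at an endpoint; the sign of `e` decides
-- which.
between : ∀ {x d e} {t t₀ : ℕ} → t ≤ t₀ → x ℤ.≤ d → x ℤ.+ + t₀ ℤ.* e ℤ.≤ d → x ℤ.+ + t ℤ.* e ℤ.≤ d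
between {x} {d} {e} {t} {t₀} t≤t₀ x≤d end≤d with ℤ.≤-total e 0ℤ
... | inj₁ e≤0 = begin
  x ℤ.+ + t ℤ.* e    ≤⟨ ℤ.+-monoʳ-≤ x (ℤ.*-monoˡ-≤-nonNeg (+ t) e≤0) ⟩
  x ℤ.+ + t ℤ.* 0ℤ   ≡⟨ cong (λ z → x ℤ.+ z) (ℤ.*-zeroʳ (+ t)) ⟩
  x ℤ.+ 0ℤ           ≡⟨ ℤ.+-identityʳ x ⟩
  x                  ≤⟨ x≤d ⟩
  d                  ∎
  where open ℤ.≤-Reasoning
... | inj₂ 0≤e = ℤ.≤-trans (ℤ.+-monoʳ-≤ x (ℤ.*-monoʳ-≤-nonNeg e {{ℤ.nonNegative 0≤e}} (ℤ.+≤+ t≤t₀))) end≤d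

-- A positive slope would carry x₀ beyond d within |d - x₀| + 1 steps. So the slope is at most zero,
-- and moving along it from `x` never increases the value.
ray : ∀ {x₀ x d e} → (∀ (t : ℕ) → x₀ ℤ.+ + t ℤ.* e ℤ.≤ d) → x ℤ.≤ d → ∀ (t : ℕ) → x ℤ.+ + t ℤ.* e ℤ.≤ d
ray {x₀} {x} {d} {e} along x≤d t with e ℤ.≤? 0ℤ
... | yes e≤0 = begin
  x ℤ.+ + t ℤ.* e    ≤⟨ ℤ.+-monoʳ-≤ x (ℤ.*-monoˡ-≤-nonNeg (+ t) e≤0) ⟩
  x ℤ.+ + t ℤ.* 0ℤ   ≡⟨ cong (λ z → x ℤ.+ z) (ℤ.*-zeroʳ (+ t)) ⟩
  x ℤ.+ 0ℤ           ≡⟨ ℤ.+-identityʳ x ⟩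
  x                  ≤⟨ x≤d ⟩
  d                  ∎
  where open ℤ.≤-Reasoning
... | no e≰0 = contradiction (along T) (ℤ.<⇒≱ (begin-strict
  d                                ≡⟨ cancel x₀ d ⟩
  x₀ ℤ.+ (d ℤ.- x₀)                ≤⟨ ℤ.+-monoʳ-≤ x₀ (i≤∣i∣ (d ℤ.- x₀)) ⟩
  x₀ ℤ.+ + ∣ d ℤ.- x₀ ∣            <⟨ ℤ.+-monoʳ-< x₀ (ℤ.+<+ (ℕ.n<1+n ∣ d ℤ.- x₀ ∣)) ⟩
  x₀ ℤ.+ + T                       ≡⟨ cong (λ z → x₀ ℤ.+ z) (sym (ℤ.*-identityʳ (+ T))) ⟩
  x₀ ℤ.+ + T ℤ.* 1ℤ                ≤⟨ ℤ.+-monoʳ-≤ x₀ (ℤ.*-monoˡ-≤-nonNeg (+ T) (ℤ.i<j⇒suc[i]≤j (ℤ.≰⇒> e≰0))) ⟩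
  x₀ ℤ.+ + T ℤ.* e                 ∎))
  where
  open ℤ.≤-Reasoning
  T : ℕ
  T = suc ∣ d ℤ.- x₀ ∣
  cancel : ∀ a b → b ≡ a ℤ.+ (b ℤ.- a)
  cancel = ℤ-Ring.solve-∀
  i≤∣i∣ : ∀ i → i ℤ.≤ + ∣ i ∣
  i≤∣i∣ (+ n)    = ℤ.≤-refl
  i≤∣i∣ -[1+ n ] = ℤ.-≤+

dot-⊞ : ∀ {n} (c u : Vec ℤ n) t D → dot c (u ⊞ t ⊡ D) ≡ dot c u ℤ.+ t ℤ.* dot c D
dot-⊞ c u t D = begin
  dot c (u ⊞ t ⊡ D)                                        ≡⟨ dot≡∙ c (u ⊞ t ⊡ D) ⟩
  lookup c ∙ lookup (u ⊞ t ⊡ D)                            ≡⟨ ∙-congʳ (lookup c) (λ l → trans (lookup-⊞ u (t ⊡ D) l) (cong (λ z → lookup u l ℤ.+ z) (lookup-⊡ t D l))) ⟩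
  lookup c ∙ (λ l → lookup u l ℤ.+ t ℤ.* lookup D l)       ≡⟨ ∙-distrib-+ (lookup c) (lookup u) (λ l → t ℤ.* lookup D l) ⟩
  lookup c ∙ lookup u ℤ.+ lookup c ∙ (λ l → t ℤ.* lookup D l)  ≡⟨ cong₂ ℤ._+_ (sym (dot≡∙ c u)) (trans (∙-scaleʳ t (lookup c) (lookup D)) (cong (t ℤ.*_) (sym (dot≡∙ c D)))) ⟩
  dot c u ℤ.+ t ℤ.* dot c D                                ∎
  where open ≡-Reasoning

RuleBounded : ∀ {nQ n} → ℕ → Rule nQ n → Set
RuleBounded H r = (∀ i j → ∣ entry (A r) i j ∣ ≤ H) × (∀ i → ∣ lookup (b r) i ∣ ≤ H) ×
  All (λ cd → (∀ i → ∣ lookup (proj₁ cd) i ∣ ≤ H) × ∣ proj₂ cd ∣ ≤ H) (guard r)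

Affine-update : ∀ {nQ n H} (r : Rule nQ n) → RuleBounded H r → Affine H (update r) (A r ·ᵥ_)
Affine-update r (A≤ , b≤ , _) = record
  { M = entry (A r) ; c = lookup (b r) ; M≤ = A≤ ; c≤ = b≤
  ; affine = λ v i → trans (lookup-⊞ (A r ·ᵥ v) (b r) i) (cong (λ t → t ℤ.+ lookup (b r) i) (lookup-·ᵥ (A r) v i))
  ; linear = λ v i → lookup-·ᵥ (A r) v i }

last-∷ : ∀ {A : Set} (x y : A) r → List⁺.last (x ∷ y ∷ r) ≡ List⁺.last (y ∷ r)
last-∷ x y r with List.initLast r
... | []            = refl
... | ys List.∷ʳ′ z = refl

module Semantics {nQ nAP n nR H : ℕ} (S : CounterSystem nQ nAP n nR) (small : ∀ δ → RuleBounded H (Δ S δ)) where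

  upd : Fin nR → Vec ℤ n → Vec ℤ n
  upd δ = update (Δ S δ)

  Ok : List (Fin nR) → Vec ℤ n → Set
  Ok []      v = ⊤
  Ok (δ ∷ w) v = Sat (guard (Δ S δ)) v × Ok w (upd δ v)

  upd-⊞ : ∀ δ u t D → upd δ (u ⊞ t ⊡ D) ≡ upd δ u ⊞ t ⊡ (A (Δ S δ) ·ᵥ D)
  upd-⊞ δ = Affine-⊞ (Affine-update (Δ S δ) (small δ))

  -- An update turns the points u + t D into points of the same form with direction A D, so
  -- `between` applies to the guard of every rule along the word.
  Ok-between : ∀ w u D {t t₀} → t ≤ t₀ → Ok w u → Ok w (u ⊞ + t₀ ⊡ D) → Ok w (u ⊞ + t ⊡ D)
  Ok-between []      u D t≤t₀ _ _ = tt
  Ok-between (δ ∷ w) u D {t} {t₀} t≤t₀ (sat , ok) (sat₀ , ok₀) =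
    All.zipWith (λ { {c , _} (p , q) → subst (ℤ._≤ _) (sym (dot-⊞ c u (+ t) D)) (between t≤t₀ p (subst (ℤ._≤ _) (dot-⊞ c u (+ t₀) D) q)) }) (sat , sat₀) ,
    subst (Ok w) (sym (upd-⊞ δ u (+ t) D)) (Ok-between w (upd δ u) (A (Δ S δ) ·ᵥ D) t≤t₀ ok (subst (Ok w) (upd-⊞ δ u (+ t₀) D) ok₀))

  -- The two base points are moved separately along the word, but the direction remains common to
  -- both, so what the ray from `u₀` shows about the slopes of the guards applies to the ray from
  -- `u`.
  Ok-ray : ∀ w u₀ u D → (∀ t → Ok w (u₀ ⊞ + t ⊡ D)) → Ok w u → ∀ t → Ok w (u ⊞ + t ⊡ D)
  Ok-ray []      u₀ u D along _ t = tt
  Ok-ray (δ ∷ w) u₀ u D along (sat , ok) t =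
    All.tabulate (λ { {c , _} m → subst (ℤ._≤ _) (sym (dot-⊞ c u (+ t) D))
      (ray {dot c u₀} {dot c u} {e = dot c D} (λ t → subst (ℤ._≤ _) (dot-⊞ c u₀ (+ t) D) (All.lookup (proj₁ (along t)) m)) (All.lookup sat m) t) }) ,
    subst (Ok w) (sym (upd-⊞ δ u (+ t) D))
      (Ok-ray w (upd δ u₀) (upd δ u) (A (Δ S δ) ·ᵥ D) (λ t → subst (Ok w) (upd-⊞ δ u₀ (+ t) D) (proj₂ (along t))) ok t)

  Ok-++⁻ : ∀ w w′ v → Ok (w ++ w′) v → Ok w v × Ok w′ (exec S w v)
  Ok-++⁻ []      w′ v ok = tt , ok
  Ok-++⁻ (δ ∷ w) w′ v (sat , ok) with Ok-++⁻ w w′ (upd δ v) ok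
  ... | ok₁ , ok₂ = (sat , ok₁) , ok₂

  Ok-++⁺ : ∀ w w′ v → Ok w v → Ok w′ (exec S w v) → Ok (w ++ w′) v
  Ok-++⁺ []      w′ v _ ok = ok
  Ok-++⁺ (δ ∷ w) w′ v (sat , ok) ok′ = sat , Ok-++⁺ w w′ (upd δ v) ok ok′

  exec-++ : ∀ w w′ v → exec S (w ++ w′) v ≡ exec S w′ (exec S w v)
  exec-++ w w′ v = List.foldl-++ (λ v δ → update (Δ S δ) v) v w w′

  exec-repeat : ∀ k w v → exec S (repeat S k w) v ≡ iter (exec S w) k v
  exec-repeat zero    w v = refl
  exec-repeat (suc k) w v = trans (exec-++ w (repeat S k w) v) (trans (exec-repeat k w (exec S w v)) (iter-suc (exec S w) k v))

  Ok-repeat⁻ : ∀ k w v → Ok (repeat S k w) v → ∀ j → j < k → Ok w (iter (exec S w) j v)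
  Ok-repeat⁻ (suc k) w v ok zero    _ = proj₁ (Ok-++⁻ w (repeat S k w) v ok)
  Ok-repeat⁻ (suc k) w v ok (suc j) (s≤s j<k) = subst (Ok w) (iter-suc (exec S w) j v)
    (Ok-repeat⁻ k w (exec S w v) (proj₂ (Ok-++⁻ w (repeat S k w) v ok)) j j<k)

  Ok-repeat⁺ : ∀ k w v → (∀ j → j < k → Ok w (iter (exec S w) j v)) → Ok (repeat S k w) v
  Ok-repeat⁺ zero    w v oks = tt
  Ok-repeat⁺ (suc k) w v oks = Ok-++⁺ w (repeat S k w) v (oks 0 (s≤s z≤n))
    (Ok-repeat⁺ k w (exec S w v) λ j j<k → subst (Ok w) (sym (iter-suc (exec S w) j v)) (oks (suc j) (s≤s j<k)))

  val : (ℕ → Fin nR) → Vec ℤ n → ℕ → Vec ℤ n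
  val ω v zero    = v
  val ω v (suc i) = val (ω ∘ suc) (upd (ω 0) v) i

  val-suc : ∀ ω v i → val ω v (suc i) ≡ upd (ω i) (val ω v i)
  val-suc ω v zero    = refl
  val-suc ω v (suc i) = val-suc (ω ∘ suc) (upd (ω 0) v) i

  val-cong : ∀ {ω ω′} → ω ≗ ω′ → ∀ v i → val ω v i ≡ val ω′ v i
  val-cong eq v zero    = refl
  val-cong {ω} {ω′} eq v (suc i) = trans (val-cong (eq ∘ suc) (upd (ω 0) v) i) (cong (λ δ → val (ω′ ∘ suc) (upd δ v) i) (eq 0))

  InfOk : (ℕ → Fin nR) → Vec ℤ n → Set
  InfOk ω v = ∀ i → Sat (guard (Δ S (ω i))) (val ω v i)

  InfOk-cong : ∀ {ω ω′} → ω ≗ ω′ → ∀ {v} i → Sat (guard (Δ S (ω i))) (val ω v i) → Sat (guard (Δ S (ω′ i))) (val ω′ v i)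
  InfOk-cong eq {v} i = subst₂ (λ δ u → Sat (guard (Δ S δ)) u) (eq i) (val-cong eq v i)

  InfOk-infWord⁻ : ∀ w c v → InfOk (infWord w c) v → Ok w v × InfOk (cycleAt c) (exec S w v)
  InfOk-infWord⁻ []      c v inf = tt , inf
  InfOk-infWord⁻ (δ ∷ w) c v inf with InfOk-infWord⁻ w c (upd δ v) (inf ∘ suc)
  ... | ok , rest = (inf 0 , ok) , rest

  -- The equation for i′ is what shows `InfOk-cycle⁺` that the position decreases when a round of
  -- the cycle is split off.
  infWord-sat : ∀ w c v i → Ok w v → (∀ i′ → i ≡ length w + i′ → Sat (guard (Δ S (cycleAt c i′))) (val (cycleAt c) (exec S w v) i′)) →
    Sat (guard (Δ S (infWord w c i))) (val (infWord w c) v i)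
  infWord-sat []      c v i       _          rest = rest i refl
  infWord-sat (δ ∷ w) c v zero    (sat , _)  rest = sat
  infWord-sat (δ ∷ w) c v (suc i) (_ , ok)   rest = infWord-sat w c (upd δ v) i ok λ i′ eq → rest i′ (cong suc eq)

  infWord-< : ∀ w c i → (i<w : i < length w) → infWord {nR} w c i ≡ List.lookup w (fromℕ< i<w)
  infWord-< (δ ∷ w) c zero    (s≤s _)   = refl
  infWord-< (δ ∷ w) c (suc i) (s≤s i<w) = infWord-< w c i i<w

  infWord-+ : ∀ w c i → infWord {nR} w c (length w + i) ≡ cycleAt c i
  infWord-+ []      c i = refl
  infWord-+ (δ ∷ w) c i = infWord-+ w c i

  cycleAt-unroll : ∀ c → infWord {nR} (List⁺.toList c) c ≗ cycleAt c
  cycleAt-unroll (δ ∷ r) i with i ℕ.<? suc (length r)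
  ... | yes i< = trans (infWord-< (δ ∷ r) (δ ∷ r) i i<) (cong (List.lookup (δ ∷ r)) (Fin.toℕ-injective (begin
    toℕ (fromℕ< i<)                      ≡⟨ Fin.toℕ-fromℕ< i< ⟩
    i                                    ≡⟨ sym (ℕ.m<n⇒m%n≡m i<) ⟩
    i ℕ.% suc (length r)                 ≡⟨ sym (Fin.toℕ-fromℕ< _) ⟩
    toℕ (i ℕ.mod suc (length r))         ∎)))
    where open ≡-Reasoning
  ... | no i≮ = begin
    infWord (δ ∷ r) (δ ∷ r) i                              ≡⟨ cong (infWord (δ ∷ r) (δ ∷ r)) (sym i≡) ⟩
    infWord (δ ∷ r) (δ ∷ r) (suc (length r) + i′)          ≡⟨ infWord-+ (δ ∷ r) (δ ∷ r) i′ ⟩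
    cycleAt (δ ∷ r) i′                                     ≡⟨ cong (List.lookup (δ ∷ r)) (Fin.toℕ-injective (begin
      toℕ (i′ ℕ.mod suc (length r))                          ≡⟨ Fin.toℕ-fromℕ< _ ⟩
      i′ ℕ.% suc (length r)                                  ≡⟨ sym (ℕ.[m+n]%n≡m%n i′ (suc (length r))) ⟩
      (i′ + suc (length r)) ℕ.% suc (length r)               ≡⟨ cong (ℕ._% suc (length r)) (trans (ℕ.+-comm i′ _) i≡) ⟩
      i ℕ.% suc (length r)                                   ≡⟨ sym (Fin.toℕ-fromℕ< _) ⟩
      toℕ (i ℕ.mod suc (length r))                           ∎)) ⟩
    cycleAt (δ ∷ r) i                                      ∎
    where
    open ≡-Reasoning
    i′ : ℕ
    i′ = i ℕ.∸ suc (length r)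
    i≡ : suc (length r) + i′ ≡ i
    i≡ = ℕ.m+[n∸m]≡n (ℕ.≮⇒≥ i≮)

  InfOk-cycle⁻ : ∀ c v → InfOk (cycleAt c) v → ∀ j → Ok (List⁺.toList c) (iter (exec S (List⁺.toList c)) j v)
  InfOk-cycle⁻ c v inf j with InfOk-infWord⁻ (List⁺.toList c) c v (λ i → InfOk-cong (sym ∘ cycleAt-unroll c) i (inf i))
  InfOk-cycle⁻ c v inf zero    | ok , rest = ok
  InfOk-cycle⁻ c v inf (suc j) | ok , rest = subst (Ok (List⁺.toList c)) (iter-suc (exec S (List⁺.toList c)) j v)
    (InfOk-cycle⁻ c (exec S (List⁺.toList c) v) rest j)

  InfOk-cycle⁺ : ∀ c v → (∀ j → Ok (List⁺.toList c) (iter (exec S (List⁺.toList c)) j v)) → InfOk (cycleAt c) v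
  InfOk-cycle⁺ c v oks i = go (suc i) i v (ℕ.n<1+n i) oks
    where
    F : Vec ℤ n → Vec ℤ n
    F = exec S (List⁺.toList c)
    go : ∀ fuel i v → i < fuel → (∀ j → Ok (List⁺.toList c) (iter F j v)) → Sat (guard (Δ S (cycleAt c i))) (val (cycleAt c) v i)
    go (suc fuel) i v (s≤s i≤fuel) oks = InfOk-cong (cycleAt-unroll c) i (infWord-sat (List⁺.toList c) c v i (oks 0)
      λ i′ i≡ → go fuel i′ (F v) (ℕ.<-≤-trans (subst (i′ <_) (sym i≡) (s≤s (ℕ.m≤n+m i′ (length (List⁺.tail c))))) i≤fuel)
        λ j → subst (Ok (List⁺.toList c)) (sym (iter-suc F j v)) (oks (suc j)))

  InfOk-infWord⁺ : ∀ w c v → Ok w v → (∀ j → Ok (List⁺.toList c) (iter (exec S (List⁺.toList c)) j (exec S w v))) → InfOk (infWord w c) v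
  InfOk-infWord⁺ w c v ok oks i = infWord-sat w c v i ok λ i′ _ → InfOk-cycle⁺ c (exec S w v) oks i′

  Path : Fin nQ → List (Fin nR) → Fin nQ → Set
  Path q []      q′ = q ≡ q′
  Path q (δ ∷ w) q′ = src (Δ S δ) ≡ q × Path (tgt (Δ S δ)) w q′

  Path-++ : ∀ {q q′ q″} w {w′} → Path q w q′ → Path q′ w′ q″ → Path q (w ++ w′) q″
  Path-++ []      refl      p = p
  Path-++ (δ ∷ w) (s , p) p′ = s , Path-++ w p p′

  Path-cycle : ∀ δ r → Linked S (δ ∷ r) → Path (src (Δ S δ)) (δ ∷ r) (tgt (Δ S (List⁺.last (δ ∷ r))))
  Path-cycle δ []       _        = refl , refl
  Path-cycle δ (δ′ ∷ r) (e , ls) = refl , subst₂ (λ q δ″ → Path q (δ′ ∷ r) (tgt (Δ S δ″))) (sym e) (sym (last-∷ δ δ′ r)) (Path-cycle δ′ r ls)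

  Path-loop : ∀ c → SimpleCycle S c → Path (src (Δ S (List⁺.head c))) (List⁺.toList c) (src (Δ S (List⁺.head c)))
  Path-loop (δ ∷ r) (linked , _ , closed) = subst (Path (src (Δ S δ)) (δ ∷ r)) closed (Path-cycle δ r linked)

  Path-repeat : ∀ k w q → Path q w q → Path q (repeat S k w) q
  Path-repeat zero    w q p = refl
  Path-repeat (suc k) w q p = Path-++ w p (Path-repeat k w q p)

  origin : List (Elem nR) → List⁺ (Fin nR) → Fin nQ
  origin []       c = src (Δ S (List⁺.head c))
  origin (u ∷ us) c = elemSrc S u

  Path-prefix : ∀ us c (ks : Vec ℕ (length us)) → All (ElemOK S) (us ++ cy c ∷ []) → LinkedElems S (us ++ cy c ∷ []) →
    ValidIter us ks → Path (origin us c) (prefixWord us ks) (src (Δ S (List⁺.head c)))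
  Path-prefix []          c []       _          _      _         = refl
  Path-prefix (rl δ ∷ us) c (.1 ∷ ks) (_ ∷ oks) linked (refl , valid) =
    refl , subst (λ q → Path q (prefixWord us ks) _) (sym (next us linked)) (Path-prefix us c ks oks (tail us linked) valid)
    where
    next : ∀ us → LinkedElems S (rl δ ∷ us ++ cy c ∷ []) → tgt (Δ S δ) ≡ origin us c
    next []      (e , _) = e
    next (_ ∷ _) (e , _) = e
    tail : ∀ us → LinkedElems S (rl δ ∷ us ++ cy c ∷ []) → LinkedElems S (us ++ cy c ∷ [])
    tail []      (_ , l) = l
    tail (_ ∷ _) (_ , l) = l
  Path-prefix (cy d ∷ us) c (k ∷ ks) (ok ∷ oks) linked (_ , valid) =
    Path-++ (repeat S k (List⁺.toList d)) (Path-repeat k (List⁺.toList d) _ (Path-loop d ok))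
      (subst (λ q → Path q (prefixWord us ks) _) (trans (sym (next us linked)) (proj₂ (proj₂ ok))) (Path-prefix us c ks oks (tail us linked) valid))
    where
    next : ∀ us → LinkedElems S (cy d ∷ us ++ cy c ∷ []) → tgt (Δ S (List⁺.last d)) ≡ origin us c
    next []      (e , _) = e
    next (_ ∷ _) (e , _) = e
    tail : ∀ us → LinkedElems S (cy d ∷ us ++ cy c ∷ []) → LinkedElems S (us ++ cy c ∷ [])
    tail []      (_ , l) = l
    tail (_ ∷ _) (_ , l) = l

  infWord-src : ∀ {q} w c → Path q w (src (Δ S (List⁺.head c))) → src (Δ S (infWord w c 0)) ≡ q
  infWord-src []      (δ ∷ r) q≡      = sym q≡
  infWord-src (δ ∷ w) c       (s , _) = s

  infWord-linked : ∀ {q} w c → SimpleCycle S c → Path q w (src (Δ S (List⁺.head c))) →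
    ∀ i → tgt (Δ S (infWord w c i)) ≡ src (Δ S (infWord w c (suc i)))
  infWord-linked (δ ∷ w) c sc (_ , p) zero    = sym (infWord-src w c p)
  infWord-linked (δ ∷ w) c sc (_ , p) (suc i) = infWord-linked w c sc p i
  -- One round is unrolled and its tail treated as a prefix; the rule split off consumes one
  -- position, so the recursion on `i` terminates.
  infWord-linked []      c sc _       i       = subst₂ (λ x y → tgt (Δ S x) ≡ src (Δ S y)) (cycleAt-unroll c i) (cycleAt-unroll c (suc i)) (around i)
    where
    around : ∀ i → tgt (Δ S (infWord (List⁺.toList c) c i)) ≡ src (Δ S (infWord (List⁺.toList c) c (suc i)))
    around zero    = sym (infWord-src (List⁺.tail c) c (proj₂ (Path-loop c sc)))
    around (suc i) = infWord-linked (List⁺.tail c) c sc (proj₂ (Path-loop c sc)) i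

  run-values : (ρ : Run S) → ∀ i → proj₂ (Run.conf ρ i) ≡ val (Run.trans ρ) (proj₂ (Run.conf ρ 0)) i
  run-values ρ zero    = refl
  run-values ρ (suc i) = trans (proj₂ (proj₂ (proj₂ (Run.step ρ i))))
    (trans (cong (upd (Run.trans ρ i)) (run-values ρ i)) (sym (val-suc (Run.trans ρ) _ i)))

  run⇒InfOk : (ρ : Run S) → InfOk (Run.trans ρ) (proj₂ (Run.conf ρ 0))
  run⇒InfOk ρ i = subst (Sat (guard (Δ S (Run.trans ρ i)))) (run-values ρ i) (proj₁ (proj₂ (Run.step ρ i)))

  InfOk⇒run : ∀ ω v → InfOk ω v → (∀ i → tgt (Δ S (ω i)) ≡ src (Δ S (ω (suc i)))) → Run S
  InfOk⇒run ω v inf linked = record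
    { conf  = λ i → src (Δ S (ω i)) , val ω v i
    ; trans = ω
    ; step  = λ i → refl , inf i , linked i , val-suc ω v i }

-- Systems of inequalities and accelerated loops

record AffineIn {n K : ℕ} (G : ℕ) (V : (Fin K → ℤ) → Vec ℤ n) : Set where
  field
    coef   : Fin n → Fin K → ℤ
    const  : Fin n → ℤ
    coef≤  : ∀ i j → ∣ coef i j ∣ ≤ G
    const≤ : ∀ i → ∣ const i ∣ ≤ G
    value  : ∀ y i → lookup (V y) i ≡ coef i ∙ y ℤ.+ const i

AffineIn-mono : ∀ {n K G G′} {V : (Fin K → ℤ) → Vec ℤ n} → G ≤ G′ → AffineIn G V → AffineIn G′ V
AffineIn-mono G≤G′ 𝑽 = record { AffineIn 𝑽 ; coef≤ = λ i j → ℕ.≤-trans (AffineIn.coef≤ 𝑽 i j) G≤G′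
                               ; const≤ = λ i → ℕ.≤-trans (AffineIn.const≤ 𝑽 i) G≤G′ }

AffineIn-const : ∀ {n K G} (v : Vec ℤ n) → (∀ i → ∣ lookup v i ∣ ≤ G) → AffineIn {n} {K} G (λ _ → v)
AffineIn-const v v≤G = record { coef = λ _ _ → 0ℤ ; const = lookup v ; coef≤ = λ _ _ → z≤n ; const≤ = v≤G
  ; value = λ y i → sym (trans (cong (λ t → t ℤ.+ lookup v i) (trans (∙-comm (λ _ → 0ℤ) y) (∙-zeroʳ y λ _ → refl))) (ℤ.+-identityˡ (lookup v i))) }

∙-affine : ∀ {n K} (a : Fin n → ℤ) (C : Fin n → Fin K → ℤ) (k : Fin n → ℤ) y →
  a ∙ (λ l → C l ∙ y ℤ.+ k l) ≡ (λ j → a ∙ λ l → C l j) ∙ y ℤ.+ a ∙ k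
∙-affine a C k y = trans (∙-distrib-+ a (λ l → C l ∙ y) k) (cong (λ t → t ℤ.+ a ∙ k) (sym (∙-assoc a C y)))

suc-*-bound : ∀ {n X G} → 1 ≤ G → n * (X * G) + X ≤ suc n * X * G
suc-*-bound {n} {X} {G} 1≤G = ℕ.≤-trans (ℕ.+-monoʳ-≤ (n * (X * G)) (ℕ.m≤m*n X G {{ℕ.>-nonZero 1≤G}})) (ℕ.≤-reflexive (arith n X G))
  where
  arith : ∀ n X G → n * (X * G) + X * G ≡ suc n * X * G
  arith = ℕ-Ring.solve-∀

AffineIn-∘ : ∀ {n K X G} {F L : Vec ℤ n → Vec ℤ n} {V : (Fin K → ℤ) → Vec ℤ n} → 1 ≤ G → Affine X F L → AffineIn G V →
  AffineIn (suc n * X * G) (F ∘ V)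
AffineIn-∘ {n} {K} {X} {G} {F} {L} {V} 1≤G 𝑭 𝑽 = record
  { coef = λ i j → M i ∙ λ l → coef l j ; const = λ i → M i ∙ const ℤ.+ c i
  ; coef≤ = λ i j → ℕ.≤-trans (∣∙∣≤ (M i) (λ l → coef l j) (M≤ i) (λ l → coef≤ l j))
      (ℕ.≤-trans (ℕ.m≤m+n (n * (X * G)) X) (suc-*-bound {n} {X} 1≤G))
  ; const≤ = λ i → ℕ.≤-trans (∣+∣≤ (M i ∙ const) (c i) (∣∙∣≤ (M i) const (M≤ i) const≤) (c≤ i)) (suc-*-bound {n} {X} 1≤G)
  ; value = λ y i → begin
      lookup (F (V y)) i                                             ≡⟨ affine (V y) i ⟩
      M i ∙ lookup (V y) ℤ.+ c i                                     ≡⟨ cong (λ t → t ℤ.+ c i) (trans (∙-congʳ (M i) (value y)) (∙-affine (M i) coef const y)) ⟩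
      (λ j → M i ∙ λ l → coef l j) ∙ y ℤ.+ M i ∙ const ℤ.+ c i       ≡⟨ ℤ.+-assoc ((λ j → M i ∙ λ l → coef l j) ∙ y) (M i ∙ const) (c i) ⟩
      (λ j → M i ∙ λ l → coef l j) ∙ y ℤ.+ (M i ∙ const ℤ.+ c i)     ∎ }
  where
  open ≡-Reasoning
  open Affine 𝑭
  open AffineIn 𝑽

AffineIn-⊞ : ∀ {n K X G} {V : (Fin K → ℤ) → Vec ℤ n} (ι : Fin K) (D : Vec ℤ n) → (∀ i → ∣ lookup D i ∣ ≤ X) → AffineIn G V →
  AffineIn (G + X) (λ y → V y ⊞ y ι ⊡ D)
AffineIn-⊞ {n} {K} {X} {G} {V} ι D D≤X 𝑽 = record
  { coef = λ i j → coef i j ℤ.+ lookup D i ℤ.* δ ι j ; const = const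
  ; coef≤ = λ i j → ∣+∣≤ (coef i j) (lookup D i ℤ.* δ ι j) (coef≤ i j)
      (ℕ.≤-trans (∣*∣≤ (lookup D i) (δ ι j) (D≤X i) (∣δ∣≤1 ι j)) (ℕ.≤-reflexive (ℕ.*-identityʳ X)))
  ; const≤ = λ i → ℕ.≤-trans (const≤ i) (ℕ.m≤m+n G X)
  ; value = λ y i → begin
      lookup (V y ⊞ y ι ⊡ D) i                                     ≡⟨ trans (lookup-⊞ (V y) (y ι ⊡ D) i) (cong₂ ℤ._+_ (value y i) (lookup-⊡ (y ι) D i)) ⟩
      coef i ∙ y ℤ.+ const i ℤ.+ y ι ℤ.* lookup D i                ≡⟨ rearr (coef i ∙ y) (const i) (y ι) (lookup D i) ⟩
      coef i ∙ y ℤ.+ lookup D i ℤ.* y ι ℤ.+ const i                ≡⟨ cong (λ t → coef i ∙ y ℤ.+ lookup D i ℤ.* t ℤ.+ const i) (sym (δ-∙ ι y)) ⟩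
      coef i ∙ y ℤ.+ lookup D i ℤ.* δ ι ∙ y ℤ.+ const i            ≡⟨ cong (λ t → t ℤ.+ const i) (cong₂ ℤ._+_ (∙-comm (coef i) y)
                                                                        (trans (cong (lookup D i ℤ.*_) (∙-comm (δ ι) y)) (sym (∙-scaleʳ (lookup D i) y (δ ι))))) ⟩
      y ∙ coef i ℤ.+ y ∙ (λ j → lookup D i ℤ.* δ ι j) ℤ.+ const i  ≡⟨ cong (λ t → t ℤ.+ const i) (trans (sym (∙-distrib-+ y (coef i) (λ j → lookup D i ℤ.* δ ι j)))
                                                                        (∙-comm y (λ j → coef i j ℤ.+ lookup D i ℤ.* δ ι j))) ⟩
      (λ j → coef i j ℤ.+ lookup D i ℤ.* δ ι j) ∙ y ℤ.+ const i    ∎ }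
  where
  open ≡-Reasoning
  open AffineIn 𝑽
  rearr : ∀ a b c d → a ℤ.+ b ℤ.+ c ℤ.* d ≡ a ℤ.+ d ℤ.* c ℤ.+ b
  rearr = ℤ-Ring.solve-∀

-- Only the size of the rows is tracked: `smallBound` depends on it and on the number of unknowns,
-- while the number of rows may be exponential.
record Expressible {K : ℕ} (G : ℕ) (P : (Fin K → ℤ) → Set) : Set where
  field
    rows  : List (Row K)
    rows≤ : All (RowBounded G) rows
    to    : ∀ y → P y → All (Holds y) rows
    from  : ∀ y → All (Holds y) rows → P y

Expressible-mono : ∀ {K G G′} {P : (Fin K → ℤ) → Set} → G ≤ G′ → Expressible G P → Expressible G′ P
Expressible-mono G≤G′ 𝑷 = record { Expressible 𝑷
  ; rows≤ = All.map (λ (p , q) → (λ j → ℕ.≤-trans (p j) G≤G′) , ℕ.≤-trans q G≤G′) (Expressible.rows≤ 𝑷) }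

Expressible-⊤ : ∀ {K G} → Expressible {K} G (λ _ → ⊤)
Expressible-⊤ = record { rows = [] ; rows≤ = [] ; to = λ _ _ → [] ; from = λ _ _ → tt }

Expressible-× : ∀ {K G} {P Q : (Fin K → ℤ) → Set} → Expressible G P → Expressible G Q → Expressible G (λ y → P y × Q y)
Expressible-× 𝑷 𝑸 = record
  { rows = rows 𝑷 ++ rows 𝑸 ; rows≤ = All.++⁺ (rows≤ 𝑷) (rows≤ 𝑸)
  ; to = λ y (p , q) → All.++⁺ (to 𝑷 y p) (to 𝑸 y q)
  ; from = λ y h → from 𝑷 y (All.++⁻ˡ (rows 𝑷) h) , from 𝑸 y (All.++⁻ʳ (rows 𝑷) h) }
  where open Expressible

Expressible-∀< : ∀ {K G} k {P : ℕ → (Fin K → ℤ) → Set} → (∀ j → j < k → Expressible G (P j)) →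
  Expressible G (λ y → ∀ j → j < k → P j y)
Expressible-∀< zero    𝑷 = record { rows = [] ; rows≤ = [] ; to = λ _ _ → [] ; from = λ _ _ _ () }
Expressible-∀< {K} {G} (suc k) {P} 𝑷 = record
  { rows = rows 𝑸 ; rows≤ = rows≤ 𝑸
  ; to = λ y p → to 𝑸 y (p 0 (s≤s z≤n) , λ j j<k → p (suc j) (s≤s j<k))
  ; from = λ { y h zero _ → proj₁ (from 𝑸 y h) ; y h (suc j) (s≤s j<k) → proj₂ (from 𝑸 y h) j j<k } }
  where
  open Expressible
  𝑸 : Expressible G (λ y → P 0 y × (∀ j → j < k → P (suc j) y))
  𝑸 = Expressible-× (𝑷 0 (s≤s z≤n)) (Expressible-∀< k λ j j<k → 𝑷 (suc j) (s≤s j<k))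

Expressible-→ : ∀ {K G} {B : Set} {P : (Fin K → ℤ) → Set} → Dec B → Expressible G P → Expressible G (λ y → B → P y)
Expressible-→ (yes b) 𝑷 = record { rows = rows ; rows≤ = rows≤ ; to = λ y p → to y (p b) ; from = λ y h _ → from y h }
  where open Expressible 𝑷
Expressible-→ (no ¬b) 𝑷 = record { rows = [] ; rows≤ = [] ; to = λ _ _ → [] ; from = λ _ _ b → contradiction b ¬b }

Expressible-dot : ∀ {n K H G} {V : (Fin K → ℤ) → Vec ℤ n} (c : Vec ℤ n) d → 1 ≤ G → (∀ i → ∣ lookup c i ∣ ≤ H) → ∣ d ∣ ≤ H → AffineIn G V →
  Expressible (suc n * H * G) (λ y → dot c (V y) ℤ.≤ d)
Expressible-dot {n} {K} {H} {G} {V} c d 1≤G c≤ d≤ 𝑽 = record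
  { rows = (a , d ℤ.- k) ∷ []
  ; rows≤ = ((λ j → ℕ.≤-trans (∣∙∣≤ (lookup c) (λ l → coef l j) c≤ (λ l → coef≤ l j)) (ℕ.≤-trans (ℕ.m≤m+n (n * (H * G)) H) (suc-*-bound {n} {H} 1≤G)))
          , ℕ.≤-trans (∣-∣≤ d k d≤ (∣∙∣≤ (lookup c) const c≤ const≤)) (ℕ.≤-trans (ℕ.≤-reflexive (ℕ.+-comm H (n * (H * G)))) (suc-*-bound {n} {H} 1≤G))) ∷ []
  ; to = λ y p → subst (ℤ._≤ d ℤ.- k) (add-sub (a ∙ y) k) (ℤ.+-monoˡ-≤ (ℤ.- k) (subst (ℤ._≤ d) (eq y) p)) ∷ []
  ; from = λ { y (h ∷ []) → subst₂ ℤ._≤_ (sym (eq y)) (sub-add d k) (ℤ.+-monoˡ-≤ k h) } }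
  where
  open AffineIn 𝑽
  a : Fin K → ℤ
  a j = lookup c ∙ λ l → coef l j
  k : ℤ
  k = lookup c ∙ const
  eq : ∀ y → dot c (V y) ≡ a ∙ y ℤ.+ k
  eq y = trans (dot≡∙ c (V y)) (trans (∙-congʳ (lookup c) (value y)) (∙-affine (lookup c) coef const y))
  add-sub : ∀ a b → a ℤ.+ b ℤ.- b ≡ a
  add-sub = ℤ-Ring.solve-∀
  sub-add : ∀ a b → a ℤ.- b ℤ.+ b ≡ a
  sub-add = ℤ-Ring.solve-∀

Expressible-Sat : ∀ {n K H G} {V : (Fin K → ℤ) → Vec ℤ n} (g : Guard n) → 1 ≤ G →
  All (λ cd → (∀ i → ∣ lookup (proj₁ cd) i ∣ ≤ H) × ∣ proj₂ cd ∣ ≤ H) g → AffineIn G V → Expressible (suc n * H * G) (λ y → Sat g (V y))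
Expressible-Sat []            1≤G []                  𝑽 = record { rows = [] ; rows≤ = [] ; to = λ _ _ → [] ; from = λ _ _ → [] }
Expressible-Sat {n} {K} {H} {G} {V} ((c , d) ∷ g) 1≤G ((c≤ , d≤) ∷ g≤) 𝑽 = record
  { rows = rows 𝑸 ; rows≤ = rows≤ 𝑸 ; to = λ { y (p ∷ ps) → to 𝑸 y (p , ps) } ; from = λ y h → proj₁ (from 𝑸 y h) ∷ proj₂ (from 𝑸 y h) }
  where
  open Expressible
  𝑸 : Expressible (suc n * H * G) (λ y → dot c (V y) ℤ.≤ d × Sat g (V y))
  𝑸 = Expressible-× (Expressible-dot c d 1≤G c≤ d≤ 𝑽) (Expressible-Sat g 1≤G g≤ 𝑽)

-- Subtract π until the index falls below ρ. Since α + π ≤ ρ, the last subtraction cannot lead below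
-- α.
decompose : ∀ {α π ρ} → α + π ≤ ρ → ∀ t j′ → α ≤ j′ → j′ < ρ + π * t → ∃₂ λ j t′ → t′ ≤ t × α ≤ j × j < ρ × π * t′ + j ≡ j′
decompose {α} {π} {ρ} α+π≤ρ t j′ α≤j′ j′< with j′ ℕ.<? ρ
... | yes j′<ρ = j′ , 0 , z≤n , α≤j′ , j′<ρ , cong (λ z → z + j′) (ℕ.*-zeroʳ π)
decompose {α} {π} {ρ} α+π≤ρ zero j′ α≤j′ j′< | no j′≮ρ = contradiction (subst (j′ <_) (trans (cong (λ z → ρ + z) (ℕ.*-zeroʳ π)) (ℕ.+-identityʳ ρ)) j′<) j′≮ρ
decompose {α} {π} {ρ} α+π≤ρ (suc t) j′ α≤j′ j′< | no j′≮ρ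
  with decompose α+π≤ρ t (j′ ℕ.∸ π) (ℕ.m+n≤o⇒m≤o∸n α (ℕ.≤-trans α+π≤ρ (ℕ.≮⇒≥ j′≮ρ)))
         (ℕ.+-cancelˡ-< π _ _ (subst₂ _<_ (sym (ℕ.m+[n∸m]≡n π≤j′)) (arith ρ π t) j′<))
  where
  π≤j′ : π ≤ j′
  π≤j′ = ℕ.≤-trans (ℕ.m≤n+m π α) (ℕ.≤-trans α+π≤ρ (ℕ.≮⇒≥ j′≮ρ))
  arith : ∀ ρ π t → ρ + π * suc t ≡ π + (ρ + π * t)
  arith = ℕ-Ring.solve-∀
... | j , t′ , t′≤t , α≤j , j<ρ , eq = j , suc t′ , s≤s t′≤t , α≤j , j<ρ ,
  trans (arith π t′ j) (trans (cong (λ z → π + z) eq) (ℕ.m+[n∸m]≡n (ℕ.≤-trans (ℕ.m≤n+m π α) (ℕ.≤-trans α+π≤ρ (ℕ.≮⇒≥ j′≮ρ)))))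
  where
  arith : ∀ π t j → π * suc t + j ≡ π + (π * t + j)
  arith = ℕ-Ring.solve-∀

module Acceleration {nQ nAP n nR H : ℕ} (S : CounterSystem nQ nAP n nR) (small : ∀ δ → RuleBounded H (Δ S δ)) where

  open Semantics S small

  -- Admissible counts have the form ρ + π t. The first ρ iterations cover the pre-period and a full
  -- period and enter the constraints one by one. The case π = 0 with zero drift is included: it
  -- freezes the count at ρ.
  record Loop (X : ℕ) (w : List (Fin nR)) : Set where
    field
      α π ρ  : ℕ
      D      : Vec ℤ n
      α+π≤ρ  : α + π ≤ ρ
      1≤ρ    : 1 ≤ ρ
      period : ∀ j v → α ≤ j → iter (exec S w) (π + j) v ≡ iter (exec S w) j v ⊞ D
      affine : ∀ j → j ≤ ρ → Affine X (iter (exec S w) j) (iter (lin S w) j)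
      D≤     : ∀ i → ∣ lookup D i ∣ ≤ X

    period-* : ∀ t j v → α ≤ j → iter (exec S w) (π * t + j) v ≡ iter (exec S w) j v ⊞ + t ⊡ D
    period-* zero    j v α≤j = trans (cong (λ k → iter (exec S w) (k + j) v) (ℕ.*-zeroʳ π)) (vec-ext λ i → sym (begin
      lookup (iter (exec S w) j v ⊞ 0ℤ ⊡ D) i                  ≡⟨ lookup-⊞ (iter (exec S w) j v) (0ℤ ⊡ D) i ⟩
      lookup (iter (exec S w) j v) i ℤ.+ lookup (0ℤ ⊡ D) i     ≡⟨ cong (λ z → lookup (iter (exec S w) j v) i ℤ.+ z) (lookup-⊡ 0ℤ D i) ⟩
      lookup (iter (exec S w) j v) i ℤ.+ 0ℤ                    ≡⟨ ℤ.+-identityʳ _ ⟩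
      lookup (iter (exec S w) j v) i                           ∎))
      where open ≡-Reasoning
    period-* (suc t) j v α≤j = begin
      iter F (π * suc t + j) v           ≡⟨ cong (λ k → iter F k v) (arith π t j) ⟩
      iter F (π + (π * t + j)) v         ≡⟨ period (π * t + j) v (ℕ.≤-trans α≤j (ℕ.m≤n+m j (π * t))) ⟩
      iter F (π * t + j) v ⊞ D           ≡⟨ cong (λ u → u ⊞ D) (period-* t j v α≤j) ⟩
      (iter F j v ⊞ + t ⊡ D) ⊞ D         ≡⟨ vec-ext (λ i → begin
        lookup ((iter F j v ⊞ + t ⊡ D) ⊞ D) i                            ≡⟨ lookup-⊞ (iter F j v ⊞ + t ⊡ D) D i ⟩
        lookup (iter F j v ⊞ + t ⊡ D) i ℤ.+ lookup D i                   ≡⟨ cong (λ z → z ℤ.+ lookup D i) (trans (lookup-⊞ (iter F j v) (+ t ⊡ D) i) (cong (λ z → lookup (iter F j v) i ℤ.+ z) (lookup-⊡ (+ t) D i))) ⟩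
        lookup (iter F j v) i ℤ.+ + t ℤ.* lookup D i ℤ.+ lookup D i      ≡⟨ collect (lookup (iter F j v) i) (+ t) (lookup D i) ⟩
        lookup (iter F j v) i ℤ.+ (1ℤ ℤ.+ + t) ℤ.* lookup D i            ≡⟨ cong (λ z → lookup (iter F j v) i ℤ.+ z) (sym (lookup-⊡ (+ suc t) D i)) ⟩
        lookup (iter F j v) i ℤ.+ lookup (+ suc t ⊡ D) i                 ≡⟨ sym (lookup-⊞ (iter F j v) (+ suc t ⊡ D) i) ⟩
        lookup (iter F j v ⊞ + suc t ⊡ D) i                              ∎) ⟩
      iter F j v ⊞ + suc t ⊡ D           ∎
      where
      open ≡-Reasoning
      F : Vec ℤ n → Vec ℤ n
      F = exec S w
      arith : ∀ π t j → π * suc t + j ≡ π + (π * t + j)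
      arith = ℕ-Ring.solve-∀
      collect : ∀ a t d → a ℤ.+ t ℤ.* d ℤ.+ d ≡ a ℤ.+ (1ℤ ℤ.+ t) ℤ.* d
      collect = ℤ-Ring.solve-∀

    α≤ρ : α ≤ ρ
    α≤ρ = ℕ.≤-trans (ℕ.m≤m+n α π) α+π≤ρ

    -- The guards are convex, so along each residue class the two extreme iterations suffice.
    all-iterations : ∀ v t → (∀ j → j < ρ → Ok w (iter (exec S w) j v)) →
      (∀ j → j < ρ → α ≤ j → Ok w (iter (exec S w) j v ⊞ + t ⊡ D)) → ∀ j → j < ρ + π * t → Ok w (iter (exec S w) j v)
    all-iterations v t first last j j< with α ℕ.≤? j
    ... | no α≰j = first j (ℕ.<-≤-trans (ℕ.≰⇒> α≰j) α≤ρ)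
    ... | yes α≤j with decompose {α} {π} {ρ} α+π≤ρ t j α≤j j<
    ... | j′ , t′ , t′≤t , α≤j′ , j′<ρ , eq = subst (λ k → Ok w (iter (exec S w) k v)) eq (subst (Ok w) (sym (period-* t′ j′ v α≤j′))
      (Ok-between w (iter (exec S w) j′ v) D t′≤t (first j′ j′<ρ) (last j′ j′<ρ α≤j′)))

    -- From `v₀` the cycle is known to repeat forever. The drift is the same from `v`, so `Ok-ray`
    -- carries the first ρ iterations along it. Taking j for the number of extra periods reaches
    -- iteration j, since π and ρ are positive.
    forever : 1 ≤ π → ∀ v₀ v → (∀ j → Ok w (iter (exec S w) j v₀)) → (∀ j → j < ρ → Ok w (iter (exec S w) j v)) → ∀ j → Ok w (iter (exec S w) j v)
    forever 1≤π v₀ v oks₀ first j = all-iterations v j first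
      (λ j′ j′<ρ α≤j′ → Ok-ray w (iter (exec S w) j′ v₀) (iter (exec S w) j′ v) D
        (λ t → subst (Ok w) (period-* t j′ v₀ α≤j′) (oks₀ (π * t + j′))) (first j′ j′<ρ) j) j
      (ℕ.+-mono-≤ 1≤ρ (ℕ.m≤n*m j π {{ℕ.>-nonZero 1≤π}}))

  ValidCount : Elem nR → ℕ → Set
  ValidCount (rl _) k = k ≡ 1
  ValidCount (cy _) k = 1 ≤ k

  -- The base `ρ` is chosen for the given count `m`, so that the original run is itself a point of
  -- the constraint system, with unknown `y₀`.
  record Accelerated (X B : ℕ) (u : Elem nR) (m : ℕ) : Set where
    field
      accel : Loop X (elemWord u)
      y₀    : ℕ
    open Loop accel public
    field
      m≡    : m ≡ ρ + π * y₀
      valid : ∀ t → ValidCount u (ρ + π * t)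
      ρ≤B   : ρ ≤ B
      π≤B   : π ≤ B

  module _ {X B : ℕ} where

    AllAccelerated : (us : List (Elem nR)) → Vec ℕ (length us) → Set
    AllAccelerated []       []       = ⊤
    AllAccelerated (u ∷ us) (m ∷ ms) = Accelerated X B u m × AllAccelerated us ms

    counts : ∀ us {ms} → AllAccelerated us ms → (Fin (length us) → ℕ) → Vec ℕ (length us)
    counts []       {[]}     _         t = []
    counts (u ∷ us) {m ∷ ms} (a , as)  t = Accelerated.ρ a + Accelerated.π a * t zero ∷ counts us as (t ∘ suc)

    originals : ∀ us {ms} → AllAccelerated us ms → Fin (length us) → ℕ
    originals (u ∷ us) {m ∷ ms} (a , as) zero    = Accelerated.y₀ a
    originals (u ∷ us) {m ∷ ms} (a , as) (suc i) = originals us as i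

    counts-valid : ∀ us {ms} (as : AllAccelerated us ms) t → ValidIter us (counts us as t)
    counts-valid []          {[]}     _        t = tt
    counts-valid (rl δ ∷ us) {m ∷ ms} (a , as) t = Accelerated.valid a (t zero) , counts-valid us as (t ∘ suc)
    counts-valid (cy c ∷ us) {m ∷ ms} (a , as) t = Accelerated.valid a (t zero) , counts-valid us as (t ∘ suc)

    counts-bounded : ∀ us {ms} (as : AllAccelerated us ms) t {T} → (∀ i → t i ≤ T) → ‖ counts us as t ‖∞ ≤ B + B * T
    counts-bounded []       {[]}     _        t t≤T = z≤n
    counts-bounded (u ∷ us) {m ∷ ms} (a , as) t t≤T = ℕ.⊔-lub
      (ℕ.+-mono-≤ (Accelerated.ρ≤B a) (ℕ.*-mono-≤ (Accelerated.π≤B a) (t≤T zero))) (counts-bounded us as (t ∘ suc) (t≤T ∘ suc))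

    module _ (c : List⁺ (Fin nR)) (final : Loop X (List⁺.toList c)) where

      private
        module 𝐋 = Loop final

      -- The unknowns are integers, so the condition makes sense at every point of the linear
      -- system. The vector after ρ + π t iterations is written as the ρ-th iterate plus t times the
      -- drift, which keeps all later vectors affine in the unknowns. For the last cycle the first
      -- rounds are enough, by `forever`.
      Cond : ∀ us {ms} → AllAccelerated us ms → (Fin (length us) → ℤ) → Vec ℤ n → Set
      Cond []       {[]}     _        t v = ∀ j → j < 𝐋.ρ → Ok (List⁺.toList c) (iter (exec S (List⁺.toList c)) j v)
      Cond (u ∷ us) {m ∷ ms} (a , as) t v =
        (∀ j → j < ρ → Ok (elemWord u) (iter (exec S (elemWord u)) j v)) ×
        (∀ j → j < ρ → α ≤ j → Ok (elemWord u) (iter (exec S (elemWord u)) j v ⊞ t zero ⊡ D)) ×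
        Cond us as (t ∘ suc) (iter (exec S (elemWord u)) ρ v ⊞ t zero ⊡ D)
        where open Accelerated a

      Cond-cong : ∀ us {ms} (as : AllAccelerated us ms) {t t′} → t ≗ t′ → ∀ v → Cond us as t v → Cond us as t′ v
      Cond-cong []       {[]}     _        t≗t′ v cond = cond
      Cond-cong (u ∷ us) {m ∷ ms} (a , as) {t} {t′} t≗t′ v (first , last , rest) = first ,
        (λ j j<ρ α≤j → subst (λ z → Ok (elemWord u) (iter (exec S (elemWord u)) j v ⊞ z ⊡ D)) (t≗t′ zero) (last j j<ρ α≤j)) ,
        Cond-cong us as (t≗t′ ∘ suc) _ (subst (λ z → Cond us as (t ∘ suc) (iter (exec S (elemWord u)) ρ v ⊞ z ⊡ D)) (t≗t′ zero) rest)
        where open Accelerated a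

      Cond⇒Ok : 1 ≤ 𝐋.π → ∀ v₀ → (∀ j → Ok (List⁺.toList c) (iter (exec S (List⁺.toList c)) j v₀)) →
        ∀ us {ms} (as : AllAccelerated us ms) t v → Cond us as (+_ ∘ t) v →
        Ok (prefixWord us (counts us as t)) v ×
        (∀ j → Ok (List⁺.toList c) (iter (exec S (List⁺.toList c)) j (exec S (prefixWord us (counts us as t)) v)))
      Cond⇒Ok 1≤π v₀ oks₀ []       {[]}     _        t v cond = tt , 𝐋.forever 1≤π v₀ v oks₀ cond
      Cond⇒Ok 1≤π v₀ oks₀ (u ∷ us) {m ∷ ms} (a , as) t v (first , last , rest) =
        Ok-++⁺ (repeat S k w) rest-word v (Ok-repeat⁺ k w v (all-iterations v (t zero) first last))
          (subst (Ok rest-word) (sym after) (proj₁ ih)) ,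
        λ j → subst (λ u → Ok (List⁺.toList c) (iter (exec S (List⁺.toList c)) j u))
          (sym (trans (exec-++ (repeat S k w) rest-word v) (cong (exec S rest-word) after))) (proj₂ ih j)
        where
        open Accelerated a
        w : List (Fin nR)
        w = elemWord u
        k : ℕ
        k = ρ + π * t zero
        rest-word : List (Fin nR)
        rest-word = prefixWord us (counts us as (t ∘ suc))
        after : exec S (repeat S k w) v ≡ iter (exec S w) ρ v ⊞ + t zero ⊡ D
        after = trans (exec-repeat k w v) (trans (cong (λ k → iter (exec S w) k v) (ℕ.+-comm ρ (π * t zero))) (period-* (t zero) ρ v α≤ρ))
        ih : _
        ih = Cond⇒Ok 1≤π v₀ oks₀ us as (t ∘ suc) (iter (exec S w) ρ v ⊞ + t zero ⊡ D) rest

      Ok⇒Cond : ∀ us {ms} (as : AllAccelerated us ms) v → Ok (prefixWord us ms) v →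
        (∀ j → Ok (List⁺.toList c) (iter (exec S (List⁺.toList c)) j (exec S (prefixWord us ms) v))) → Cond us as (+_ ∘ originals us as) v
      Ok⇒Cond []       {[]}     _        v ok oks = λ j _ → oks j
      Ok⇒Cond (u ∷ us) {m ∷ ms} (a , as) v ok oks = first , last ,
        subst (Cond us as (+_ ∘ originals us as)) after
          (Ok⇒Cond us as (exec S (repeat S m w) v) (proj₂ split) λ j → subst (λ u → Ok (List⁺.toList c) (iter (exec S (List⁺.toList c)) j u))
            (exec-++ (repeat S m w) (prefixWord us ms) v) (oks j))
        where
        open Accelerated a
        w : List (Fin nR)
        w = elemWord u
        split : Ok (repeat S m w) v × Ok (prefixWord us ms) (exec S (repeat S m w) v)
        split = Ok-++⁻ (repeat S m w) (prefixWord us ms) v ok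
        first : ∀ j → j < ρ → Ok w (iter (exec S w) j v)
        first j j<ρ = Ok-repeat⁻ m w v (proj₁ split) j (ℕ.<-≤-trans j<ρ (ℕ.≤-trans (ℕ.m≤m+n ρ (π * y₀)) (ℕ.≤-reflexive (sym m≡))))
        -- In the original run the translate of iteration j by y₀ drifts is iteration π y₀ + j.
        last : ∀ j → j < ρ → α ≤ j → Ok w (iter (exec S w) j v ⊞ + y₀ ⊡ D)
        last j j<ρ α≤j = subst (Ok w) (period-* y₀ j v α≤j) (Ok-repeat⁻ m w v (proj₁ split) (π * y₀ + j)
          (ℕ.<-≤-trans (ℕ.+-monoʳ-< (π * y₀) j<ρ) (ℕ.≤-reflexive (trans (ℕ.+-comm (π * y₀) ρ) (sym m≡)))))
        after : exec S (repeat S m w) v ≡ iter (exec S w) ρ v ⊞ + y₀ ⊡ D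
        after = trans (exec-repeat m w v) (trans (cong (λ k → iter (exec S w) k v) (trans m≡ (ℕ.+-comm ρ (π * y₀)))) (period-* y₀ ρ v α≤ρ))

-- Bounds for the constraint system

lookup-0ᵥ : ∀ {n} (i : Fin n) → lookup (0ᵥ {n}) i ≡ 0ℤ
lookup-0ᵥ i = Vec.lookup-replicate i 0ℤ

⊞-0ᵥ : ∀ {n} (v : Vec ℤ n) → v ≡ v ⊞ 0ᵥ
⊞-0ᵥ v = vec-ext λ i → sym (trans (lookup-⊞ v 0ᵥ i) (trans (cong (λ z → lookup v i ℤ.+ z) (lookup-0ᵥ i)) (ℤ.+-identityʳ _)))

Expressible-nonneg : ∀ {K G} → 1 ≤ G → Expressible {K} G (λ y → ∀ j → 0ℤ ℤ.≤ y j)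
Expressible-nonneg {K} {G} 1≤G = record
  { rows = List.tabulate row
  ; rows≤ = All.tabulate⁺ λ j → (λ i → ℕ.≤-trans (ℕ.≤-reflexive (trans (cong ∣_∣ (ℤ.-1*i≡-i (δ j i))) (ℤ.∣-i∣≡∣i∣ (δ j i)))) (ℕ.≤-trans (∣δ∣≤1 j i) 1≤G)) , z≤n
  ; to = λ y 0≤y → All.tabulate⁺ λ j → subst (ℤ._≤ 0ℤ) (sym (row∙ j y)) (ℤ.neg-mono-≤ (0≤y j))
  ; from = λ y h j → subst (0ℤ ℤ.≤_) (ℤ.neg-involutive (y j)) (ℤ.neg-mono-≤ (subst (ℤ._≤ 0ℤ) (row∙ j y) (All.tabulate⁻ h j))) }
  where
  row : Fin K → Row K
  row j = (λ i → ℤ.-1ℤ ℤ.* δ j i) , 0ℤ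
  row∙ : ∀ j y → (λ i → ℤ.-1ℤ ℤ.* δ j i) ∙ y ≡ ℤ.- y j
  row∙ j y = trans (∙-scaleˡ ℤ.-1ℤ (δ j) y) (trans (ℤ.-1*i≡-i (δ j ∙ y)) (cong ℤ.-_ (δ-∙ j y)))

-- `wordBound` bounds the effect of at most s rules, each contributing a factor (n + 1) H.
-- `periodBound` counts matrices with entries up to the entry bound. In `iterBound`, 3 times
-- `periodBound` bounds the iterations treated one by one, whose number is at most (π + α) + π, and
-- the factor 2 arises because a drift is a difference of two constants.
wordBound periodBound iterBound : ℕ → ℕ → ℕ → ℕ
wordBound   n H s = (suc n * H) ^ s
periodBound n H s = suc (entryBound n (wordBound n H s) + entryBound n (wordBound n H s)) ^ (n * n)
iterBound   n H s = W + (E + 2 * (3 * periodBound n H s * (n * (W * E))))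
  where
  W E : ℕ
  W = wordBound n H s
  E = entryBound n W

-- Starting from an initial vector bounded by H, the coefficients gain a factor (n + 2) `iterBound`
-- for each of the K elements and for the last cycle, then (n + 1) H for each rule of a word and for
-- the guard. One of the n + 2 summands accounts for the drift and one for the constant.
condBound : ℕ → ℕ → ℕ → ℕ → ℕ
condBound n H s K = (suc n * H) ^ suc s * ((suc (suc n) * iterBound n H s) ^ suc K * H)

module Bounded {nQ nAP n nR H : ℕ} (S : CounterSystem nQ nAP n nR) (small : ∀ δ → RuleBounded H (Δ S δ)) (1≤H : 1 ≤ H) (s : ℕ) where

  open Semantics S small
  open Acceleration S small

  Z W E B X : ℕ
  Z = suc n * H
  W = wordBound n H s
  E = entryBound n W
  B = 3 * periodBound n H s
  X = iterBound n H s

  1≤Z : 1 ≤ Z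
  1≤Z = ℕ.*-mono-≤ {1} {suc n} (s≤s z≤n) 1≤H

  1≤Z^ : ∀ k → 1 ≤ Z ^ k
  1≤Z^ k = ℕ.m^n>0 Z {{ℕ.>-nonZero 1≤Z}} k

  1≤X : 1 ≤ X
  1≤X = ℕ.≤-trans (1≤Z^ s) (ℕ.m≤m+n W _)

  Affine-exec : ∀ w → Affine (Z ^ length w) (exec S w) (lin S w)
  Affine-exec []      = Affine-id
  Affine-exec (δ ∷ w) = subst (λ Y → Affine Y (exec S (δ ∷ w)) (lin S (δ ∷ w))) (arith n (Z ^ length w) H)
    (Affine-∘ 1≤H (Affine-exec w) (Affine-update (Δ S δ) (small δ)))
    where
    arith : ∀ n Y H → suc n * Y * H ≡ suc n * H * Y
    arith = ℕ-Ring.solve-∀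

  Affine-exec-W : ∀ w → length w ≤ s → Affine W (exec S w) (lin S w)
  Affine-exec-W w w≤s = Affine-mono (ℕ.^-monoʳ-≤ Z {{ℕ.>-nonZero 1≤Z}} w≤s) (Affine-exec w)

  Expressible-Ok : ∀ {K G} {V : (Fin K → ℤ) → Vec ℤ n} w → 1 ≤ G → AffineIn G V → Expressible (Z ^ suc (length w) * G) (λ y → Ok w (V y))
  Expressible-Ok []      1≤G 𝑽 = Expressible-⊤
  Expressible-Ok {G = G} (δ ∷ w) 1≤G 𝑽 = Expressible-×
    (Expressible-mono (ℕ.*-monoˡ-≤ G (ℕ.m≤m*n Z (Z ^ suc (length w)) {{ℕ.>-nonZero (1≤Z^ (suc (length w)))}}))
      (Expressible-Sat (guard (Δ S δ)) 1≤G (proj₂ (proj₂ (small δ))) 𝑽))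
    (Expressible-mono (ℕ.≤-reflexive (arith Z (Z ^ suc (length w)) G))
      (Expressible-Ok w (ℕ.*-mono-≤ 1≤Z 1≤G) (AffineIn-∘ 1≤G (Affine-update (Δ S δ) (small δ)) 𝑽)))
    where
    arith : ∀ Z Y G → Y * (Z * G) ≡ Z * Y * G
    arith = ℕ-Ring.solve-∀

  Φ : ℕ
  Φ = suc (suc n) * X

  1≤Φ : 1 ≤ Φ
  1≤Φ = ℕ.*-mono-≤ {1} {suc (suc n)} (s≤s z≤n) 1≤X

  Expressible-Ok-s : ∀ {K G} {V : (Fin K → ℤ) → Vec ℤ n} w → length w ≤ s → 1 ≤ G → AffineIn G V → Expressible (Z ^ suc s * G) (λ y → Ok w (V y))
  Expressible-Ok-s {G = G} w w≤s 1≤G 𝑽 = Expressible-mono (ℕ.*-monoˡ-≤ G (ℕ.^-monoʳ-≤ Z {{ℕ.>-nonZero 1≤Z}} (s≤s w≤s))) (Expressible-Ok w 1≤G 𝑽)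

  AffineIn-iter : ∀ {K G F L} {V : (Fin K → ℤ) → Vec ℤ n} → 1 ≤ G → Affine X F L → AffineIn G V → AffineIn (Φ * G) (F ∘ V)
  AffineIn-iter {G = G} 1≤G 𝑭 𝑽 = AffineIn-mono (ℕ.*-monoˡ-≤ G (ℕ.*-monoˡ-≤ X (ℕ.n≤1+n (suc n)))) (AffineIn-∘ 1≤G 𝑭 𝑽)

  AffineIn-drift : ∀ {K G F L} {V : (Fin K → ℤ) → Vec ℤ n} ι D → (∀ i → ∣ lookup D i ∣ ≤ X) → 1 ≤ G → Affine X F L → AffineIn G V →
    AffineIn (Φ * G) (λ y → F (V y) ⊞ y ι ⊡ D)
  AffineIn-drift {G = G} ι D D≤ 1≤G 𝑭 𝑽 = AffineIn-mono (ℕ.≤-trans (ℕ.+-monoʳ-≤ (suc n * X * G) (ℕ.m≤m*n X G {{ℕ.>-nonZero 1≤G}})) (ℕ.≤-reflexive (arith n X G)))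
    (AffineIn-⊞ ι D D≤ (AffineIn-∘ 1≤G 𝑭 𝑽))
    where
    arith : ∀ n X G → suc n * X * G + X * G ≡ suc (suc n) * X * G
    arith = ℕ-Ring.solve-∀

  -- `ι` places the unknowns of the remaining elements among all K: the vector reached so far
  -- already depends on the earlier ones.
  Expressible-Cond : ∀ {K G} c (final : Loop X (List⁺.toList c)) → length (List⁺.toList c) ≤ s → 1 ≤ G →
    ∀ us {ms} (as : AllAccelerated {X} {B} us ms) → All (λ u → length (elemWord u) ≤ s) us →
    (ι : Fin (length us) → Fin K) {V : (Fin K → ℤ) → Vec ℤ n} → AffineIn G V →
    Expressible (Z ^ suc s * (Φ ^ suc (length us) * G)) (λ y → Cond c final us as (y ∘ ι) (V y))
  Expressible-Cond {G = G} c final c≤s 1≤G []       {[]}     _        _            ι 𝑽 = Expressible-∀< (Loop.ρ final) λ j j<ρ →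
    Expressible-mono (ℕ.*-monoʳ-≤ (Z ^ suc s) (ℕ.*-monoˡ-≤ G (ℕ.≤-reflexive (sym (ℕ.*-identityʳ Φ)))))
      (Expressible-Ok-s (List⁺.toList c) c≤s (ℕ.*-mono-≤ 1≤Φ 1≤G) (AffineIn-iter 1≤G (Loop.affine final j (ℕ.<⇒≤ j<ρ)) 𝑽))
  Expressible-Cond {K} {G} c final c≤s 1≤G (u ∷ us) {m ∷ ms} (a , as) (u≤s ∷ us≤s) ι {V} 𝑽 = Expressible-×
    (Expressible-∀< ρ λ j j<ρ → local (AffineIn-iter 1≤G (affine j (ℕ.<⇒≤ j<ρ)) 𝑽))
    (Expressible-×
      (Expressible-∀< ρ λ j j<ρ → Expressible-→ (α ℕ.≤? j) (local (AffineIn-drift (ι zero) D D≤ 1≤G (affine j (ℕ.<⇒≤ j<ρ)) 𝑽)))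
      (Expressible-mono (ℕ.*-monoʳ-≤ (Z ^ suc s) (ℕ.≤-reflexive (arith Φ (Φ ^ suc (length us)) G)))
        (Expressible-Cond c final c≤s (ℕ.*-mono-≤ 1≤Φ 1≤G) us as us≤s (ι ∘ suc) (AffineIn-drift (ι zero) D D≤ 1≤G (affine ρ ℕ.≤-refl) 𝑽))))
    where
    open Accelerated a
    arith : ∀ Z Y G → Y * (Z * G) ≡ Z * Y * G
    arith = ℕ-Ring.solve-∀
    local : ∀ {V : (Fin K → ℤ) → Vec ℤ n} → AffineIn (Φ * G) V → Expressible (Z ^ suc s * (Φ ^ suc (suc (length us)) * G)) (λ y → Ok (elemWord u) (V y))
    local 𝑽′ = Expressible-mono (ℕ.*-monoʳ-≤ (Z ^ suc s) (ℕ.*-monoˡ-≤ G (ℕ.m≤m*n Φ (Φ ^ suc (length us)) {{ℕ.m^n≢0 Φ (suc (length us)) {{ℕ.>-nonZero 1≤Φ}}}})))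
      (Expressible-Ok-s (elemWord u) u≤s (ℕ.*-mono-≤ 1≤Φ 1≤G) 𝑽′)

  record PeriodicWord (w : List (Fin nR)) : Set where
    field
      α π    : ℕ
      D      : Vec ℤ n
      1≤π    : 1 ≤ π
      π+α≤   : π + α ≤ periodBound n H s
      period : ∀ j v → α ≤ j → iter (exec S w) (π + j) v ≡ iter (exec S w) j v ⊞ D
      affine : ∀ j → j ≤ B → Affine X (iter (exec S w) j) (iter (lin S w) j)
      D≤     : ∀ i → ∣ lookup D i ∣ ≤ X

  periodic-word : FiniteMonoid S → ∀ w → length w ≤ s → PeriodicWord w
  periodic-word fm w w≤s = from-period (pow-period {a = proj₁ evp} {p = proj₁ (proj₂ evp)} M (1≤Z^ s) M≤ ev)
    where
    𝑭 : Affine W (exec S w) (lin S w)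
    𝑭 = Affine-exec-W w w≤s
    open Affine 𝑭 using (M; M≤; linear)
    evp : ∃₂ λ a p → EventuallyPeriodic M a p
    evp = finite-monoid⇒eventuallyPeriodic S fm w M linear
    ev : EventuallyPeriodic M (proj₁ evp) (proj₁ (proj₂ evp))
    ev = proj₂ (proj₂ evp)
    open Iteration 𝑭 (pow-entry-bounded {a = proj₁ evp} {p = proj₁ (proj₂ evp)} M (1≤Z^ s) M≤ ev)
    from-period : (∃₂ λ α p → suc p + α ≤ periodBound n H s × EventuallyPeriodic M α p) → PeriodicWord w
    from-period (α , p , π+α≤ , evα) = record
      { α = α ; π = suc p ; D = drift α (suc p) ; 1≤π = s≤s z≤n ; π+α≤ = π+α≤
      ; period = iter-drift α p evα
      ; affine = λ j j≤B → Affine-mono (ℕ.≤-trans (ℕ.+-monoʳ-≤ E (ℕ.m≤m+n _ _)) (ℕ.m≤n+m _ W)) (Affine-iter j j≤B)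
      ; D≤ = λ i → ℕ.≤-trans (drift≤ {B} α (suc p) (ℕ.≤-trans π+α≤ (ℕ.m≤m+n _ _)) i) (ℕ.≤-trans (ℕ.m≤n+m _ E) (ℕ.m≤n+m _ W)) }

  constant-loop : ∀ w m → 1 ≤ m → (∀ j → j ≤ m → Affine X (iter (exec S w) j) (iter (lin S w) j)) → Loop X w
  constant-loop w m 1≤m aff = record { α = 0 ; π = 0 ; ρ = m ; D = 0ᵥ ; α+π≤ρ = z≤n ; 1≤ρ = 1≤m
    ; period = λ j v _ → ⊞-0ᵥ (iter (exec S w) j v) ; affine = aff ; D≤ = λ i → subst (λ z → ∣ z ∣ ≤ X) (sym (lookup-0ᵥ i)) z≤n }

  periodic-loop : ∀ {w} (pw : PeriodicWord w) → let open PeriodicWord pw in ∀ r → r ≤ π → Loop X w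
  periodic-loop pw r r≤π = record { α = α ; π = π ; ρ = π + α + r ; D = D
    ; α+π≤ρ = ℕ.≤-trans (ℕ.≤-reflexive (ℕ.+-comm α π)) (ℕ.m≤m+n (π + α) r)
    ; 1≤ρ = ℕ.≤-trans 1≤π (ℕ.≤-trans (ℕ.m≤m+n π α) (ℕ.m≤m+n (π + α) r))
    ; period = period ; affine = λ j j≤ → affine j (ℕ.≤-trans j≤ (ρ≤B r r≤π)) ; D≤ = D≤ }
    where
    open PeriodicWord pw
    ρ≤B : ∀ r → r ≤ π → π + α + r ≤ B
    ρ≤B r r≤π = ℕ.+-mono-≤ π+α≤ (ℕ.≤-trans r≤π (ℕ.≤-trans (ℕ.m≤m+n π α) (ℕ.≤-trans π+α≤ (ℕ.m≤m+n (periodBound n H s) _))))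

  -- A count below π + α is frozen. A larger one is (π + α + r) + π q, where q and r are quotient
  -- and remainder of m - (π + α) by π; keeping π + α in the base provides α + π ≤ ρ.
  accelerate : ∀ u m → ValidCount u m → (∀ c → u ≡ cy c → PeriodicWord (List⁺.toList c)) → length (elemWord u) ≤ s → Accelerated X B u m
  accelerate (rl δ) .1 refl _ 1≤s = record
    { accel = constant-loop (δ ∷ []) 1 ℕ.≤-refl λ
        { zero _ → Affine-mono 1≤X Affine-id
        ; (suc zero) _ → Affine-mono (ℕ.m≤m+n W _) (Affine-exec-W (δ ∷ []) 1≤s)
        ; (suc (suc j)) (s≤s ()) }
    ; y₀ = 0 ; m≡ = refl ; valid = λ _ → refl ; ρ≤B = ℕ.*-mono-≤ {1} {3} (s≤s z≤n) (ℕ.m^n>0 (suc (E + E)) (n * n)) ; π≤B = z≤n }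
  accelerate (cy c) m 1≤m periodic _ = by-size (m ℕ.<? π + α)
    where
    pw : PeriodicWord (List⁺.toList c)
    pw = periodic c refl
    open PeriodicWord pw
    instance
      π≢0 : ℕ.NonZero π
      π≢0 = ℕ.>-nonZero 1≤π
    P≤B : periodBound n H s ≤ B
    P≤B = ℕ.m≤m+n _ _
    by-size : Dec (m < π + α) → Accelerated X B (cy c) m
    by-size (yes m<) = record
      { accel = constant-loop (List⁺.toList c) m 1≤m λ j j≤m → affine j (ℕ.≤-trans j≤m m≤B)
      ; y₀ = 0 ; m≡ = sym (ℕ.+-identityʳ m) ; valid = λ _ → ℕ.≤-trans 1≤m (ℕ.m≤m+n m _) ; ρ≤B = m≤B ; π≤B = z≤n }
      where
      m≤B : m ≤ B
      m≤B = ℕ.≤-trans (ℕ.<⇒≤ m<) (ℕ.≤-trans π+α≤ P≤B)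
    by-size (no m≮) = record
      { accel = periodic-loop pw r r≤π
      ; y₀ = q
      ; m≡ = sym (trans (ℕ.+-assoc (π + α) r (π * q)) (trans (cong (λ z → π + α + z) (trans (cong (λ z → r + z) (ℕ.*-comm π q)) (sym (ℕ.m≡m%n+[m/n]*n d π)))) (ℕ.m+[n∸m]≡n (ℕ.≮⇒≥ m≮))))
      ; valid = λ t → ℕ.≤-trans (Loop.1≤ρ (periodic-loop pw r r≤π)) (ℕ.m≤m+n _ (π * t))
      ; ρ≤B = ℕ.+-mono-≤ π+α≤ (ℕ.≤-trans r≤π (ℕ.≤-trans (ℕ.m≤m+n π α) (ℕ.≤-trans π+α≤ (ℕ.m≤m+n (periodBound n H s) _))))
      ; π≤B = ℕ.≤-trans (ℕ.m≤m+n π α) (ℕ.≤-trans π+α≤ P≤B) }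
      where
      d q r : ℕ
      d = m ℕ.∸ (π + α)
      q = d ℕ./ π
      r = d ℕ.% π
      r≤π : r ≤ π
      r≤π = ℕ.<⇒≤ (ℕ.m%n<n d π)

-- Sizes and polynomial growth

lookup-injective : ∀ {A : Set} {xs : List A} → Unique xs → ∀ i j → List.lookup xs i ≡ List.lookup xs j → i ≡ j
lookup-injective (x∉xs ∷ uniq) zero    zero    eq = refl
lookup-injective (x∉xs ∷ uniq) zero    (suc j) eq = contradiction eq (All.lookup x∉xs (∈-lookup j))
lookup-injective (x∉xs ∷ uniq) (suc i) zero    eq = contradiction (sym eq) (All.lookup x∉xs (∈-lookup i))
lookup-injective (x∉xs ∷ uniq) (suc i) (suc j) eq = cong suc (lookup-injective uniq i j eq)

Unique⇒length≤ : ∀ {n} {xs : List (Fin n)} → Unique xs → length xs ≤ n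
Unique⇒length≤ {xs = xs} uniq = Fin.injective⇒≤ {f = List.lookup xs} λ {i} {j} → lookup-injective uniq i j

-- In a flat system a simple cycle is determined by its source, so the cycles of
-- a path schema embed into the states.
module _ {nQ nAP n nR : ℕ} (S : CounterSystem nQ nAP n nR) where

  elemKey : Elem nR → Fin nR ⊎ Fin nQ
  elemKey (rl δ) = inj₁ δ
  elemKey (cy c) = inj₂ (src (Δ S (List⁺.head c)))

  elemKey-injective : Flat S → ∀ u u′ → ElemOK S u → ElemOK S u′ → elemKey u ≡ elemKey u′ → u ≡ u′
  elemKey-injective flat (rl δ) (rl δ′) _  _   eq = cong rl (inj₁-injective eq)
  elemKey-injective flat (cy c) (cy c′) ok ok′ eq = cong cy (flat c c′ ok ok′ (inj₂-injective eq))

  schema-length : Flat S → ∀ us → All (ElemOK S) us → Unique us → length us ≤ nR + nQ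
  schema-length flat us oks uniq = Fin.injective⇒≤ {f = λ i → Fin.join nR nQ (elemKey (List.lookup us i))} λ {i} {j} eq →
    lookup-injective uniq i j (elemKey-injective flat _ _ (All.lookup oks (∈-lookup i)) (All.lookup oks (∈-lookup j))
      (trans (sym (Fin.splitAt-join nR nQ (elemKey (List.lookup us i)))) (trans (cong (Fin.splitAt nR) eq) (Fin.splitAt-join nR nQ (elemKey (List.lookup us j))))))

n≤2^⌈log₂n⌉ : ∀ n → n ≤ 2 ^ ⌈log₂ n ⌉
n≤2^⌈log₂n⌉ n = <-rec (λ n → n ≤ 2 ^ ⌈log₂ n ⌉) halve n
  where
  halve : ∀ n → (∀ {m} → m < n → m ≤ 2 ^ ⌈log₂ m ⌉) → n ≤ 2 ^ ⌈log₂ n ⌉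
  halve 0 rec = z≤n
  halve 1 rec = s≤s z≤n
  halve n@(suc (suc k)) rec = begin
    n                                     ≡⟨ sym (ℕ.⌊n/2⌋+⌈n/2⌉≡n n) ⟩
    ℕ.⌊ n /2⌋ + ℕ.⌈ n /2⌉                 ≤⟨ ℕ.+-monoˡ-≤ ℕ.⌈ n /2⌉ (ℕ.⌊n/2⌋≤⌈n/2⌉ n) ⟩
    ℕ.⌈ n /2⌉ + ℕ.⌈ n /2⌉                 ≡⟨ cong (λ z → ℕ.⌈ n /2⌉ + z) (sym (ℕ.+-identityʳ _)) ⟩
    2 * ℕ.⌈ n /2⌉                         ≤⟨ ℕ.*-monoʳ-≤ 2 (rec (ℕ.⌈n/2⌉<n k)) ⟩
    2 ^ suc ⌈log₂ ℕ.⌈ n /2⌉ ⌉             ≡⟨ cong (λ z → 2 ^ suc z) (⌈log₂⌈n/2⌉⌉≡⌈log₂n⌉∸1 n) ⟩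
    2 ^ suc (⌈log₂ n ⌉ ℕ.∸ 1)             ≡⟨ cong (2 ^_) (ℕ.m+[n∸m]≡n {1} (⌈log₂⌉-mono-≤ {2} {n} (s≤s (s≤s z≤n)))) ⟩
    2 ^ ⌈log₂ n ⌉                         ∎
    where open ℕ.≤-Reasoning

∣i∣≤2^bits : ∀ i → ∣ i ∣ ≤ 2 ^ bits i
∣i∣≤2^bits i = ℕ.≤-trans (ℕ.n≤1+n ∣ i ∣) (ℕ.≤-trans (n≤2^⌈log₂n⌉ (suc ∣ i ∣)) (ℕ.^-monoʳ-≤ 2 (ℕ.n≤1+n ⌈log₂ suc ∣ i ∣ ⌉)))

bits≤⇒ : ∀ {s} i → bits i ≤ s → ∣ i ∣ ≤ 2 ^ s
bits≤⇒ i le = ℕ.≤-trans (∣i∣≤2^bits i) (ℕ.^-monoʳ-≤ 2 le)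

bits≤sizeVec : ∀ {n} (v : Vec ℤ n) i → bits (lookup v i) ≤ sizeVec v
bits≤sizeVec (x ∷ v) zero    = ℕ.m≤m+n (bits x) (sizeVec v)
bits≤sizeVec (x ∷ v) (suc i) = ℕ.≤-trans (bits≤sizeVec v i) (ℕ.m≤n+m (sizeVec v) (bits x))

sizeVec≤sizeRows : ∀ {m n} (M : Vec (Vec ℤ n) m) i → sizeVec (lookup M i) ≤ Vec.foldr _ _+_ 0 (Vec.map sizeVec M)
sizeVec≤sizeRows (v ∷ M) zero    = ℕ.m≤m+n (sizeVec v) _
sizeVec≤sizeRows (v ∷ M) (suc i) = ℕ.≤-trans (sizeVec≤sizeRows M i) (ℕ.m≤n+m _ (sizeVec v))

f≤sum-map : ∀ {A : Set} (f : A → ℕ) {x xs} → x ∈ xs → f x ≤ ℕ.sum (List.map f xs)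
f≤sum-map f {x} {y ∷ xs} (Any.here refl) = ℕ.m≤m+n (f x) _
f≤sum-map f {x} {y ∷ xs} (Any.there m)   = ℕ.≤-trans (f≤sum-map f m) (ℕ.m≤n+m _ (f y))

length≤sum-map : ∀ {A : Set} (f : A → ℕ) xs → (∀ x → 1 ≤ f x) → length xs ≤ ℕ.sum (List.map f xs)
length≤sum-map f []       1≤f = z≤n
length≤sum-map f (x ∷ xs) 1≤f = ℕ.+-mono-≤ (1≤f x) (length≤sum-map f xs 1≤f)

sizeRule-RuleBounded : ∀ {nQ n} (r : Rule nQ n) {s} → sizeRule r ≤ s → RuleBounded (2 ^ s) r
sizeRule-RuleBounded r {s} size≤s = (λ i j → bits≤⇒ (entry (A r) i j) (ℕ.≤-trans (bits≤sizeVec (lookup (A r) i) j)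
    (ℕ.≤-trans (sizeVec≤sizeRows (A r) i) (ℕ.≤-trans (ℕ.≤-trans (ℕ.m≤n+m (sizeMatrix (A r)) (3 + sizeGuard (guard r))) (ℕ.m≤m+n _ (sizeVec (b r)))) size≤s)))) ,
  (λ i → bits≤⇒ (lookup (b r) i) (ℕ.≤-trans (bits≤sizeVec (b r) i) (ℕ.≤-trans (ℕ.m≤n+m (sizeVec (b r)) _) size≤s))) ,
  All.tabulate λ { {c , d} m → (λ i → bits≤⇒ (lookup c i) (ℕ.≤-trans (bits≤sizeVec c i) (ℕ.≤-trans (ℕ.m≤m+n (sizeVec c) (bits d)) (in-guard m)))) ,
    bits≤⇒ d (ℕ.≤-trans (ℕ.m≤n+m (bits d) (sizeVec c)) (in-guard m)) }
  where
  in-guard : ∀ {cd} → cd ∈ guard r → sizeVec (proj₁ cd) + bits (proj₂ cd) ≤ s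
  in-guard m = ℕ.≤-trans (f≤sum-map (λ cd → sizeVec (proj₁ cd) + bits (proj₂ cd)) m) (ℕ.≤-trans (ℕ.m≤n+m (sizeGuard (guard r)) 3)
    (ℕ.≤-trans (ℕ.m≤m+n (3 + sizeGuard (guard r)) (sizeMatrix (A r))) (ℕ.≤-trans (ℕ.m≤m+n _ (sizeVec (b r))) size≤s)))

module _ {nQ nAP n nR : ℕ} (S : CounterSystem nQ nAP n nR) where

  private
    rules : ℕ
    rules = ℕ.sum (List.map (λ i → sizeRule (Δ S i)) (List.allFin nR))

  sizeRule≤sizeCS : ∀ δ → sizeRule (Δ S δ) ≤ sizeCS S
  sizeRule≤sizeCS δ = ℕ.≤-trans (f≤sum-map (λ i → sizeRule (Δ S i)) (∈-allFin δ)) (ℕ.m≤n+m rules _)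

  nR≤rules : nR ≤ rules
  nR≤rules = subst (_≤ rules) (List.length-tabulate id) (length≤sum-map (λ i → sizeRule (Δ S i)) (List.allFin nR) λ _ → s≤s z≤n)

  nR+nQ≤sizeCS : nR + nQ ≤ sizeCS S
  nR+nQ≤sizeCS = ℕ.≤-trans (ℕ.≤-reflexive (ℕ.+-comm nR nQ)) (ℕ.+-mono-≤
    (ℕ.≤-trans (ℕ.m≤m+n nQ nAP) (ℕ.≤-trans (ℕ.m≤m+n (nQ + nAP) n) (ℕ.m≤m+n (nQ + nAP + n) (nQ * nAP)))) nR≤rules)

  n≤sizeCS : n ≤ sizeCS S
  n≤sizeCS = ℕ.≤-trans (ℕ.m≤n+m n (nQ + nAP)) (ℕ.≤-trans (ℕ.m≤m+n (nQ + nAP + n) (nQ * nAP)) (ℕ.m≤m+n _ rules))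

-- Arithmetic of polynomial and exponential bounds

addPoly : Poly → Poly → Poly
addPoly []       q        = q
addPoly (a ∷ p)  []       = a ∷ p
addPoly (a ∷ p)  (b ∷ q)  = a + b ∷ addPoly p q

evalPoly-add : ∀ p q x → evalPoly (addPoly p q) x ≡ evalPoly p x + evalPoly q x
evalPoly-add []      q       x = refl
evalPoly-add (a ∷ p) []      x = sym (ℕ.+-identityʳ _)
evalPoly-add (a ∷ p) (b ∷ q) x = trans (cong (λ z → a + b + x * z) (evalPoly-add p q x)) (arith a b x (evalPoly p x) (evalPoly q x))
  where
  arith : ∀ a b x u v → a + b + x * (u + v) ≡ a + x * u + (b + x * v)
  arith = ℕ-Ring.solve-∀

scalePoly : ℕ → Poly → Poly
scalePoly c = List.map (c *_)

evalPoly-scale : ∀ c p x → evalPoly (scalePoly c p) x ≡ c * evalPoly p x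
evalPoly-scale c []      x = sym (ℕ.*-zeroʳ c)
evalPoly-scale c (a ∷ p) x = trans (cong (λ z → c * a + x * z) (evalPoly-scale c p x)) (arith c a x (evalPoly p x))
  where
  arith : ∀ c a x u → c * a + x * (c * u) ≡ c * (a + x * u)
  arith = ℕ-Ring.solve-∀

mulPoly : Poly → Poly → Poly
mulPoly []      q = []
mulPoly (a ∷ p) q = addPoly (scalePoly a q) (0 ∷ mulPoly p q)

evalPoly-mul : ∀ p q x → evalPoly (mulPoly p q) x ≡ evalPoly p x * evalPoly q x
evalPoly-mul []      q x = refl
evalPoly-mul (a ∷ p) q x = trans (evalPoly-add (scalePoly a q) (0 ∷ mulPoly p q) x)
  (trans (cong₂ (λ y z → y + x * z) (evalPoly-scale a q x) (evalPoly-mul p q x)) (arith a x (evalPoly p x) (evalPoly q x)))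
  where
  arith : ∀ a x u v → a * v + x * (u * v) ≡ (a + x * u) * v
  arith = ℕ-Ring.solve-∀

n≤2^n : ∀ n → n ≤ 2 ^ n
n≤2^n zero    = z≤n
n≤2^n (suc n) = ℕ.≤-trans (ℕ.+-mono-≤ {1} {2 ^ n} (ℕ.m^n>0 2 n) (n≤2^n n)) (ℕ.≤-reflexive (cong (λ z → 2 ^ n + z) (sym (ℕ.+-identityʳ _))))

module Growth {I : Set} (size : I → ℕ) where

  PolyBounded ExpBounded : (I → ℕ) → Set
  PolyBounded f = Σ Poly λ p → ∀ i → f i ≤ evalPoly p (size i)
  ExpBounded  f = Σ Poly λ p → ∀ i → f i ≤ 2 ^ evalPoly p (size i)

  poly-size : ∀ {f} → (∀ i → f i ≤ size i) → PolyBounded f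
  poly-size f≤ = 0 ∷ 1 ∷ [] , λ i → ℕ.≤-trans (f≤ i) (ℕ.≤-reflexive (arith (size i)))
    where
    arith : ∀ x → x ≡ x * (1 + x * 0)
    arith = ℕ-Ring.solve-∀

  poly-const : ∀ c → PolyBounded λ _ → c
  poly-const c = c ∷ [] , λ i → ℕ.m≤m+n c _

  poly-+ : ∀ {f g} → PolyBounded f → PolyBounded g → PolyBounded λ i → f i + g i
  poly-+ (p , f≤) (q , g≤) = addPoly p q , λ i → ℕ.≤-trans (ℕ.+-mono-≤ (f≤ i) (g≤ i)) (ℕ.≤-reflexive (sym (evalPoly-add p q (size i))))

  poly-* : ∀ {f g} → PolyBounded f → PolyBounded g → PolyBounded λ i → f i * g i
  poly-* (p , f≤) (q , g≤) = mulPoly p q , λ i → ℕ.≤-trans (ℕ.*-mono-≤ (f≤ i) (g≤ i)) (ℕ.≤-reflexive (sym (evalPoly-mul p q (size i))))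

  poly-suc : ∀ {f} → PolyBounded f → PolyBounded λ i → suc (f i)
  poly-suc = poly-+ (poly-const 1)

  exp-poly : ∀ {f} → PolyBounded f → ExpBounded f
  exp-poly {f} (p , f≤) = p , λ i → ℕ.≤-trans (n≤2^n (f i)) (ℕ.^-monoʳ-≤ 2 (f≤ i))

  exp-2^ : ∀ {f} → PolyBounded f → ExpBounded λ i → 2 ^ f i
  exp-2^ (p , f≤) = p , λ i → ℕ.^-monoʳ-≤ 2 (f≤ i)

  exp-* : ∀ {f g} → ExpBounded f → ExpBounded g → ExpBounded λ i → f i * g i
  exp-* (p , f≤) (q , g≤) = addPoly p q , λ i → ℕ.≤-trans (ℕ.*-mono-≤ (f≤ i) (g≤ i))
    (ℕ.≤-reflexive (trans (sym (ℕ.^-distribˡ-+-* 2 (evalPoly p (size i)) (evalPoly q (size i)))) (cong (2 ^_) (sym (evalPoly-add p q (size i))))))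

  exp-+ : ∀ {f g} → ExpBounded f → ExpBounded g → ExpBounded λ i → f i + g i
  exp-+ {f} {g} (p , f≤) (q , g≤) = addPoly (1 ∷ []) (addPoly p q) , λ i → begin
    f i + g i                                                 ≤⟨ ℕ.+-mono-≤ (f≤ i) (g≤ i) ⟩
    2 ^ evalPoly p (size i) + 2 ^ evalPoly q (size i)         ≤⟨ ℕ.+-mono-≤ (ℕ.^-monoʳ-≤ 2 (ℕ.m≤m+n (evalPoly p (size i)) (evalPoly q (size i)))) (ℕ.^-monoʳ-≤ 2 (ℕ.m≤n+m (evalPoly q (size i)) (evalPoly p (size i)))) ⟩
    2 ^ e i + 2 ^ e i                                         ≡⟨ cong (λ z → 2 ^ e i + z) (sym (ℕ.+-identityʳ _)) ⟩
    2 ^ (1 + e i)                                             ≡⟨ cong (2 ^_) (sym (trans (evalPoly-add (1 ∷ []) (addPoly p q) (size i))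
                                                                   (cong₂ _+_ (cong suc (ℕ.*-zeroʳ (size i))) (evalPoly-add p q (size i))))) ⟩
    2 ^ evalPoly (addPoly (1 ∷ []) (addPoly p q)) (size i)    ∎
    where
    open ℕ.≤-Reasoning
    e : I → ℕ
    e i = evalPoly p (size i) + evalPoly q (size i)

  exp-^ : ∀ {f g} → ExpBounded f → PolyBounded g → ExpBounded λ i → f i ^ g i
  exp-^ {f} {g} (p , f≤) (q , g≤) = mulPoly p q , λ i → begin
    f i ^ g i                                               ≤⟨ ℕ.^-monoˡ-≤ (g i) (f≤ i) ⟩
    (2 ^ evalPoly p (size i)) ^ g i                         ≤⟨ ℕ.^-monoʳ-≤ (2 ^ evalPoly p (size i)) {{ℕ.m^n≢0 2 (evalPoly p (size i))}} (g≤ i) ⟩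
    (2 ^ evalPoly p (size i)) ^ evalPoly q (size i)         ≡⟨ ℕ.^-*-assoc 2 (evalPoly p (size i)) (evalPoly q (size i)) ⟩
    2 ^ (evalPoly p (size i) * evalPoly q (size i))         ≡⟨ cong (2 ^_) (sym (evalPoly-mul p q (size i))) ⟩
    2 ^ evalPoly (mulPoly p q) (size i)                     ∎
    where open ℕ.≤-Reasoning

  exp-const : ∀ c → ExpBounded λ _ → c
  exp-const c = exp-poly (poly-const c)

  exp-suc : ∀ {f} → ExpBounded f → ExpBounded λ i → suc (f i)
  exp-suc = exp-+ (exp-const 1)

-- The bound on the iteration counts

-- The bound depends on a system through these three numbers only. Using them as the index set
-- yields a polynomial fixed before any system is given, and the two inequalities make it a
-- polynomial in s alone.
record Parameters : Set where
  field
    n K s : ℕ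
    n≤s   : n ≤ s
    K≤s   : K ≤ s

iterationBound : ℕ → ℕ → ℕ → ℕ
iterationBound n K s = B + B * smallBound K (condBound n (2 ^ s) s K)
  where
  B : ℕ
  B = 3 * periodBound n (2 ^ s) s

opaque
  iterationBound-exponential : Growth.ExpBounded Parameters.s λ i → iterationBound (Parameters.n i) (Parameters.K i) (Parameters.s i)
  iterationBound-exponential = exp-+ eB (exp-* eB (exp-* (exp-poly pK) (exp-* eG (exp-+ eC (exp-* (exp-poly pK) (exp-* eC eG))))))
    where
    open Growth Parameters.s
    open Parameters
    pn : PolyBounded n
    pn = poly-size n≤s
    pK : PolyBounded K
    pK = poly-size K≤s
    ps : PolyBounded s
    ps = poly-size λ _ → ℕ.≤-refl
    pL : PolyBounded λ i → suc (n i)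
    pL = poly-suc pn
    eH : ExpBounded λ i → 2 ^ s i
    eH = exp-2^ ps
    eZ : ExpBounded λ i → suc (n i) * 2 ^ s i
    eZ = exp-* (exp-poly pL) eH
    eW : ExpBounded λ i → wordBound (n i) (2 ^ s i) (s i)
    eW = exp-^ eZ ps
    eD : ExpBounded λ i → dirichletBound (suc (n i))
    eD = exp-^ (exp-poly (poly-suc (poly-+ (poly-* (poly-const 2) pL) (poly-* (poly-const 2) pL)))) pL
    eE : ExpBounded λ i → entryBound (n i) (wordBound (n i) (2 ^ s i) (s i))
    eE = exp-* (exp-* (exp-poly pL) (exp-* (exp-const 2) eD)) (exp-^ (exp-* (exp-poly pL) eW) (poly-+ pL pL))
    eB : ExpBounded λ i → 3 * periodBound (n i) (2 ^ s i) (s i)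
    eB = exp-* (exp-const 3) (exp-^ (exp-suc (exp-+ eE eE)) (poly-* pn pn))
    eX : ExpBounded λ i → iterBound (n i) (2 ^ s i) (s i)
    eX = exp-+ eW (exp-+ eE (exp-* (exp-const 2) (exp-* eB (exp-* (exp-poly pn) (exp-* eW eE)))))
    eC : ExpBounded λ i → condBound (n i) (2 ^ s i) (s i) (K i)
    eC = exp-* (exp-^ eZ (poly-suc ps)) (exp-* (exp-^ (exp-* (exp-poly (poly-suc pL)) eX) (poly-suc pK)) eH)
    eG : ExpBounded λ i → suc (2 * (suc (K i) * condBound (n i) (2 ^ s i) (s i) (K i))) ^ K i
    eG = exp-^ (exp-suc (exp-* (exp-const 2) (exp-* (exp-poly (poly-suc pK)) eC))) pK

module SmallIteration {nQ nAP n nR : ℕ} (S : CounterSystem nQ nAP n nR) (flat : Flat S) (finite : FiniteMonoid S)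
  (q₀ : Fin nQ) (v₀ : Vec ℤ n) (ρ : Run S) (starts : StartsIn S ρ (q₀ , v₀))
  (P : PathSchema nR) (m : Vec ℕ (length (pre P))) (schema : IsPathSchema S P) (valid : ValidIter (pre P) m)
  (word : ∀ k → Run.trans ρ k ≡ ipsWord P m k) where

  s H : ℕ
  s = sizeCS S + sizeVec v₀
  H = 2 ^ s

  us : List (Elem nR)
  us = pre P

  c : List⁺ (Fin nR)
  c = loop P

  oks : All (ElemOK S) (us ++ cy c ∷ [])
  oks = proj₁ schema

  1≤H : 1 ≤ H
  1≤H = ℕ.m^n>0 2 s

  nR+nQ≤s : nR + nQ ≤ s
  nR+nQ≤s = ℕ.≤-trans (nR+nQ≤sizeCS S) (ℕ.m≤m+n (sizeCS S) (sizeVec v₀))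

  small : ∀ δ → RuleBounded H (Δ S δ)
  small δ = sizeRule-RuleBounded (Δ S δ) (ℕ.≤-trans (sizeRule≤sizeCS S δ) (ℕ.m≤m+n (sizeCS S) (sizeVec v₀)))

  open Semantics S small
  open Acceleration S small
  open Bounded S small 1≤H s

  word≤s : ∀ {u} → ElemOK S u → length (elemWord u) ≤ s
  word≤s {rl δ} _              = ℕ.≤-trans (ℕ.≤-<-trans z≤n (Fin.toℕ<n δ)) (ℕ.≤-trans (ℕ.m≤m+n nR nQ) nR+nQ≤s)
  word≤s {cy d} (_ , uniq , _) = ℕ.≤-trans (Unique⇒length≤ uniq) (ℕ.≤-trans (ℕ.m≤m+n nR nQ) nR+nQ≤s)

  words≤s : All (λ u → length (elemWord u) ≤ s) (us ++ cy c ∷ [])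
  words≤s = All.map word≤s oks

  loopOK : SimpleCycle S c
  loopOK = All.lookup oks (∈-++⁺ʳ us (Any.here refl))

  parameters : Parameters
  parameters = record { n = n ; K = length us ; s = s
    ; n≤s = ℕ.≤-trans (n≤sizeCS S) (ℕ.m≤m+n (sizeCS S) (sizeVec v₀))
    ; K≤s = ℕ.≤-trans (ℕ.≤-trans (ℕ.m≤m+n (length us) 1) (ℕ.≤-reflexive (sym (List.length-++ us))))
        (ℕ.≤-trans (schema-length S flat (us ++ cy c ∷ []) oks (proj₁ (proj₂ schema))) nR+nQ≤s) }

  accelerate-all : ∀ us (ms : Vec ℕ (length us)) → All (ElemOK S) us → ValidIter us ms → AllAccelerated {X} {B} us ms
  accelerate-all []          []       _          _               = tt
  accelerate-all (rl δ ∷ us) (k ∷ ks) (ok ∷ oks) (k≡1 , valid) =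
    accelerate (rl δ) k k≡1 (λ _ ()) (word≤s {rl δ} tt) , accelerate-all us ks oks valid
  accelerate-all (cy d ∷ us) (k ∷ ks) (ok ∷ oks) (1≤k , valid) =
    accelerate (cy d) k 1≤k (λ { .d refl → periodic-word finite (List⁺.toList d) (word≤s {cy d} ok) }) (word≤s {cy d} ok) , accelerate-all us ks oks valid

  as : AllAccelerated {X} {B} us m
  as = accelerate-all us m (All.++⁻ˡ us oks) valid

  final-word : PeriodicWord (List⁺.toList c)
  final-word = periodic-word finite (List⁺.toList c) (word≤s {cy c} loopOK)

  -- The last cycle carries no count, so there is no residue to match and r = 0.
  final : Loop X (List⁺.toList c)
  final = periodic-loop final-word 0 z≤n

  original : Ok (prefixWord us m) v₀ × InfOk (cycleAt c) (exec S (prefixWord us m) v₀)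
  original = InfOk-infWord⁻ (prefixWord us m) c v₀ λ i →
    InfOk-cong word i (subst (λ γ → Sat (guard (Δ S (Run.trans ρ i))) (val (Run.trans ρ) (proj₂ γ) i)) starts (run⇒InfOk ρ i))

  originally-forever : ∀ j → Ok (List⁺.toList c) (iter (exec S (List⁺.toList c)) j (exec S (prefixWord us m) v₀))
  originally-forever = InfOk-cycle⁻ c _ (proj₂ original)

  R : ℕ
  R = condBound n H s (length us)

  1≤R : 1 ≤ R
  1≤R = ℕ.*-mono-≤ (1≤Z^ (suc s)) (ℕ.*-mono-≤ (ℕ.m^n>0 Φ {{ℕ.>-nonZero 1≤Φ}} (suc (length us))) 1≤H)

  -- Nonnegativity lets the unknowns be read as numbers of periods, and it is also what ends the
  -- descent in `SmallSolution`.
  Constraint : (Fin (length us) → ℤ) → Set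
  Constraint y = (∀ j → 0ℤ ℤ.≤ y j) × Cond c final us as y v₀

  system : Expressible R Constraint
  system = Expressible-× (Expressible-nonneg 1≤R)
    (Expressible-Cond c final (word≤s {cy c} loopOK) 1≤H us as (All.++⁻ˡ us words≤s) id
      (AffineIn-const v₀ λ i → bits≤⇒ (lookup v₀ i) (ℕ.≤-trans (bits≤sizeVec v₀ i) (ℕ.m≤n+m (sizeVec v₀) (sizeCS S)))))

  open Expressible system

  -- The original run shows that the system is solvable.
  solution : Σ (Fin (length us) → ℤ) λ y → All (Holds y) rows × (∀ j → ∣ y j ∣ ≤ smallBound (length us) R)
  solution = SmallSolution.small-solution rows 1≤R rows≤ (λ y h → proj₁ (from y h)) (+_ ∘ originals us as)
    (to (+_ ∘ originals us as) ((λ _ → ℤ.+≤+ z≤n) , Ok⇒Cond c final us as v₀ (proj₁ original) originally-forever))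

  y : Fin (length us) → ℤ
  y = proj₁ solution

  t : Fin (length us) → ℕ
  t i = ∣ y i ∣

  y-constraint : Constraint y
  y-constraint = from y (proj₁ (proj₂ solution))

  m′ : Vec ℕ (length us)
  m′ = counts us as t

  valid′ : ValidIter us m′
  valid′ = counts-valid us as t

  new : Ok (prefixWord us m′) v₀ × (∀ j → Ok (List⁺.toList c) (iter (exec S (List⁺.toList c)) j (exec S (prefixWord us m′) v₀)))
  new = Cond⇒Ok c final (PeriodicWord.1≤π final-word) (exec S (prefixWord us m) v₀) originally-forever us as t v₀
    (Cond-cong c final us as (λ i → sym (ℤ.0≤i⇒+∣i∣≡i (proj₁ y-constraint i))) v₀ (proj₂ y-constraint))

  path : ∀ ks → ValidIter us ks → Path (origin us c) (prefixWord us ks) (src (Δ S (List⁺.head c)))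
  path ks = Path-prefix us c ks oks (proj₂ (proj₂ schema))

  ρ′ : Run S
  ρ′ = InfOk⇒run (ipsWord P m′) v₀ (InfOk-infWord⁺ (prefixWord us m′) c v₀ (proj₁ new) (proj₂ new))
    (infWord-linked (prefixWord us m′) c loopOK (path m′ valid′))

  -- The first state is fixed by the path schema through `origin`, and the two runs share the
  -- schema.
  starts′ : StartsIn S ρ′ (q₀ , v₀)
  starts′ = cong (λ q → q , v₀) (begin
    src (Δ S (ipsWord P m′ 0))        ≡⟨ infWord-src (prefixWord us m′) c (path m′ valid′) ⟩
    origin us c                       ≡⟨ sym (infWord-src (prefixWord us m) c (path m valid)) ⟩
    src (Δ S (ipsWord P m 0))         ≡⟨ cong (λ δ → src (Δ S δ)) (sym (word 0)) ⟩
    src (Δ S (Run.trans ρ 0))         ≡⟨ proj₁ (Run.step ρ 0) ⟩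
    proj₁ (Run.conf ρ 0)              ≡⟨ cong proj₁ starts ⟩
    q₀                                ∎)
    where open ≡-Reasoning

  m′≤ : ‖ m′ ‖∞ ≤ iterationBound n (length us) s
  m′≤ = counts-bounded us as t (proj₂ (proj₂ solution))

theorem2 : ∃ λ (p : Poly) →
    ∀ {nQ nAP n nR : ℕ} (S : CounterSystem nQ nAP n nR) →
    RulesDistinct S → DeadlockFree S → Flat S → FiniteMonoid S →
    ∀ (q₀ : Fin nQ) (v₀ : Vec ℤ n) (ρ : Run S) → StartsIn S ρ (q₀ , v₀) →
    ∀ (P : PathSchema nR) (m : Vec ℕ (length (pre P))) → InIPS S ρ P m →
    Σ (Run S) λ ρ′ → StartsIn S ρ′ (q₀ , v₀) ×
    Σ (Vec ℕ (length (pre P))) λ m′ → InIPS S ρ′ P m′ ×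
    ‖ m′ ‖∞ ≤ 2 ^ evalPoly p (sizeCS S + sizeVec v₀)
theorem2 = proj₁ iterationBound-exponential , λ S _ _ flat finite q₀ v₀ ρ starts P m (schema , valid , word) →
  let open SmallIteration S flat finite q₀ v₀ ρ starts P m schema valid word in
  ρ′ , starts′ , m′ , (schema , valid′ , λ _ → refl) ,
  ℕ.≤-trans m′≤ (proj₂ iterationBound-exponential parameters)
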